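{- For every integer $r\geq 2$, with $p=p(n)\in[0,1]$: (i) if $p=\left(\frac{r\log n-\omega(1)}{n}\right)^{1/r}$ (where $\omega(1)$ denotes some function of $n$ tending to infinity), then asymptotically almost surely $\mathrm{tc}_r(G(n,p))> r$; (ii) if $p = o\left( \left(\frac{r\log n}{n}\right)^{1/r}\right)$, then asymptotically almost surely $\mathrm{tc}_r(G(n,p))\to \infty$, that is, for every constant $K$, $\Pr[\mathrm{tc}_r(G(n,p))>K]\to 1$ as $n\to\infty$.
   Context: $G(n,p)$ is the binomial random graph on $n$ vertices in which each pair is an edge independently with probability $p=p(n)$. A sequence of events $A_n$ holds asymptotically almost surely if $\Pr[A_n]\to 1$ as $n\to\infty$. $\log$ is the natural logarithm. The $r$-color tree-cover number $\mathrm{tc}_r(G)$ is the minimum $s$ such that for every $r$-coloring of the edges of $G$ (an arbitrary assignment of one of $r$ colors to each edge) there exists a collection of monochromatic connected subgraphs $\{H_1,\dots,H_t\}$ with $t\leq s$ such that $V(H_1)\cup\dots\cup V(H_t)=V(G)$. (A single vertex counts as a monochromatic connected subgraph.) -}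

module Defs where

open import Data.Bool using (Bool; true; false; if_then_else_)
import Data.Bool.Properties as Bool
open import Data.Fin using (Fin; zero; suc)
import Data.Fin.Properties as Fin
open import Data.Fin.Subset using (Subset; Nonempty; _∈_; ⁅_⁆)
open import Data.Fin.Subset.Properties using (_∈?_; nonempty?; x∈⁅x⁆; x∈⁅y⁆⇒x≡y)
open import Data.Integer using (+_; +[1+_])
import Data.Integer as ℤ
import Data.Integer.Properties as ℤ
open import Data.List using (List; []; _∷_; _++_; foldr; map; filter; allFin; cartesianProductWith)
open import Data.List.Membership.Propositional using (lose) renaming (_∈_ to _∈ₗ_)
open import Data.List.Membership.Propositional.Properties using (∈-cartesianProductWith⁺; ∈-allFin)
open import Data.List.Relation.Unary.All using (All)
import Data.List.Relation.Unary.All as All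
open import Data.List.Relation.Unary.Any using (here; there)
import Data.List.Relation.Unary.Any as Any
open import Data.Maybe using (Maybe; just; nothing)
import Data.Maybe.Properties as Maybe
open import Data.Nat using (ℕ; _≤′_; ≤′-reflexive; ≤′-step; zero; suc; NonZero; _≤_; _<_; _>_; z≤n; s≤s; _⊔_)
import Data.Nat as Nat
import Data.Nat.Properties as ℕ
open import Data.Product using (∃; ∃-syntax; _×_; _,_; proj₁; proj₂)
open import Data.Rational using (ℚ; 0ℚ; 1ℚ; ½; mkℚ; Positive; NonNegative)
import Data.Rational as ℚ
import Data.Rational.Properties as ℚ
import Data.Rational.Unnormalised as ℚᵘ
import Data.Rational.Unnormalised.Properties as ℚᵘ
open import Data.Rational.Solver using (module +-*-Solver)
open import Algebra.Definitions.RawSemiring ℚ.+-*-rawSemiring using () renaming (_^_ to _^ℚ_)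
open import Data.Sum using (_⊎_; inj₁; inj₂)
open import Data.Vec using (Vec; []; _∷_; lookup; toList; tabulate; replicate)
import Data.Vec.Relation.Unary.All as VAll
import Data.Vec.Relation.Unary.All.Properties as VAll
import Data.Vec.Relation.Unary.Any as VAny
import Data.Vec.Relation.Unary.Any.Properties as VAny
import Data.Vec.Properties as Vec
open import Function using (_∘_)
open import Relation.Binary.Construct.Closure.ReflexiveTransitive using (Star; ε; _◅_; _◅◅_)
open import Relation.Binary.PropositionalEquality
open import Relation.Nullary using (Dec; yes; no; ¬_; contradiction)
open import Relation.Nullary.Decidable using (map′; _×-dec_; _⊎-dec_; _→-dec_)
open import Relation.Unary using (Decidable)

Cauchy : (ℕ → ℚ) → Set
Cauchy s = ∀ δ → .{{Positive δ}} →
  ∃[ N ] (∀ m n → N ≤ m → N ≤ n → ℚ.∣ s m ℚ.- s n ∣ ℚ.≤ δ)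

-- Equality of reals is _≈ℝ_, not _≡_.
record ℝ : Set where
  constructor mkℝ
  field
    seq    : ℕ → ℚ
    cauchy : Cauchy seq

open ℝ public

infix 4 _≤ℝ_ _≈ℝ_ _Is_thRootOf_

_≤ℝ_ : ℝ → ℝ → Set
x ≤ℝ y = ∀ δ → .{{Positive δ}} →
  ∃[ N ] (∀ n → N ≤ n → seq x n ℚ.≤ seq y n ℚ.+ δ)

_≈ℝ_ : ℝ → ℝ → Set
x ≈ℝ y = x ≤ℝ y × y ≤ℝ x

fromℚ : ℚ → ℝ
fromℚ q = mkℝ (λ _ → q) λ δ → 0 , λ _ _ _ _ →
  subst (ℚ._≤ δ) (sym (cong ℚ.∣_∣ (ℚ.+-inverseʳ q))) (ℚ.<⇒≤ (ℚ.positive⁻¹ δ))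

fromℕ : ℕ → ℝ
fromℕ n = fromℚ (+ n ℚ./ 1)

0ℝ 1ℝ : ℝ
0ℝ = fromℚ 0ℚ
1ℝ = fromℚ 1ℚ

module _ where
  open +-*-Solver

  +-swap : ∀ a b c d → (a ℚ.+ b) ℚ.- (c ℚ.+ d) ≡ (a ℚ.- c) ℚ.+ (b ℚ.- d)
  +-swap = solve 4 (λ a b c d → (a :+ b) :- (c :+ d) := (a :- c) :+ (b :- d)) refl

  sub-add : ∀ a b → a ≡ (a ℚ.- b) ℚ.+ b
  sub-add = solve 2 (λ a b → a := (a :- b) :+ b) refl

  add-sub : ∀ a b → (a ℚ.+ b) ℚ.- b ≡ a
  add-sub = solve 2 (λ a b → (a :+ b) :- b := a) refl

  neg-sub : ∀ a b → ℚ.- (a ℚ.- b) ≡ b ℚ.- a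
  neg-sub = solve 2 (λ a b → :- (a :- b) := b :- a) refl

  *-diff : ∀ a b c d → a ℚ.* b ℚ.- c ℚ.* d ≡ a ℚ.* (b ℚ.- d) ℚ.+ d ℚ.* (a ℚ.- c)
  *-diff = solve 4 (λ a b c d → a :* b :- c :* d := a :* (b :- d) :+ d :* (a :- c)) refl

  collect : ∀ s p v a b →
    (s ℚ.+ p ℚ.* v) ℚ.+ b ℚ.* ((a ℚ.* p) ℚ.* v) ≡ s ℚ.+ (1ℚ ℚ.+ b ℚ.* a) ℚ.* (p ℚ.* v)
  collect = solve 5 (λ s p v a b →
    (s :+ p :* v) :+ b :* ((a :* p) :* v) := s :+ (con 1ℚ :+ b :* a) :* (p :* v)) refl

½+½ : ∀ d → ½ ℚ.* d ℚ.+ ½ ℚ.* d ≡ d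
½+½ d = trans (sym (ℚ.*-distribʳ-+ d ½ ½)) (ℚ.*-identityˡ d)

+-cauchy : ∀ s t → Cauchy s → Cauchy t → Cauchy (λ n → s n ℚ.+ t n)
+-cauchy s t cs ct δ = N₁ ⊔ N₂ , λ m n N≤m N≤n → begin
    ℚ.∣ (s m ℚ.+ t m) ℚ.- (s n ℚ.+ t n) ∣
      ≡⟨ cong ℚ.∣_∣ (+-swap (s m) (t m) (s n) (t n)) ⟩
    ℚ.∣ (s m ℚ.- s n) ℚ.+ (t m ℚ.- t n) ∣
      ≤⟨ ℚ.∣p+q∣≤∣p∣+∣q∣ (s m ℚ.- s n) (t m ℚ.- t n) ⟩
    ℚ.∣ s m ℚ.- s n ∣ ℚ.+ ℚ.∣ t m ℚ.- t n ∣
      ≤⟨ ℚ.+-mono-≤ (h₁ m n (ℕ.m⊔n≤o⇒m≤o N₁ N₂ N≤m) (ℕ.m⊔n≤o⇒m≤o N₁ N₂ N≤n))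
                    (h₂ m n (ℕ.m⊔n≤o⇒n≤o N₁ N₂ N≤m) (ℕ.m⊔n≤o⇒n≤o N₁ N₂ N≤n)) ⟩
    ½ ℚ.* δ ℚ.+ ½ ℚ.* δ ≡⟨ ½+½ δ ⟩
    δ ∎
  where
  open ℚ.≤-Reasoning
  instance
    half⁺ : Positive (½ ℚ.* δ)
    half⁺ = ℚ.pos*pos⇒pos ½ δ
  N₁ = proj₁ (cs (½ ℚ.* δ))
  h₁ = proj₂ (cs (½ ℚ.* δ))
  N₂ = proj₁ (ct (½ ℚ.* δ))
  h₂ = proj₂ (ct (½ ℚ.* δ))

neg-cauchy : ∀ s → Cauchy s → Cauchy (λ n → ℚ.- s n)
neg-cauchy s cs δ = proj₁ (cs δ) , λ m n N≤m N≤n → begin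
    ℚ.∣ ℚ.- s m ℚ.- (ℚ.- s n) ∣ ≡⟨ cong ℚ.∣_∣ (sym (ℚ.neg-distrib-+ (s m) (ℚ.- s n))) ⟩
    ℚ.∣ ℚ.- (s m ℚ.- s n) ∣     ≡⟨ ℚ.∣-p∣≡∣p∣ (s m ℚ.- s n) ⟩
    ℚ.∣ s m ℚ.- s n ∣           ≤⟨ proj₂ (cs δ) m n N≤m N≤n ⟩
    δ ∎
  where open ℚ.≤-Reasoning

abs-cauchy : ∀ s → Cauchy s → Cauchy (λ n → ℚ.∣ s n ∣)
abs-cauchy s cs δ = proj₁ (cs δ) , λ m n N≤m N≤n →
    ℚ.≤-trans (reverse (s m) (s n)) (proj₂ (cs δ) m n N≤m N≤n)
  where
  open ℚ.≤-Reasoning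
  half : ∀ a b → ℚ.∣ a ∣ ℚ.- ℚ.∣ b ∣ ℚ.≤ ℚ.∣ a ℚ.- b ∣
  half a b = begin
    ℚ.∣ a ∣ ℚ.- ℚ.∣ b ∣
      ≡⟨ cong (λ z → ℚ.∣ z ∣ ℚ.- ℚ.∣ b ∣) (sub-add a b) ⟩
    ℚ.∣ (a ℚ.- b) ℚ.+ b ∣ ℚ.- ℚ.∣ b ∣
      ≤⟨ ℚ.+-monoˡ-≤ (ℚ.- ℚ.∣ b ∣) (ℚ.∣p+q∣≤∣p∣+∣q∣ (a ℚ.- b) b) ⟩
    (ℚ.∣ a ℚ.- b ∣ ℚ.+ ℚ.∣ b ∣) ℚ.- ℚ.∣ b ∣
      ≡⟨ add-sub ℚ.∣ a ℚ.- b ∣ ℚ.∣ b ∣ ⟩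
    ℚ.∣ a ℚ.- b ∣ ∎
  reverse : ∀ a b → ℚ.∣ ℚ.∣ a ∣ ℚ.- ℚ.∣ b ∣ ∣ ℚ.≤ ℚ.∣ a ℚ.- b ∣
  reverse a b with ℚ.∣p∣≡p∨∣p∣≡-p (ℚ.∣ a ∣ ℚ.- ℚ.∣ b ∣)
  ... | inj₁ e = subst (ℚ._≤ ℚ.∣ a ℚ.- b ∣) (sym e) (half a b)
  ... | inj₂ e = begin
    ℚ.∣ ℚ.∣ a ∣ ℚ.- ℚ.∣ b ∣ ∣ ≡⟨ e ⟩
    ℚ.- (ℚ.∣ a ∣ ℚ.- ℚ.∣ b ∣) ≡⟨ neg-sub ℚ.∣ a ∣ ℚ.∣ b ∣ ⟩
    ℚ.∣ b ∣ ℚ.- ℚ.∣ a ∣       ≤⟨ half b a ⟩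
    ℚ.∣ b ℚ.- a ∣             ≡⟨ cong ℚ.∣_∣ (sym (neg-sub a b)) ⟩
    ℚ.∣ ℚ.- (a ℚ.- b) ∣       ≡⟨ ℚ.∣-p∣≡∣p∣ (a ℚ.- b) ⟩
    ℚ.∣ a ℚ.- b ∣ ∎

bounded : ∀ s → Cauchy s →
  ∃[ B ] Positive B × ∃[ N ] (∀ n → N ≤ n → ℚ.∣ s n ∣ ℚ.≤ B)
bounded s cs = 1ℚ ℚ.+ ℚ.∣ s N ∣
               , ℚ.pos+nonNeg⇒pos 1ℚ ℚ.∣ s N ∣ {{ℚ.∣-∣-nonNeg (s N)}}
               , N , λ n N≤n → begin
    ℚ.∣ s n ∣                     ≡⟨ cong ℚ.∣_∣ (sub-add (s n) (s N)) ⟩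
    ℚ.∣ (s n ℚ.- s N) ℚ.+ s N ∣   ≤⟨ ℚ.∣p+q∣≤∣p∣+∣q∣ (s n ℚ.- s N) (s N) ⟩
    ℚ.∣ s n ℚ.- s N ∣ ℚ.+ ℚ.∣ s N ∣ ≤⟨ ℚ.+-monoˡ-≤ ℚ.∣ s N ∣ (proj₂ (cs 1ℚ) n N N≤n ℕ.≤-refl) ⟩
    1ℚ ℚ.+ ℚ.∣ s N ∣ ∎
  where
  open ℚ.≤-Reasoning
  N = proj₁ (cs 1ℚ)

scale : ∀ C δ → Positive C → Positive δ → ∃[ η ] Positive η × C ℚ.* η ≡ δ
scale C δ C⁺ δ⁺ = q ℚ.* δ , ℚ.pos*pos⇒pos q {{q⁺}} δ {{δ⁺}} , (begin
    C ℚ.* (q ℚ.* δ)   ≡⟨ sym (ℚ.*-assoc C q δ) ⟩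
    (C ℚ.* q) ℚ.* δ   ≡⟨ cong (ℚ._* δ) (ℚ.*-inverseʳ C {{C≢0}}) ⟩
    1ℚ ℚ.* δ          ≡⟨ ℚ.*-identityˡ δ ⟩
    δ ∎)
  where
  open ≡-Reasoning
  C≢0 = ℚ.pos⇒nonZero C {{C⁺}}
  q = (ℚ.1/ C) {{C≢0}}
  q⁺ : Positive q
  q⁺ = ℚ.1/pos⇒pos C {{C⁺}}

*-bound : ∀ a d D η → Positive D → ℚ.∣ a ∣ ℚ.≤ D → ℚ.∣ d ∣ ℚ.≤ η → ℚ.∣ a ℚ.* d ∣ ℚ.≤ D ℚ.* η
*-bound a d D η D⁺ a≤ d≤ = begin
    ℚ.∣ a ℚ.* d ∣         ≡⟨ ℚ.∣p*q∣≡∣p∣*∣q∣ a d ⟩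
    ℚ.∣ a ∣ ℚ.* ℚ.∣ d ∣   ≤⟨ ℚ.*-monoʳ-≤-nonNeg ℚ.∣ d ∣ {{ℚ.∣-∣-nonNeg d}} {ℚ.∣ a ∣} {D} a≤ ⟩
    D ℚ.* ℚ.∣ d ∣         ≤⟨ ℚ.*-monoˡ-≤-nonNeg D {{ℚ.pos⇒nonNeg D {{D⁺}}}} {ℚ.∣ d ∣} {η} d≤ ⟩
    D ℚ.* η ∎
  where open ℚ.≤-Reasoning

*-close : ∀ a b c d A B η δ → Positive A → Positive B → (A ℚ.+ B) ℚ.* η ≡ δ →
  ℚ.∣ a ∣ ℚ.≤ A → ℚ.∣ d ∣ ℚ.≤ B → ℚ.∣ a ℚ.- c ∣ ℚ.≤ η → ℚ.∣ b ℚ.- d ∣ ℚ.≤ η →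
  ℚ.∣ a ℚ.* b ℚ.- c ℚ.* d ∣ ℚ.≤ δ
*-close a b c d A B η δ A⁺ B⁺ eq a≤ d≤ ac bd = begin
    ℚ.∣ a ℚ.* b ℚ.- c ℚ.* d ∣
      ≡⟨ cong ℚ.∣_∣ (*-diff a b c d) ⟩
    ℚ.∣ a ℚ.* (b ℚ.- d) ℚ.+ d ℚ.* (a ℚ.- c) ∣
      ≤⟨ ℚ.∣p+q∣≤∣p∣+∣q∣ (a ℚ.* (b ℚ.- d)) (d ℚ.* (a ℚ.- c)) ⟩
    ℚ.∣ a ℚ.* (b ℚ.- d) ∣ ℚ.+ ℚ.∣ d ℚ.* (a ℚ.- c) ∣
      ≤⟨ ℚ.+-mono-≤ (*-bound a (b ℚ.- d) A η A⁺ a≤ bd) (*-bound d (a ℚ.- c) B η B⁺ d≤ ac) ⟩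
    A ℚ.* η ℚ.+ B ℚ.* η ≡⟨ sym (ℚ.*-distribʳ-+ η A B) ⟩
    (A ℚ.+ B) ℚ.* η     ≡⟨ eq ⟩
    δ ∎
  where open ℚ.≤-Reasoning

Bounded : (ℕ → ℚ) → Set
Bounded s = ∃[ B ] Positive B × ∃[ N ] (∀ n → N ≤ n → ℚ.∣ s n ∣ ℚ.≤ B)

CloseAt : (ℕ → ℚ) → ℚ → Set
CloseAt s δ = ∃[ N ] (∀ m n → N ≤ m → N ≤ n → ℚ.∣ s m ℚ.- s n ∣ ℚ.≤ δ)

*-cauchy : ∀ s t → Cauchy s → Cauchy t → Cauchy (λ n → s n ℚ.* t n)
*-cauchy s t cs ct δ = step₁ (bounded s cs) (bounded t ct)
  where
  step₃ : ∀ A B η → Positive A → Positive B → (A ℚ.+ B) ℚ.* η ≡ δ →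
    ∀ M₁ → (∀ n → M₁ ≤ n → ℚ.∣ s n ∣ ℚ.≤ A) → ∀ M₂ → (∀ n → M₂ ≤ n → ℚ.∣ t n ∣ ℚ.≤ B) →
    CloseAt s η → CloseAt t η → CloseAt (λ n → s n ℚ.* t n) δ
  step₃ A B η A⁺ B⁺ eq M₁ b₁ M₂ b₂ (N₁ , h₁) (N₂ , h₂) = (N₁ ⊔ M₁) ⊔ (N₂ ⊔ M₂) , λ m n N≤m N≤n →
    let l≤m = ℕ.m⊔n≤o⇒m≤o (N₁ ⊔ M₁) (N₂ ⊔ M₂) N≤m
        r≤m = ℕ.m⊔n≤o⇒n≤o (N₁ ⊔ M₁) (N₂ ⊔ M₂) N≤m
        l≤n = ℕ.m⊔n≤o⇒m≤o (N₁ ⊔ M₁) (N₂ ⊔ M₂) N≤n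
        r≤n = ℕ.m⊔n≤o⇒n≤o (N₁ ⊔ M₁) (N₂ ⊔ M₂) N≤n
    in *-close (s m) (t m) (s n) (t n) A B η δ A⁺ B⁺ eq
         (b₁ m (ℕ.m⊔n≤o⇒n≤o N₁ M₁ l≤m)) (b₂ n (ℕ.m⊔n≤o⇒n≤o N₂ M₂ r≤n))
         (h₁ m n (ℕ.m⊔n≤o⇒m≤o N₁ M₁ l≤m) (ℕ.m⊔n≤o⇒m≤o N₁ M₁ l≤n))
         (h₂ m n (ℕ.m⊔n≤o⇒m≤o N₂ M₂ r≤m) (ℕ.m⊔n≤o⇒m≤o N₂ M₂ r≤n))
  step₂ : ∀ A B → Positive A → Positive B →
    ∀ M₁ → (∀ n → M₁ ≤ n → ℚ.∣ s n ∣ ℚ.≤ A) → ∀ M₂ → (∀ n → M₂ ≤ n → ℚ.∣ t n ∣ ℚ.≤ B) →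
    (∃[ η ] Positive η × (A ℚ.+ B) ℚ.* η ≡ δ) → CloseAt (λ n → s n ℚ.* t n) δ
  step₂ A B A⁺ B⁺ M₁ b₁ M₂ b₂ (η , η⁺ , eq) =
    step₃ A B η A⁺ B⁺ eq M₁ b₁ M₂ b₂ (cs η {{η⁺}}) (ct η {{η⁺}})
  step₁ : Bounded s → Bounded t → CloseAt (λ n → s n ℚ.* t n) δ
  step₁ (A , A⁺ , M₁ , b₁) (B , B⁺ , M₂ , b₂) =
    step₂ A B A⁺ B⁺ M₁ b₁ M₂ b₂
      (scale (A ℚ.+ B) δ (ℚ.pos+pos⇒pos A {{A⁺}} B {{B⁺}}) (ℚ.positive (ℚ.positive⁻¹ δ)))

infixl 6 _+ℝ_ _-ℝ_
infixl 7 _*ℝ_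
infixr 8 _^ℝ_

_+ℝ_ _*ℝ_ _-ℝ_ : ℝ → ℝ → ℝ
x +ℝ y = mkℝ (λ n → seq x n ℚ.+ seq y n) (+-cauchy (seq x) (seq y) (cauchy x) (cauchy y))
x *ℝ y = mkℝ (λ n → seq x n ℚ.* seq y n) (*-cauchy (seq x) (seq y) (cauchy x) (cauchy y))
x -ℝ y = mkℝ (λ n → seq x n ℚ.- seq y n)
  (+-cauchy (seq x) (λ n → ℚ.- seq y n) (cauchy x) (neg-cauchy (seq y) (cauchy y)))

∣_∣ℝ : ℝ → ℝ
∣ x ∣ℝ = mkℝ (λ n → ℚ.∣ seq x n ∣) (abs-cauchy (seq x) (cauchy x))

_^ℝ_ : ℝ → ℕ → ℝ
x ^ℝ zero  = 1ℝ
x ^ℝ suc n = x *ℝ x ^ℝ n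

_/ℝ_ : ℝ → (n : ℕ) → .{{NonZero n}} → ℝ
x /ℝ n = x *ℝ fromℚ (+ 1 ℚ./ n)

-- For r ≥ 1 this determines y = x^{1/r} uniquely, and forces x ≥ 0.
_Is_thRootOf_ : ℝ → ℕ → ℝ → Set
y Is r thRootOf x = 0ℝ ≤ℝ y × y ^ℝ r ≈ℝ x

sumℝ productℝ : List ℝ → ℝ
sumℝ     = foldr _+ℝ_ 0ℝ
productℝ = foldr _*ℝ_ 1ℝ

-- mercator x m = x + x²/2 + … + xᵐ/m, which tends to -log (1 - x) for 0 ≤ x < 1.
mercator : ℚ → ℕ → ℚ
mercator x zero    = 0ℚ
mercator x (suc m) = mercator x m ℚ.+ x ^ℚ suc m ℚ.* (+ 1 ℚ./ suc m)

toℚᵘ-/ : ∀ i n → ℚ.toℚᵘ (i ℚ./ suc n) ℚᵘ.≃ ℚᵘ.mkℚᵘ i n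
toℚᵘ-/ i n = ℚ.toℚᵘ-fromℚᵘ (ℚᵘ.mkℚᵘ i n)

1/-anti : ∀ m n → m ≤ n → + 1 ℚ./ suc n ℚ.≤ + 1 ℚ./ suc m
1/-anti m n m≤n = ℚ.toℚᵘ-cancel-≤
  (ℚᵘ.≤-respˡ-≃ (ℚᵘ.≃-sym {ℚ.toℚᵘ (+ 1 ℚ./ suc n)} (toℚᵘ-/ (+ 1) n))
  (ℚᵘ.≤-respʳ-≃ (ℚᵘ.≃-sym {ℚ.toℚᵘ (+ 1 ℚ./ suc m)} (toℚᵘ-/ (+ 1) m))
  (ℚᵘ.*≤* (ℤ.*-monoˡ-≤-nonNeg (+ 1) (ℤ.+≤+ (s≤s m≤n))))))

1/↧≤ : ∀ δ → .{{Positive δ}} → + 1 ℚ./ suc (ℚ.denominator-1 δ) ℚ.≤ δ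
1/↧≤ δ@(mkℚ +[1+ a ] d _) = ℚ.toℚᵘ-cancel-≤
  (ℚᵘ.≤-respˡ-≃ (ℚᵘ.≃-sym {ℚ.toℚᵘ (+ 1 ℚ./ suc d)} (toℚᵘ-/ (+ 1) d))
  (ℚᵘ.*≤* (ℤ.*-monoʳ-≤-nonNeg (+ suc d) {+ 1} {+[1+ a ]} (ℤ.+≤+ (s≤s z≤n)))))

module Log (x : ℚ) (0≤x : NonNegative x) (x≤1 : x ℚ.≤ 1ℚ)
           (c : ℚ) (c⁺ : Positive c) (c-cx : 1ℚ ℚ.+ c ℚ.* x ≡ c) where
  open ℚ.≤-Reasoning

  c⁰ : NonNegative c
  c⁰ = ℚ.pos⇒nonNeg c {{c⁺}}

  pow⁺ : ∀ m → NonNegative (x ^ℚ m)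
  pow⁺ zero    = _
  pow⁺ (suc m) = ℚ.nonNeg*nonNeg⇒nonNeg x {{0≤x}} (x ^ℚ m) {{pow⁺ m}}

  pow≤1 : ∀ m → x ^ℚ m ℚ.≤ 1ℚ
  pow≤1 zero    = ℚ.≤-refl
  pow≤1 (suc m) = begin
    x ℚ.* x ^ℚ m  ≤⟨ ℚ.*-monoˡ-≤-nonNeg x {{0≤x}} {x ^ℚ m} {1ℚ} (pow≤1 m) ⟩
    x ℚ.* 1ℚ      ≡⟨ ℚ.*-identityʳ x ⟩
    x             ≤⟨ x≤1 ⟩
    1ℚ ∎

  u : ℕ → ℚ
  u m = + 1 ℚ./ suc m

  u⁺ : ∀ m → NonNegative (u m)
  u⁺ m = ℚ.normalize-nonNeg 1 (suc m)

  term : ℕ → ℚ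
  term m = x ^ℚ suc m ℚ.* u m

  term⁺ : ∀ m → NonNegative (term m)
  term⁺ m = ℚ.nonNeg*nonNeg⇒nonNeg (x ^ℚ suc m) {{pow⁺ (suc m)}} (u m) {{u⁺ m}}

  term≤ : ∀ N m → N ≤ m → term m ℚ.≤ u N
  term≤ N m N≤m = begin
    x ^ℚ suc m ℚ.* u m ≤⟨ ℚ.*-monoʳ-≤-nonNeg (u m) {{u⁺ m}} {x ^ℚ suc m} {1ℚ} (pow≤1 (suc m)) ⟩
    1ℚ ℚ.* u m         ≡⟨ ℚ.*-identityˡ (u m) ⟩
    u m                ≤⟨ 1/-anti N m N≤m ⟩
    u N ∎

  S T : ℕ → ℚ
  S = mercator x
  T m = S m ℚ.+ c ℚ.* term m

  ≤-add : ∀ p q → NonNegative q → p ℚ.≤ p ℚ.+ q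
  ≤-add p q q⁺ = begin
    p        ≡⟨ sym (ℚ.+-identityʳ p) ⟩
    p ℚ.+ 0ℚ ≤⟨ ℚ.+-monoʳ-≤ p {0ℚ} {q} (ℚ.nonNegative⁻¹ q {{q⁺}}) ⟩
    p ℚ.+ q ∎

  S-step : ∀ m → S m ℚ.≤ S (suc m)
  S-step m = ≤-add (S m) (term m) (term⁺ m)

  S≤T : ∀ m → S m ℚ.≤ T m
  S≤T m = ≤-add (S m) (c ℚ.* term m) (ℚ.nonNeg*nonNeg⇒nonNeg c {{c⁰}} (term m) {{term⁺ m}})

  T-aux : ∀ s p v w → NonNegative p → w ℚ.≤ v →
    (s ℚ.+ p ℚ.* v) ℚ.+ c ℚ.* ((x ℚ.* p) ℚ.* w) ℚ.≤ s ℚ.+ c ℚ.* (p ℚ.* v)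
  T-aux s p v w p⁺ w≤v = begin
    (s ℚ.+ p ℚ.* v) ℚ.+ c ℚ.* ((x ℚ.* p) ℚ.* w)
      ≤⟨ ℚ.+-monoʳ-≤ (s ℚ.+ p ℚ.* v) {c ℚ.* ((x ℚ.* p) ℚ.* w)} {c ℚ.* ((x ℚ.* p) ℚ.* v)}
           (ℚ.*-monoˡ-≤-nonNeg c {{c⁰}} {(x ℚ.* p) ℚ.* w} {(x ℚ.* p) ℚ.* v}
             (ℚ.*-monoˡ-≤-nonNeg (x ℚ.* p) {{ℚ.nonNeg*nonNeg⇒nonNeg x {{0≤x}} p {{p⁺}}}} {w} {v} w≤v)) ⟩
    (s ℚ.+ p ℚ.* v) ℚ.+ c ℚ.* ((x ℚ.* p) ℚ.* v) ≡⟨ collect s p v x c ⟩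
    s ℚ.+ (1ℚ ℚ.+ c ℚ.* x) ℚ.* (p ℚ.* v)
      ≡⟨ cong (λ z → s ℚ.+ z ℚ.* (p ℚ.* v)) c-cx ⟩
    s ℚ.+ c ℚ.* (p ℚ.* v) ∎

  T-step : ∀ m → T (suc m) ℚ.≤ T m
  T-step m = T-aux (S m) (x ^ℚ suc m) (u m) (u (suc m)) (pow⁺ (suc m)) (1/-anti m (suc m) (ℕ.n≤1+n m))

  S-mono : ∀ {a b} → a ≤′ b → S a ℚ.≤ S b
  S-mono {a} (≤′-reflexive e) = ℚ.≤-reflexive (cong S e)
  S-mono {a} (≤′-step {b} p)  = ℚ.≤-trans {S a} {S b} {S (suc b)} (S-mono p) (S-step b)

  T-anti : ∀ {a b} → a ≤′ b → T b ℚ.≤ T a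
  T-anti {a} (≤′-reflexive e) = ℚ.≤-reflexive (cong T (sym e))
  T-anti {a} (≤′-step {b} p)  = ℚ.≤-trans {T (suc b)} {T b} {T a} (T-step b) (T-anti p)

  gap : ∀ s t e → s ℚ.≤ t → t ℚ.≤ s ℚ.+ e → ℚ.∣ t ℚ.- s ∣ ℚ.≤ e
  gap s t e s≤t t≤ = begin
    ℚ.∣ t ℚ.- s ∣   ≡⟨ ℚ.0≤p⇒∣p∣≡p 0≤t-s ⟩
    t ℚ.- s         ≤⟨ ℚ.+-monoˡ-≤ (ℚ.- s) {t} {s ℚ.+ e} t≤ ⟩
    s ℚ.+ e ℚ.- s   ≡⟨ cong (ℚ._- s) (ℚ.+-comm s e) ⟩
    e ℚ.+ s ℚ.- s   ≡⟨ add-sub e s ⟩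
    e ∎
    where
    0≤t-s : 0ℚ ℚ.≤ t ℚ.- s
    0≤t-s = begin
      0ℚ      ≡⟨ sym (ℚ.+-inverseʳ s) ⟩
      s ℚ.- s ≤⟨ ℚ.+-monoˡ-≤ (ℚ.- s) {s} {t} s≤t ⟩
      t ℚ.- s ∎

  ordered : ∀ N a b → N ≤ a → a ≤ b → ℚ.∣ S b ℚ.- S a ∣ ℚ.≤ c ℚ.* u N
  ordered N a b N≤a a≤b = gap (S a) (S b) (c ℚ.* u N) (S-mono (ℕ.≤⇒≤′ a≤b)) (begin
    S b                     ≤⟨ S≤T b ⟩
    T b                     ≤⟨ T-anti (ℕ.≤⇒≤′ a≤b) ⟩
    S a ℚ.+ c ℚ.* term a    ≤⟨ ℚ.+-monoʳ-≤ (S a) {c ℚ.* term a} {c ℚ.* u N}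
                                 (ℚ.*-monoˡ-≤-nonNeg c {{c⁰}} {term a} {u N} (term≤ N a N≤a)) ⟩
    S a ℚ.+ c ℚ.* u N ∎)

  close : ∀ N a b → N ≤ a → N ≤ b → ℚ.∣ S a ℚ.- S b ∣ ℚ.≤ c ℚ.* u N
  close N a b N≤a N≤b with ℕ.≤-total a b
  ... | inj₂ b≤a = ordered N b a N≤b b≤a
  ... | inj₁ a≤b = subst (ℚ._≤ c ℚ.* u N)
    (trans (sym (ℚ.∣-p∣≡∣p∣ (S b ℚ.- S a))) (cong ℚ.∣_∣ (neg-sub (S b) (S a))))
    (ordered N a b N≤a a≤b)

  S-cauchy′ : ∀ δ → (∃[ η ] Positive η × c ℚ.* η ≡ δ) → CloseAt S δ
  S-cauchy′ δ (η , η⁺ , eq) = N , λ a b N≤a N≤b → begin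
    ℚ.∣ S a ℚ.- S b ∣ ≤⟨ close N a b N≤a N≤b ⟩
    c ℚ.* u N         ≤⟨ ℚ.*-monoˡ-≤-nonNeg c {{c⁰}} {u N} {η} (1/↧≤ η {{η⁺}}) ⟩
    c ℚ.* η           ≡⟨ eq ⟩
    δ ∎
    where N = ℚ.denominator-1 η

  S-cauchy : Cauchy S
  S-cauchy δ = S-cauchy′ δ (scale c δ c⁺ (ℚ.positive (ℚ.positive⁻¹ δ)))

mercator-cauchy : ∀ k → Cauchy (mercator (+ k ℚ./ suc k))
mercator-cauchy k = Log.S-cauchy x (ℚ.normalize-nonNeg k (suc k)) x≤1 c (ℚ.normalize-pos (suc k) 1) eq
  where
  x = + k ℚ./ suc k
  c = + suc k ℚ./ 1
  x≤1 : x ℚ.≤ 1ℚ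
  x≤1 = ℚ.toℚᵘ-cancel-≤ (ℚᵘ.≤-respˡ-≃ (ℚᵘ.≃-sym {ℚ.toℚᵘ x} (toℚᵘ-/ (+ k) k))
    (ℚᵘ.*≤* (subst₂ ℤ._≤_ (sym (ℤ.*-identityʳ (+ k))) (sym (ℤ.*-identityˡ (+ suc k)))
      (ℤ.+≤+ (ℕ.n≤1+n k)))))
  cx : c ℚ.* x ≡ + k ℚ./ 1
  cx = ℚ.toℚᵘ-injective (ℚᵘ.≃-trans (ℚ.toℚᵘ-homo-* c x)
    (ℚᵘ.≃-trans (ℚᵘ.*-cong (toℚᵘ-/ (+ suc k) 0) (toℚᵘ-/ (+ k) k))
    (ℚᵘ.≃-trans (ℚᵘ.*≡* cross) (ℚᵘ.≃-sym {ℚ.toℚᵘ (+ k ℚ./ 1)} (toℚᵘ-/ (+ k) 0)))))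
    where
    cross : (+ suc k ℤ.* + k) ℤ.* + 1 ≡ + k ℤ.* + suc (k Nat.+ 0)
    cross = trans (ℤ.*-identityʳ (+ suc k ℤ.* + k)) (trans (ℤ.*-comm (+ suc k) (+ k))
      (cong (λ z → + k ℤ.* + suc z) (sym (ℕ.+-identityʳ k))))
  eq : 1ℚ ℚ.+ c ℚ.* x ≡ c
  eq = trans (cong (1ℚ ℚ.+_) cx) (ℚ.toℚᵘ-injective (ℚᵘ.≃-trans (ℚ.toℚᵘ-homo-+ 1ℚ (+ k ℚ./ 1))
    (ℚᵘ.≃-trans (ℚᵘ.+-congʳ (ℚ.toℚᵘ 1ℚ) (toℚᵘ-/ (+ k) 0))
    (ℚᵘ.≃-trans (ℚᵘ.*≡* cross) (ℚᵘ.≃-sym {ℚ.toℚᵘ c} (toℚᵘ-/ (+ suc k) 0))))))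
    where
    cross : (+ 1 ℤ.* + 1 ℤ.+ + k ℤ.* + 1) ℤ.* + 1 ≡ + suc k ℤ.* + 1
    cross = cong (ℤ._* + 1) (cong (λ z → + 1 ℤ.+ z) (ℤ.*-identityʳ (+ k)))

-- log n = -log (1 - (n-1)/n)
log : (n : ℕ) → .{{NonZero n}} → ℝ
log (suc k) = mkℝ (mercator (+ k ℚ./ suc k)) (mercator-cauchy k)

infix 4 _⟶_ _⟶∞ _=o_

_⟶_ : (ℕ → ℝ) → ℝ → Set
x ⟶ a = ∀ δ → .{{Positive δ}} → ∃[ N ] (∀ n → N ≤ n → ∣ x n -ℝ a ∣ℝ ≤ℝ fromℚ δ)

_⟶∞ : (ℕ → ℝ) → Set
x ⟶∞ = ∀ M → ∃[ N ] (∀ n → N ≤ n → fromℚ M ≤ℝ x n)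

_=o_ : (ℕ → ℝ) → (ℕ → ℝ) → Set
f =o g = ∀ δ → .{{Positive δ}} → ∃[ N ] (∀ n → N ≤ n → ∣ f n ∣ℝ ≤ℝ fromℚ δ *ℝ ∣ g n ∣ℝ)

-- One entry of A for every unordered pair of distinct elements of Fin n:
-- the row added at stage n holds the entries of the pairs {0 , 1 + j}.
infixl 5 _▹_

data Triangle (A : Set) : ℕ → Set where
  []  : Triangle A 0
  _▹_ : ∀ {n} → Triangle A n → Vec A n → Triangle A (suc n)

module _ {A : Set} where

  entry : ∀ {n} → Triangle A n → Fin n → Fin n → Maybe A
  entry (t ▹ row) zero    zero    = nothing
  entry (t ▹ row) zero    (suc j) = just (lookup row j)
  entry (t ▹ row) (suc i) zero    = just (lookup row i)
  entry (t ▹ row) (suc i) (suc j) = entry t i j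

  entries : ∀ {n} → Triangle A n → List A
  entries []        = []
  entries (t ▹ row) = entries t ++ toList row

Graph : ℕ → Set
Graph = Triangle Bool

Adj : ∀ {n} → Graph n → Fin n → Fin n → Set
Adj G u v = entry G u v ≡ just true

-- An edge colouring of G is given by a colouring of all pairs, of which only
-- the values at edges of G are ever used.
Coloring : ℕ → ℕ → Set
Coloring r = Triangle (Fin r)

record Subgraph (n : ℕ) : Set where
  constructor subgraph
  field
    vertices : Subset n
    edges    : Graph n

open Subgraph public

_IsSubgraphOf_ : ∀ {n} → Subgraph n → Graph n → Set
H IsSubgraphOf G = ∀ u v → Adj (edges H) u v → Adj G u v × u ∈ vertices H × v ∈ vertices H

Connected : ∀ {n} → Subgraph n → Set
Connected H = Nonempty (vertices H) ×
  (∀ u v → u ∈ vertices H → v ∈ vertices H → Star (Adj (edges H)) u v)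

Monochromatic : ∀ {r n} → Coloring r n → Subgraph n → Set
Monochromatic χ H = ∀ u v u′ v′ →
  Adj (edges H) u v → Adj (edges H) u′ v′ → entry χ u v ≡ entry χ u′ v′

IsPiece : ∀ {r n} → Graph n → Coloring r n → Subgraph n → Set
IsPiece G χ H = H IsSubgraphOf G × Connected H × Monochromatic χ H

IsTreeCover : ∀ {r n t} → Graph n → Coloring r n → Vec (Subgraph n) t → Set
IsTreeCover G χ Hs = VAll.All (IsPiece G χ) Hs × (∀ v → VAny.Any (λ H → v ∈ vertices H) Hs)

HasTreeCovers : (r : ℕ) {n : ℕ} → Graph n → ℕ → Set
HasTreeCovers r {n} G s = (χ : Coloring r n) →
  ∃[ t ] t < suc s × ∃ λ (Hs : Vec (Subgraph n) t) → IsTreeCover G χ Hs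

module _ {A : Set} (xs : List A) where

  allVecs : ∀ n → List (Vec A n)
  allVecs zero    = [] ∷ []
  allVecs (suc n) = cartesianProductWith _∷_ xs (allVecs n)

  allTriangles : ∀ n → List (Triangle A n)
  allTriangles zero    = [] ∷ []
  allTriangles (suc n) = cartesianProductWith _▹_ (allTriangles n) (allVecs n)

allBools : List Bool
allBools = true ∷ false ∷ []

allGraphs : ∀ n → List (Graph n)
allGraphs = allTriangles allBools

Complete : {A : Set} → List A → Set
Complete xs = ∀ a → a ∈ₗ xs

allVecs-complete : ∀ {A : Set} {xs : List A} → Complete xs → ∀ n → Complete (allVecs xs n)
allVecs-complete c zero    []      = here refl
allVecs-complete c (suc n) (a ∷ v) = ∈-cartesianProductWith⁺ _∷_ (c a) (allVecs-complete c n v)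

allTriangles-complete : ∀ {A : Set} {xs : List A} → Complete xs → ∀ n → Complete (allTriangles xs n)
allTriangles-complete c zero    []        = here refl
allTriangles-complete c (suc n) (t ▹ row) =
  ∈-cartesianProductWith⁺ _▹_ (allTriangles-complete c n t) (allVecs-complete c n row)

allBools-complete : Complete allBools
allBools-complete true  = here refl
allBools-complete false = there (here refl)

allSubgraphs : ∀ n → List (Subgraph n)
allSubgraphs n = cartesianProductWith subgraph (allVecs allBools n) (allGraphs n)

allSubgraphs-complete : ∀ n → Complete (allSubgraphs n)
allSubgraphs-complete n (subgraph V E) = ∈-cartesianProductWith⁺ subgraph
  (allVecs-complete allBools-complete n V) (allTriangles-complete allBools-complete n E)

∃? : ∀ {A : Set} {xs : List A} {P : A → Set} → Complete xs → Decidable P → Dec (∃ P)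
∃? {xs = xs} c P? = map′ Any.satisfied (λ (a , p) → lose (c a) p) (Any.any? P? xs)

∀? : ∀ {A : Set} {xs : List A} {P : A → Set} → Complete xs → Decidable P → Dec (∀ a → P a)
∀? {xs = xs} c P? = map′ (λ ps a → All.lookup ps (c a)) (λ f → All.universal f xs) (All.all? P? xs)

-- Via xs u v: v is reachable from u with all intermediate vertices in xs.
module Reach {n : ℕ} (R : Fin n → Fin n → Set) (R? : ∀ u v → Dec (R u v)) where

  Via : List (Fin n) → Fin n → Fin n → Set
  Via []       u v = u ≡ v ⊎ R u v
  Via (x ∷ xs) u v = Via xs u v ⊎ (Via xs u x × Via xs x v)

  via? : ∀ xs u v → Dec (Via xs u v)
  via? []       u v = (u Fin.≟ v) ⊎-dec R? u v
  via? (x ∷ xs) u v = via? xs u v ⊎-dec (via? xs u x ×-dec via? xs x v)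

  weaken : ∀ xs {u v} → u ≡ v ⊎ R u v → Via xs u v
  weaken []       p = p
  weaken (x ∷ xs) p = inj₁ (weaken xs p)

  sound : ∀ xs {u v} → Via xs u v → Star R u v
  sound []       (inj₁ refl)    = ε
  sound []       (inj₂ r)       = r ◅ ε
  sound (x ∷ xs) (inj₁ p)       = sound xs p
  sound (x ∷ xs) (inj₂ (p , q)) = sound xs p ◅◅ sound xs q

  into : ∀ xs {x u} → Via (x ∷ xs) u x → Via xs u x
  into xs (inj₁ p)       = p
  into xs (inj₂ (p , _)) = p

  outof : ∀ xs {x v} → Via (x ∷ xs) x v → Via xs x v
  outof xs (inj₁ p)       = p
  outof xs (inj₂ (_ , p)) = p

  join : ∀ {xs w u v} → w ∈ₗ xs → Via xs u w → Via xs w v → Via xs u v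
  join {x ∷ xs} (here refl) p q = inj₂ (into xs p , outof xs q)
  join (there w∈) (inj₁ p)        (inj₁ q)        = inj₁ (join w∈ p q)
  join (there w∈) (inj₁ p)        (inj₂ (q₁ , q₂)) = inj₂ (join w∈ p q₁ , q₂)
  join (there w∈) (inj₂ (p₁ , p₂)) (inj₁ q)        = inj₂ (p₁ , join w∈ p₂ q)
  join (there w∈) (inj₂ (p₁ , p₂)) (inj₂ (q₁ , q₂)) = inj₂ (p₁ , q₂)

  complete : ∀ {u v} → Star R u v → Via (allFin n) u v
  complete ε            = weaken (allFin n) (inj₁ refl)
  complete (_◅_ {j = w} r rs) = join (∈-allFin w) (weaken (allFin n) (inj₂ r)) (complete rs)

  star? : ∀ u v → Dec (Star R u v)
  star? u v = map′ (sound (allFin n)) complete (via? (allFin n) u v)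

adj? : ∀ {n} (G : Graph n) u v → Dec (Adj G u v)
adj? G u v = Maybe.≡-dec Bool._≟_ (entry G u v) (just true)

isPiece? : ∀ {r n} (G : Graph n) (χ : Coloring r n) → Decidable (IsPiece G χ)
isPiece? G χ H =
  Fin.all? (λ u → Fin.all? λ v → adj? E u v →-dec (adj? G u v ×-dec (u ∈? V ×-dec v ∈? V)))
  ×-dec (nonempty? V ×-dec
    Fin.all? λ u → Fin.all? λ v → u ∈? V →-dec (v ∈? V →-dec Reach.star? (Adj E) (adj? E) u v))
  ×-dec Fin.all? λ u → Fin.all? λ v → Fin.all? λ u′ → Fin.all? λ v′ →
    adj? E u v →-dec (adj? E u′ v′ →-dec Maybe.≡-dec Fin._≟_ (entry χ u v) (entry χ u′ v′))
  where
  V = vertices H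
  E = edges H

isTreeCover? : ∀ {r n t} (G : Graph n) (χ : Coloring r n) → Decidable (IsTreeCover {t = t} G χ)
isTreeCover? G χ Hs = VAll.all? (isPiece? G χ) Hs
  ×-dec Fin.all? λ v → VAny.any? (λ H → v ∈? vertices H) Hs

hasTreeCovers? : ∀ r {n} (G : Graph n) → Decidable (HasTreeCovers r G)
hasTreeCovers? r {n} G s = ∀? (allTriangles-complete ∈-allFin n) λ χ →
  ℕ.anyUpTo? (λ t → ∃? (allVecs-complete (allSubgraphs-complete n) t) (isTreeCover? G χ)) (suc s)

IsLeast : (ℕ → Set) → ℕ → Set
IsLeast P s = P s × (∀ m → P m → s ≤ m)

least : (P : ℕ → Set) → Decidable P → ∀ b → P b → ∃ (IsLeast P)
least P P? zero    p = 0 , p , λ _ _ → z≤n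
least P P? (suc b) p with P? 0
... | yes p₀ = 0 , p₀ , λ _ _ → z≤n
... | no ¬p₀ with least (P ∘ suc) (P? ∘ suc) b p
...   | s , q , min = suc s , q , λ where
          zero    p₀ → contradiction p₀ ¬p₀
          (suc m) pm → s≤s (min m pm)

noEdges : ∀ n → Graph n
noEdges zero    = []
noEdges (suc n) = noEdges n ▹ replicate n false

noEdges-¬Adj : ∀ {n} (u v : Fin n) → ¬ Adj (noEdges n) u v
noEdges-¬Adj zero    zero    ()
noEdges-¬Adj zero    (suc v) e with () ← trans (sym (Vec.lookup-replicate v false)) (Maybe.just-injective e)
noEdges-¬Adj (suc u) zero    e with () ← trans (sym (Vec.lookup-replicate u false)) (Maybe.just-injective e)
noEdges-¬Adj (suc u) (suc v) e = noEdges-¬Adj u v e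

singletons-cover : ∀ r {n} (G : Graph n) → HasTreeCovers r G n
singletons-cover r {n} G χ = n , ℕ.n<1+n n , tabulate single
  , VAll.tabulate⁺ piece , λ v → VAny.tabulate⁺ v (x∈⁅x⁆ v)
  where
  single : Fin n → Subgraph n
  single v = subgraph ⁅ v ⁆ (noEdges n)
  piece : ∀ v → IsPiece G χ (single v)
  piece v = (λ a b e → contradiction e (noEdges-¬Adj a b))
    , ((v , x∈⁅x⁆ v) , λ a b a∈ b∈ → subst₂ (Star _) (sym (x∈⁅y⁆⇒x≡y v a∈)) (sym (x∈⁅y⁆⇒x≡y v b∈)) ε)
    , λ a b _ _ e _ → contradiction e (noEdges-¬Adj a b)

least-cover : ∀ r {n} (G : Graph n) → ∃ (IsLeast (HasTreeCovers r G))
least-cover r {n} G = least (HasTreeCovers r G) (hasTreeCovers? r G) n (singletons-cover r G)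

tc : (r : ℕ) {n : ℕ} → Graph n → ℕ
tc r G = proj₁ (least-cover r G)

tc-isLeast : ∀ r {n} (G : Graph n) → IsLeast (HasTreeCovers r G) (tc r G)
tc-isLeast r G = proj₂ (least-cover r G)

weight : ∀ {n} → ℝ → Graph n → ℝ
weight p G = productℝ (map (λ b → if b then p else 1ℝ -ℝ p) (entries G))

-- allGraphs n lists every graph exactly once.
Pr : ∀ {n} {A : Graph n → Set} → ℝ → Decidable A → ℝ
Pr {n} p A? = sumℝ (map (weight p) (filter A? (allGraphs n)))

AsymptoticallyAlmostSurely : (ℕ → ℝ) → {A : ∀ n → Graph n → Set} → (∀ n → Decidable (A n)) → Set
AsymptoticallyAlmostSurely p A? = (λ n → Pr (p n) (A? n)) ⟶ 1ℝ

tc>? : ∀ r K n → Decidable (λ (G : Graph n) → tc r G > K)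
tc>? r K n G = tc r G ℕ.>? K

{-# OPTIONS --safe #-}

-- Let X be a set of t vertices and z a further vertex such that X ∪ {z} is independent and every
-- other vertex has fewer than r neighbours in X. Let each vertex outside X give distinct colours
-- below r - 1 to its edges into X, and give all remaining edges the last colour. Then a
-- monochromatic connected subgraph meets X ∪ {z} in at most one vertex, so that tc_r > t.
--
-- Such sets exist a.a.s. by the second moment method, applied to the sets X with one vertex in each
-- of t disjoint parts of the vertex set. With v the probability that a fixed vertex has fewer than r
-- neighbours in X, the expected number of good sets is of order n^t v^n. In (i), t = r and
-- v = 1 - p^r, and n^r (1 - p^r)^n tends to infinity with ω. In (ii), t is arbitrary and v^n ≥ (4n)^{-1/2}.
-- The pairs of sets that intersect contribute a vanishing proportion of the second moment.
--
-- All estimates are made for the k-th rational approximations of p(n) and log n, with k large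
-- depending on n. About the approximations L of log n only (1 + L/N)^N ≤ 4n for all N is used.

module Submission where

open import Defs
open import Data.Bool using (Bool; true; false; if_then_else_; _∨_; not)
import Data.Bool as Bool
import Data.Bool.Properties as Bool
open import Data.Fin using (Fin; zero; suc)
import Data.Fin as Fin
import Data.Fin.Properties as Fin
open import Data.Fin.Subset using (_∈_)
open import Data.Integer using () renaming (+_ to pos)
import Data.Integer as ℤ
import Data.Integer.Properties as ℤ
open import Data.List using (List; []; _∷_; _++_; map; filter; length; allFin; cartesianProductWith)
import Data.List as List
open import Data.List.Membership.Propositional using () renaming (_∈_ to _∈ₗ_)
open import Data.List.Membership.Propositional.Properties
  using (∈-cartesianProduct⁺; ∈-cartesianProduct⁻; ∈-tabulate⁺; ∈-tabulate⁻; ∈-++⁺ˡ; ∈-++⁺ʳ; ∈-allFin)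
import Data.List.Properties as List
open import Data.List.Relation.Unary.All using (All; []; _∷_)
open import Data.List.Relation.Unary.AllPairs using ([]; _∷_)
open import Data.List.Relation.Unary.Any using (here; there)
open import Data.List.Relation.Unary.Unique.Propositional using (Unique)
import Data.List.Relation.Unary.Unique.Propositional.Properties as Unique
open import Data.Maybe using (just)
import Data.Maybe.Properties as Maybe
open import Data.Nat using (ℕ; zero; suc; _≤_; _⊔_; NonZero)
import Data.Nat as Nat
import Data.Nat.DivMod as ℕ
import Data.Nat.Properties as ℕ
open import Data.Product using (_×_; _,_; proj₁; proj₂; ∃-syntax)
open import Data.Rational using (ℚ; 0ℚ; 1ℚ; ½; _+_; _*_; _-_; -_)
  renaming (_≤_ to _≤ℚ_; _<_ to _<ℚ_)
import Data.Rational as ℚ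
import Data.Rational.Properties as ℚ
open import Data.Rational.Properties using (≤-refl; ≤-reflexive; ≤-trans; <⇒≤; positive⁻¹; nonNegative⁻¹; neg-antimono-≤;
  +-identityˡ; +-identityʳ; +-mono-≤; +-monoˡ-≤; +-monoʳ-≤;
  *-assoc; *-comm; *-identityˡ; *-identityʳ; *-zeroˡ; *-zeroʳ)
open import Data.Rational.Solver using (module +-*-Solver)
open +-*-Solver using (solve; _:=_; con; _:+_; _:*_; _:-_; :-_)
import Data.Rational.Unnormalised as ℚᵘ
import Data.Rational.Unnormalised.Properties as ℚᵘ
open import Data.Sum using (_⊎_; inj₁; inj₂)
open import Data.Vec using (Vec; []; _∷_; lookup; toList; tabulate)
import Data.Vec.Properties as Vec
import Data.Vec.Relation.Unary.All.Properties as VAll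
import Data.Vec.Relation.Unary.Any as VAny
import Data.Vec.Relation.Unary.Any.Properties as VAny
open import Algebra.Bundles using (CommutativeRing)
open import Algebra.Definitions.RawSemiring ℚ.+-*-rawSemiring using (_^_)
import Algebra.Properties.CommutativeSemiring.Exp
  (CommutativeRing.commutativeSemiring ℚ.+-*-commutativeRing) as Exp
open import Function using (_∘_; id; case_of_)
open import Relation.Binary.Construct.Closure.ReflexiveTransitive
  using (Star; _◅_) renaming (ε to refl⋆)
open import Relation.Binary.PropositionalEquality
open import Relation.Nullary using (Dec; yes; no; does; ¬_; contradiction)
open import Relation.Nullary.Decidable using (isYes)

-- Inequalities between rationals

-- The vertex z makes t = r sufficient in (i): t + 1 vertices are separated, but only edges into X
-- are restricted, because a monochromatic walk from a vertex of X alternates between it and its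
-- neighbours and never arrives at z. Taking X as a tuple with one entry per part makes its vertices
-- distinct, and two tuples share a vertex exactly when they agree in a coordinate, which happens
-- for a proportion of at most t/m of the pairs (m is the size of a part). In (i), two unequal
-- tuples both succeed at an outer vertex with probability at most 1 - 2p^r + p^(r+1). As n p^(r+1)
-- tends to 0, this costs only a constant factor over independence, which t/m outweighs. In (ii),
-- the second tuple of an intersecting pair is simply ignored; the bound is then v^n instead of
-- v^(2n), and v^n ≥ (4n)^(-1/2) beats t/m. The factor 4 in (1 + L/N)^N ≤ 4n is harmless: ω tends to
-- infinity in (i), and (ii) has polynomial room. Roots and exponentials are never formed: r-th
-- powers are compared, and exp y is replaced by (1 + y/N)^N.

≤-of-diff : ∀ {a b} → 0ℚ ≤ℚ b - a → a ≤ℚ b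
≤-of-diff {a} {b} h = begin
    a            ≡⟨ sym (+-identityˡ a) ⟩
    0ℚ + a       ≤⟨ +-monoˡ-≤ a h ⟩
    (b - a) + a  ≡⟨ sym (sub-add b a) ⟩
    b ∎
  where open ℚ.≤-Reasoning

diff-nonneg : ∀ {a b} → a ≤ℚ b → 0ℚ ≤ℚ b - a
diff-nonneg {a} {b} h = begin
    0ℚ     ≡⟨ sym (ℚ.+-inverseʳ a) ⟩
    a - a  ≤⟨ +-monoˡ-≤ (- a) h ⟩
    b - a ∎
  where open ℚ.≤-Reasoning

-- The certificate form of most inequalities below: `e` is visibly nonnegative, and the ring solver
-- checks that it is the difference of the two sides.
≤-by : ∀ {a b} e → 0ℚ ≤ℚ e → b - a ≡ e → a ≤ℚ b
≤-by e h eq = ≤-of-diff (subst (0ℚ ≤ℚ_) (sym eq) h)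

0≤+ : ∀ {a b} → 0ℚ ≤ℚ a → 0ℚ ≤ℚ b → 0ℚ ≤ℚ a + b
0≤+ = +-mono-≤

0≤* : ∀ {a b} → 0ℚ ≤ℚ a → 0ℚ ≤ℚ b → 0ℚ ≤ℚ a * b
0≤* {a} {b} ha hb =
  nonNegative⁻¹ (a * b) {{ℚ.nonNeg*nonNeg⇒nonNeg a {{ℚ.nonNegative ha}} b {{ℚ.nonNegative hb}}}}

0<* : ∀ {a b} → 0ℚ <ℚ a → 0ℚ <ℚ b → 0ℚ <ℚ a * b
0<* {a} {b} ha hb = positive⁻¹ (a * b) {{ℚ.pos*pos⇒pos a {{ℚ.positive ha}} b {{ℚ.positive hb}}}}

*-monoˡ : ∀ {a b} c → 0ℚ ≤ℚ c → a ≤ℚ b → c * a ≤ℚ c * b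
*-monoˡ c hc h = ℚ.*-monoˡ-≤-nonNeg c {{ℚ.nonNegative hc}} h

*-monoʳ : ∀ {a b} c → 0ℚ ≤ℚ c → a ≤ℚ b → a * c ≤ℚ b * c
*-monoʳ c hc h = ℚ.*-monoʳ-≤-nonNeg c {{ℚ.nonNegative hc}} h

*-mono : ∀ {a b c d} → 0ℚ ≤ℚ a → a ≤ℚ b → 0ℚ ≤ℚ c → c ≤ℚ d → a * c ≤ℚ b * d
*-mono {a} {b} {c} {d} ha ab hc cd = ≤-trans (*-monoʳ c hc ab) (*-monoˡ b (≤-trans ha ab) cd)

*-cancelˡ : ∀ {a b} c → 0ℚ <ℚ c → c * a ≤ℚ c * b → a ≤ℚ b
*-cancelˡ c hc h = ℚ.*-cancelˡ-≤-pos c {{ℚ.positive hc}} h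

*-≤1 : ∀ {a b} → 0ℚ ≤ℚ a → a ≤ℚ 1ℚ → b ≤ℚ 1ℚ → a * b ≤ℚ 1ℚ
*-≤1 {a} {b} ha a1 b1 = ≤-trans (*-monoˡ a ha b1) (≤-trans (≤-reflexive (*-identityʳ a)) a1)

*≤ˡ : ∀ {a b} → 0ℚ ≤ℚ a → b ≤ℚ 1ℚ → a * b ≤ℚ a
*≤ˡ {a} {b} ha b1 = ≤-trans (*-monoˡ a ha b1) (≤-reflexive (*-identityʳ a))

*≤ʳ : ∀ {a b} → 0ℚ ≤ℚ b → a ≤ℚ 1ℚ → a * b ≤ℚ b
*≤ʳ {a} {b} hb a1 = ≤-trans (*-monoʳ b hb a1) (≤-reflexive (*-identityˡ b))

0≤1 : 0ℚ ≤ℚ 1ℚ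
0≤1 = nonNegative⁻¹ 1ℚ

x≤1+x : ∀ x → x ≤ℚ 1ℚ + x
x≤1+x x = ≤-by 1ℚ 0≤1 (solve 1 (λ x → (con 1ℚ :+ x) :- x := con 1ℚ) refl x)

0≤square : ∀ a → 0ℚ ≤ℚ a * a
0≤square a with ℚ.≤-total 0ℚ a
... | inj₁ h = 0≤* h h
... | inj₂ h = subst (0ℚ ≤ℚ_) (solve 1 (λ a → (:- a) :* (:- a) := a :* a) refl a)
                 (0≤* (neg-antimono-≤ h) (neg-antimono-≤ h))

0≤^ : ∀ {a} n → 0ℚ ≤ℚ a → 0ℚ ≤ℚ a ^ n
0≤^ zero    h = 0≤1
0≤^ (suc n) h = 0≤* h (0≤^ n h)

0<^ : ∀ {a} n → 0ℚ <ℚ a → 0ℚ <ℚ a ^ n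
0<^ zero    h = positive⁻¹ 1ℚ
0<^ (suc n) h = 0<* h (0<^ n h)

^≤1 : ∀ {a} n → 0ℚ ≤ℚ a → a ≤ℚ 1ℚ → a ^ n ≤ℚ 1ℚ
^≤1 zero    h h1 = ≤-refl
^≤1 (suc n) h h1 = *-≤1 h h1 (^≤1 n h h1)

1≤^ : ∀ {a} n → 1ℚ ≤ℚ a → 1ℚ ≤ℚ a ^ n
1≤^ zero    h = ≤-refl
1≤^ {a} (suc n) h = *-mono 0≤1 h 0≤1 (1≤^ n h)

^-mono : ∀ {a b} n → 0ℚ ≤ℚ a → a ≤ℚ b → a ^ n ≤ℚ b ^ n
^-mono zero    h ab = ≤-refl
^-mono (suc n) h ab = *-mono h ab (0≤^ n h) (^-mono n h ab)

^-anti : ∀ {a m n} → 0ℚ ≤ℚ a → a ≤ℚ 1ℚ → m ≤ n → a ^ n ≤ℚ a ^ m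
^-anti {n = n} h h1 Nat.z≤n = ^≤1 n h h1
^-anti {a} h h1 (Nat.s≤s m≤n) = *-monoˡ a h (^-anti h h1 m≤n)

^-strict : ∀ {a b} n → 0ℚ ≤ℚ a → a <ℚ b → a ^ suc n <ℚ b ^ suc n
^-strict zero h ab = subst₂ _<ℚ_ (sym (*-identityʳ _)) (sym (*-identityʳ _)) ab
^-strict {a} {b} (suc n) h ab = ℚ.≤-<-trans
  (*-monoˡ a h (<⇒≤ (^-strict n h ab)))
  (ℚ.*-monoˡ-<-pos (b ^ suc n) {{ℚ.positive (0<^ (suc n) (ℚ.≤-<-trans h ab))}} ab)

-- Replaces the extraction of roots, which ℚ does not have: b < a would contradict strict
-- monotonicity of powers.
^-cancel : ∀ {a b} n → 0ℚ ≤ℚ b → a ^ suc n ≤ℚ b ^ suc n → a ≤ℚ b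
^-cancel {a} {b} n hb h with a ℚ.≤? b
... | yes p = p
... | no ¬p = contradiction (ℚ.<-≤-trans (^-strict n hb (ℚ.≰⇒> ¬p)) h) (ℚ.<-irrefl refl)

-- Naturals as rationals, and Bernoulli's inequality

ι : ℕ → ℚ
ι n = pos n ℚ./ 1

ι-suc : ∀ n → ι (suc n) ≡ 1ℚ + ι n
ι-suc k = sym (ℚ.toℚᵘ-injective (ℚᵘ.≃-trans (ℚ.toℚᵘ-homo-+ 1ℚ (ι k))
    (ℚᵘ.≃-trans (ℚᵘ.+-congʳ (ℚ.toℚᵘ 1ℚ) (toℚᵘ-/ (pos k) 0))
    (ℚᵘ.≃-trans (ℚᵘ.*≡* cross) (ℚᵘ.≃-sym {ℚ.toℚᵘ (ι (suc k))} (toℚᵘ-/ (pos (suc k)) 0))))))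
  where
  cross : (pos 1 ℤ.* pos 1 ℤ.+ pos k ℤ.* pos 1) ℤ.* pos 1 ≡ pos (suc k) ℤ.* pos 1
  cross = cong (ℤ._* pos 1) (cong (λ z → pos 1 ℤ.+ z) (ℤ.*-identityʳ (pos k)))

/-cancel : ∀ n d → ι (suc d) * (pos n ℚ./ suc d) ≡ ι n
/-cancel n d = ℚ.toℚᵘ-injective (ℚᵘ.≃-trans (ℚ.toℚᵘ-homo-* (ι (suc d)) (pos n ℚ./ suc d))
    (ℚᵘ.≃-trans (ℚᵘ.*-cong (toℚᵘ-/ (pos (suc d)) 0) (toℚᵘ-/ (pos n) d))
    (ℚᵘ.≃-trans (ℚᵘ.*≡* cross) (ℚᵘ.≃-sym {ℚ.toℚᵘ (ι n)} (toℚᵘ-/ (pos n) 0)))))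
  where
  cross : (pos (suc d) ℤ.* pos n) ℤ.* pos 1 ≡ pos n ℤ.* pos (suc (d Nat.+ 0))
  cross = trans (ℤ.*-identityʳ _) (trans (ℤ.*-comm (pos (suc d)) (pos n))
    (cong (λ z → pos n ℤ.* pos (suc z)) (sym (ℕ.+-identityʳ d))))

0≤ι : ∀ n → 0ℚ ≤ℚ ι n
0≤ι n = nonNegative⁻¹ (ι n) {{ℚ.normalize-nonNeg n 1}}

0<ι : ∀ n → 0ℚ <ℚ ι (suc n)
0<ι n = positive⁻¹ (ι (suc n)) {{ℚ.normalize-pos (suc n) 1}}

0≤recip : ∀ n → 0ℚ ≤ℚ pos 1 ℚ./ suc n
0≤recip n = nonNegative⁻¹ _ {{ℚ.normalize-nonNeg 1 (suc n)}}

0<recip : ∀ n → 0ℚ <ℚ pos 1 ℚ./ suc n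
0<recip n = positive⁻¹ _ {{ℚ.normalize-pos 1 (suc n)}}

ι-+ : ∀ m n → ι (m Nat.+ n) ≡ ι m + ι n
ι-+ zero n = sym (+-identityˡ (ι n))
ι-+ (suc m) n = begin
    ι (suc (m Nat.+ n))  ≡⟨ ι-suc (m Nat.+ n) ⟩
    1ℚ + ι (m Nat.+ n)   ≡⟨ cong (1ℚ +_) (ι-+ m n) ⟩
    1ℚ + (ι m + ι n)     ≡⟨ sym (ℚ.+-assoc 1ℚ (ι m) (ι n)) ⟩
    1ℚ + ι m + ι n       ≡⟨ cong (_+ ι n) (sym (ι-suc m)) ⟩
    ι (suc m) + ι n ∎
  where open ≡-Reasoning

ι-* : ∀ m n → ι (m Nat.* n) ≡ ι m * ι n
ι-* zero n = sym (*-zeroˡ (ι n))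
ι-* (suc m) n = begin
    ι (n Nat.+ m Nat.* n)  ≡⟨ ι-+ n (m Nat.* n) ⟩
    ι n + ι (m Nat.* n)    ≡⟨ cong (ι n +_) (ι-* m n) ⟩
    ι n + ι m * ι n        ≡⟨ solve 2 (λ m n → n :+ m :* n := (con 1ℚ :+ m) :* n) refl (ι m) (ι n) ⟩
    (1ℚ + ι m) * ι n       ≡⟨ cong (_* ι n) (sym (ι-suc m)) ⟩
    ι (suc m) * ι n ∎
  where open ≡-Reasoning

ι-mono : ∀ {m n} → m ≤ n → ι m ≤ℚ ι n
ι-mono {m} {n} m≤n = subst (λ z → ι m ≤ℚ ι z) (ℕ.m+[n∸m]≡n m≤n) (begin
    ι m                   ≡⟨ sym (+-identityʳ (ι m)) ⟩
    ι m + 0ℚ              ≤⟨ +-monoʳ-≤ (ι m) (0≤ι (n Nat.∸ m)) ⟩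
    ι m + ι (n Nat.∸ m)   ≡⟨ sym (ι-+ m (n Nat.∸ m)) ⟩
    ι (m Nat.+ (n Nat.∸ m)) ∎)
  where open ℚ.≤-Reasoning

archimedean : ∀ B → ∃[ N ] B ≤ℚ ι N
archimedean B@(ℚ.mkℚ i d _) = ℤ.∣ i ∣ , ℚ.toℚᵘ-cancel-≤
  (ℚᵘ.≤-respʳ-≃ (ℚᵘ.≃-sym {ℚ.toℚᵘ (ι ℤ.∣ i ∣)} (toℚᵘ-/ (pos ℤ.∣ i ∣) 0)) (ℚᵘ.*≤* cross))
  where
  open ℤ.≤-Reasoning
  i≤ : ∀ i → i ℤ.≤ pos ℤ.∣ i ∣
  i≤ (ℤ.+ n)      = ℤ.≤-refl
  i≤ ℤ.-[1+ n ]   = ℤ.-≤+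
  cross : i ℤ.* pos 1 ℤ.≤ pos ℤ.∣ i ∣ ℤ.* pos (suc d)
  cross = begin
    i ℤ.* pos 1 ≡⟨ ℤ.*-identityʳ i ⟩
    i ≤⟨ i≤ i ⟩
    pos ℤ.∣ i ∣ ≤⟨ ℤ.+≤+ (ℕ.m≤m*n ℤ.∣ i ∣ (suc d)) ⟩
    pos (ℤ.∣ i ∣ Nat.* suc d) ≡⟨ ℤ.pos-* ℤ.∣ i ∣ (suc d) ⟩
    pos ℤ.∣ i ∣ ℤ.* pos (suc d) ∎

large : ∀ B δ → 0ℚ <ℚ δ → ∃[ N ] (∀ n → N ≤ n → B ≤ℚ δ * ι n)
large B δ hδ with scale δ 1ℚ (ℚ.positive hδ) (ℚ.positive (positive⁻¹ 1ℚ))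
... | η , η⁺ , δη with archimedean (η * B)
...   | N , h = N , λ n N≤n → begin
    B              ≡⟨ sym (*-identityˡ B) ⟩
    1ℚ * B         ≡⟨ cong (_* B) (sym δη) ⟩
    (δ * η) * B    ≡⟨ *-assoc δ η B ⟩
    δ * (η * B)    ≤⟨ *-monoˡ δ (<⇒≤ hδ) (≤-trans h (ι-mono N≤n)) ⟩
    δ * ι n ∎
  where open ℚ.≤-Reasoning

bernoulli : ∀ {x} n → - 1ℚ ≤ℚ x → 1ℚ + ι n * x ≤ℚ (1ℚ + x) ^ n
bernoulli {x} zero h = ≤-reflexive (trans (cong (1ℚ +_) (*-zeroˡ x)) (+-identityʳ 1ℚ))
bernoulli {x} (suc n) h = begin
    1ℚ + ι (suc n) * x        ≡⟨ cong (λ z → 1ℚ + z * x) (ι-suc n) ⟩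
    1ℚ + (1ℚ + ι n) * x       ≤⟨ ≤-by (ι n * (x * x)) (0≤* (0≤ι n) (0≤square x))
                                   (solve 2 (λ k x → (con 1ℚ :+ x) :* (con 1ℚ :+ k :* x) :- (con 1ℚ :+ (con 1ℚ :+ k) :* x)
                                      := k :* (x :* x)) refl (ι n) x) ⟩
    (1ℚ + x) * (1ℚ + ι n * x) ≤⟨ *-monoˡ (1ℚ + x) 0≤1+x (bernoulli n h) ⟩
    (1ℚ + x) * (1ℚ + x) ^ n ∎
  where
  open ℚ.≤-Reasoning
  0≤1+x : 0ℚ ≤ℚ 1ℚ + x
  0≤1+x = subst (_≤ℚ 1ℚ + x) (ℚ.+-inverseʳ 1ℚ) (+-monoʳ-≤ 1ℚ h)

-- (1 + a)ⁿ ≤ 1 / (1 - n a), without the division.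
[1+a]^n*[1-na]≤1 : ∀ {a} n → 0ℚ ≤ℚ a → (1ℚ + a) ^ n * (1ℚ - ι n * a) ≤ℚ 1ℚ
[1+a]^n*[1-na]≤1 {a} zero h = ≤-reflexive
  (trans (*-identityˡ _) (trans (cong (λ z → 1ℚ - z) (*-zeroˡ a)) refl))
[1+a]^n*[1-na]≤1 {a} (suc n) h = begin
    ((1ℚ + a) * (1ℚ + a) ^ n) * (1ℚ - ι (suc n) * a)
      ≡⟨ cong (λ z → ((1ℚ + a) * (1ℚ + a) ^ n) * (1ℚ - z * a)) (ι-suc n) ⟩
    ((1ℚ + a) * (1ℚ + a) ^ n) * (1ℚ - (1ℚ + ι n) * a)
      ≤⟨ ≤-by ((1ℚ + a) ^ n * ((1ℚ + ι n) * (a * a)))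
           (0≤* (0≤^ n (0≤+ 0≤1 h)) (0≤* (0≤+ 0≤1 (0≤ι n)) (0≤* h h)))
           (solve 3 (λ a k p → p :* (con 1ℚ :- k :* a) :- ((con 1ℚ :+ a) :* p) :* (con 1ℚ :- (con 1ℚ :+ k) :* a)
              := p :* ((con 1ℚ :+ k) :* (a :* a))) refl a (ι n) ((1ℚ + a) ^ n)) ⟩
    (1ℚ + a) ^ n * (1ℚ - ι n * a) ≤⟨ [1+a]^n*[1-na]≤1 n h ⟩
    1ℚ ∎
  where
  open ℚ.≤-Reasoning

-- The logarithm

recip : ℕ → ℚ
recip n = pos 1 ℚ./ suc n

recip-cancel : ∀ n → ι (suc n) * recip n ≡ 1ℚ
recip-cancel n = /-cancel 1 n

-- The index is shifted: `1-1/n n` is 1 - 1/(n+1), the point at which `mercator` approximates log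
-- (n+1).
1-1/n : ℕ → ℚ
1-1/n n = pos n ℚ./ suc n

0≤1-1/n : ∀ n → 0ℚ ≤ℚ 1-1/n n
0≤1-1/n n = nonNegative⁻¹ _ {{ℚ.normalize-nonNeg n (suc n)}}

1-1/n≡ : ∀ n → 1-1/n n ≡ 1ℚ - recip n
1-1/n≡ n = begin
    x                        ≡⟨ sym (*-identityˡ x) ⟩
    1ℚ * x                   ≡⟨ cong (_* x) (sym (recip-cancel n)) ⟩
    (ι (suc n) * u) * x      ≡⟨ solve 3 (λ a u x → (a :* u) :* x := u :* (a :* x)) refl (ι (suc n)) u x ⟩
    u * (ι (suc n) * x)      ≡⟨ cong (u *_) (/-cancel n n) ⟩
    u * ι n                  ≡⟨ solve 2 (λ u a → u :* a := (con 1ℚ :+ a) :* u :- u) refl u (ι n) ⟩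
    (1ℚ + ι n) * u - u       ≡⟨ cong (λ z → z * u - u) (sym (ι-suc n)) ⟩
    ι (suc n) * u - u        ≡⟨ cong (_- u) (recip-cancel n) ⟩
    1ℚ - u ∎
  where
  open ≡-Reasoning
  u = recip n
  x = 1-1/n n

geometric : ℚ → ℕ → ℚ
geometric y zero    = 0ℚ
geometric y (suc k) = geometric y k + y ^ k

geometric-sum : ∀ y k → (1ℚ - y) * geometric y k ≡ 1ℚ - y ^ k
geometric-sum y zero    = *-zeroʳ (1ℚ - y)
geometric-sum y (suc k) = begin
    (1ℚ - y) * (g + y ^ k)        ≡⟨ ℚ.*-distribˡ-+ (1ℚ - y) g (y ^ k) ⟩
    (1ℚ - y) * g + (1ℚ - y) * y ^ k ≡⟨ cong (_+ (1ℚ - y) * y ^ k) (geometric-sum y k) ⟩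
    (1ℚ - y ^ k) + (1ℚ - y) * y ^ k
      ≡⟨ solve 2 (λ y p → (con 1ℚ :- p) :+ (con 1ℚ :- y) :* p := con 1ℚ :- y :* p) refl y (y ^ k) ⟩
    1ℚ - y * y ^ k ∎
  where
  open ≡-Reasoning
  g = geometric y k

^-diff : ∀ {x y} i → 0ℚ ≤ℚ x → x ≤ℚ y → y ^ suc i - x ^ suc i ≤ℚ ι (suc i) * ((y - x) * y ^ i)
^-diff {x} {y} zero h xy = ≤-reflexive
  (solve 2 (λ x y → y :* con 1ℚ :- x :* con 1ℚ := con 1ℚ :* ((y :- x) :* con 1ℚ)) refl x y)
^-diff {x} {y} (suc i) h xy = begin
    y * Y - x * Z
      ≡⟨ solve 4 (λ x y Y Z → y :* Y :- x :* Z := y :* (Y :- Z) :+ (y :- x) :* Z) refl x y Y Z ⟩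
    y * (Y - Z) + (y - x) * Z
      ≤⟨ +-mono-≤ (*-monoˡ y (≤-trans h xy) (^-diff i h xy))
                    (*-monoˡ (y - x) (diff-nonneg xy) (^-mono (suc i) h xy)) ⟩
    y * (ι (suc i) * ((y - x) * y ^ i)) + (y - x) * (y * y ^ i)
      ≡⟨ solve 4 (λ x y a p → y :* (a :* ((y :- x) :* p)) :+ (y :- x) :* (y :* p)
           := (con 1ℚ :+ a) :* ((y :- x) :* (y :* p))) refl x y (ι (suc i)) (y ^ i) ⟩
    (1ℚ + ι (suc i)) * ((y - x) * (y * y ^ i))
      ≡⟨ cong (_* ((y - x) * (y * y ^ i))) (sym (ι-suc (suc i))) ⟩
    ι (suc (suc i)) * ((y - x) * (y * y ^ i)) ∎
  where
  open ℚ.≤-Reasoning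
  Y = y ^ suc i
  Z = x ^ suc i

-- A mean value inequality: the derivative of the k-th Mercator sum is the k-th geometric sum, which
-- increases and is therefore largest at y.
mercator-diff : ∀ {x y} k → 0ℚ ≤ℚ x → x ≤ℚ y → mercator y k - mercator x k ≤ℚ (y - x) * geometric y k
mercator-diff {x} {y} zero h xy = ≤-reflexive (sym (*-zeroʳ (y - x)))
mercator-diff {x} {y} (suc k) h xy = begin
    (mercator y k + Y * u) - (mercator x k + Z * u)
      ≡⟨ solve 5 (λ a b Y Z u → (a :+ Y :* u) :- (b :+ Z :* u) := (a :- b) :+ (Y :- Z) :* u)
           refl (mercator y k) (mercator x k) Y Z u ⟩
    (mercator y k - mercator x k) + (Y - Z) * u
      ≤⟨ +-mono-≤ (mercator-diff k h xy) (*-monoʳ u (0≤recip k) (^-diff k h xy)) ⟩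
    (y - x) * g + (ι (suc k) * ((y - x) * y ^ k)) * u
      ≡⟨ solve 5 (λ d g a p u → d :* g :+ (a :* (d :* p)) :* u := d :* g :+ (a :* u) :* (d :* p))
           refl (y - x) g (ι (suc k)) (y ^ k) u ⟩
    (y - x) * g + (ι (suc k) * u) * ((y - x) * y ^ k)
      ≡⟨ cong (λ z → (y - x) * g + z * ((y - x) * y ^ k)) (recip-cancel k) ⟩
    (y - x) * g + 1ℚ * ((y - x) * y ^ k)
      ≡⟨ solve 3 (λ d g p → d :* g :+ con 1ℚ :* (d :* p) := d :* (g :+ p)) refl (y - x) g (y ^ k) ⟩
    (y - x) * (g + y ^ k) ∎
  where
  open ℚ.≤-Reasoning
  Y = y ^ suc k
  Z = x ^ suc k
  u = recip k
  g = geometric y k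

-- The k-th approximation of log (1 + i).
logApprox : ℕ → ℕ → ℚ
logApprox i k = mercator (1-1/n i) k

0≤mercator : ∀ {x} k → 0ℚ ≤ℚ x → 0ℚ ≤ℚ mercator x k
0≤mercator zero    h = ≤-refl
0≤mercator (suc k) h = 0≤+ (0≤mercator k h) (0≤* (0≤^ (suc k) h) (0≤recip k))

0≤log : ∀ i k → 0ℚ ≤ℚ logApprox i k
0≤log i k = 0≤mercator k (0≤1-1/n i)

mercator-≥ : ∀ {x} k → 0ℚ ≤ℚ x → x ≤ℚ mercator x (suc k)
mercator-≥ {x} zero h = ≤-reflexive
  (solve 1 (λ x → x := con 0ℚ :+ (x :* con 1ℚ) :* con 1ℚ) refl x)
mercator-≥ {x} (suc k) h = ≤-trans (mercator-≥ k h) (begin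
    mercator x (suc k)        ≡⟨ sym (+-identityʳ _) ⟩
    mercator x (suc k) + 0ℚ   ≤⟨ +-monoʳ-≤ (mercator x (suc k)) (0≤* (0≤^ (suc (suc k)) h) (0≤recip (suc k))) ⟩
    mercator x (suc (suc k)) ∎)
  where open ℚ.≤-Reasoning

recip-diff : ∀ j → (recip j - recip (suc j)) * ι (suc (suc j)) ≡ recip j
recip-diff j = begin
    (u - u′) * ι (suc (suc j))
      ≡⟨ solve 3 (λ u v a → (u :- v) :* a := u :* a :- a :* v) refl u u′ (ι (suc (suc j))) ⟩
    u * ι (suc (suc j)) - ι (suc (suc j)) * u′
      ≡⟨ cong₂ (λ a b → u * a - b) (ι-suc (suc j)) (recip-cancel (suc j)) ⟩
    u * (1ℚ + ι (suc j)) - 1ℚ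
      ≡⟨ solve 2 (λ u a → u :* (con 1ℚ :+ a) :- con 1ℚ := u :+ (a :* u :- con 1ℚ)) refl u (ι (suc j)) ⟩
    u + (ι (suc j) * u - 1ℚ) ≡⟨ cong (λ z → u + (z - 1ℚ)) (recip-cancel j) ⟩
    u + (1ℚ - 1ℚ)            ≡⟨ +-identityʳ u ⟩
    u ∎
  where
  open ≡-Reasoning
  u = recip j
  u′ = recip (suc j)

-- For every k this is log (j+2) ≤ log (j+1) + 1/(j+1), with no truncation error: the arguments
-- differ by 1/(j+1) - 1/(j+2), and at the larger one the geometric sum stays below its limit j + 2.
-- The product of the two is exactly 1/(j+1).
log-step : ∀ j k → logApprox (suc j) k ≤ℚ logApprox j k + recip j
log-step j k = begin
    logApprox (suc j) k
      ≡⟨ solve 2 (λ a b → a := b :+ (a :- b)) refl (logApprox (suc j) k) (logApprox j k) ⟩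
    logApprox j k + (logApprox (suc j) k - logApprox j k)
      ≤⟨ +-monoʳ-≤ (logApprox j k) (mercator-diff k (0≤1-1/n j) x≤y) ⟩
    logApprox j k + (y - x) * g
      ≡⟨ cong (λ z → logApprox j k + z * g) y-x ⟩
    logApprox j k + (recip j - recip (suc j)) * g
      ≤⟨ +-monoʳ-≤ (logApprox j k) (*-monoˡ _ (diff-nonneg (1/-anti j (suc j) (ℕ.n≤1+n j))) g≤) ⟩
    logApprox j k + (recip j - recip (suc j)) * ι (suc (suc j))
      ≡⟨ cong (logApprox j k +_) (recip-diff j) ⟩
    logApprox j k + recip j ∎
  where
  open ℚ.≤-Reasoning
  x = 1-1/n j
  y = 1-1/n (suc j)
  g = geometric y k
  y-x : y - x ≡ recip j - recip (suc j)
  y-x = trans (cong₂ _-_ (1-1/n≡ (suc j)) (1-1/n≡ j))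
    (solve 2 (λ u v → (con 1ℚ :- v) :- (con 1ℚ :- u) := u :- v) refl (recip j) (recip (suc j)))
  x≤y : x ≤ℚ y
  x≤y = ≤-by _ (diff-nonneg (1/-anti j (suc j) (ℕ.n≤1+n j))) y-x
  1-y : 1ℚ - y ≡ recip (suc j)
  1-y = trans (cong (λ z → 1ℚ - z) (1-1/n≡ (suc j)))
    (solve 1 (λ v → con 1ℚ :- (con 1ℚ :- v) := v) refl (recip (suc j)))
  g≤ : g ≤ℚ ι (suc (suc j))
  g≤ = *-cancelˡ (recip (suc j)) (0<recip (suc j)) (begin
    recip (suc j) * g  ≡⟨ cong (_* g) (sym 1-y) ⟩
    (1ℚ - y) * g       ≡⟨ geometric-sum y k ⟩
    1ℚ - y ^ k         ≤⟨ ≤-by (y ^ k) (0≤^ k (0≤1-1/n (suc j)))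
                            (solve 1 (λ p → con 1ℚ :- (con 1ℚ :- p) := p) refl (y ^ k)) ⟩
    1ℚ                 ≡⟨ sym (recip-cancel (suc j)) ⟩
    ι (suc (suc j)) * recip (suc j) ≡⟨ *-comm (ι (suc (suc j))) (recip (suc j)) ⟩
    recip (suc j) * ι (suc (suc j)) ∎)

log-one : ∀ k → logApprox 0 k ≡ 0ℚ
log-one zero    = refl
log-one (suc k) = trans (cong₂ _+_ (log-one k) refl) (solve 2 (λ p u → con 0ℚ :+ (con 0ℚ :* p) :* u := con 0ℚ) refl
  (0ℚ ^ k) (recip k))

-- Here η = 1/N. The sum 1 + 1/2 + ⋯ + 1/j dominates log (1 + j), and (1 + η/i)ᴺ ≤ 1 / (1 - 1/i) telescopes over i ≥ 2.
module ExpLog (N : ℕ) (η : ℚ) (0≤η : 0ℚ ≤ℚ η) (Nη : ι N * η ≡ 1ℚ) where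
  open ℚ.≤-Reasoning

  4ℚ : ℚ
  4ℚ = ι 4

  exp≤ : ℚ → ℚ
  exp≤ y = (1ℚ + y * η) ^ N

  exp-bound : ∀ {y} → 0ℚ ≤ℚ y → exp≤ y * (1ℚ - y) ≤ℚ 1ℚ
  exp-bound {y} h = begin
    exp≤ y * (1ℚ - y) ≡⟨ cong (λ z → exp≤ y * (1ℚ - z)) (sym (trans
        (solve 3 (λ a y e → a :* (y :* e) := (a :* e) :* y) refl (ι N) y η)
        (trans (cong (_* y) Nη) (*-identityˡ y)))) ⟩
    exp≤ y * (1ℚ - ι N * (y * η)) ≤⟨ [1+a]^n*[1-na]≤1 N (0≤* h 0≤η) ⟩
    1ℚ ∎

  exp-+ : ∀ {x y} → 0ℚ ≤ℚ x → 0ℚ ≤ℚ y → exp≤ (x + y) ≤ℚ exp≤ x * exp≤ y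
  exp-+ {x} {y} hx hy = begin
    (1ℚ + (x + y) * η) ^ N
      ≤⟨ ^-mono N (0≤+ 0≤1 (0≤* (0≤+ hx hy) 0≤η))
           (≤-by ((x * η) * (y * η)) (0≤* (0≤* hx 0≤η) (0≤* hy 0≤η))
             (solve 3 (λ x y e → (con 1ℚ :+ x :* e) :* (con 1ℚ :+ y :* e) :- (con 1ℚ :+ (x :+ y) :* e)
                := (x :* e) :* (y :* e)) refl x y η)) ⟩
    ((1ℚ + x * η) * (1ℚ + y * η)) ^ N ≡⟨ Exp.^-distrib-* (1ℚ + x * η) (1ℚ + y * η) N ⟩
    exp≤ x * exp≤ y ∎

  exp-mono : ∀ {x y} → 0ℚ ≤ℚ x → x ≤ℚ y → exp≤ x ≤ℚ exp≤ y
  exp-mono hx xy = ^-mono N (0≤+ 0≤1 (0≤* hx 0≤η)) (+-monoʳ-≤ 1ℚ (*-monoʳ η 0≤η xy))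

  0≤exp : ∀ {x} → 0ℚ ≤ℚ x → 0ℚ ≤ℚ exp≤ x
  0≤exp hx = 0≤^ N (0≤+ 0≤1 (0≤* hx 0≤η))

  exp-½ : exp≤ ½ ≤ℚ ι 2
  exp-½ = *-cancelˡ ½ (positive⁻¹ ½) (≤-trans
    (≤-reflexive (*-comm ½ (exp≤ ½))) (exp-bound (nonNegative⁻¹ ½)))

  -- `exp-bound` says nothing at y = 1, so 1 is split into two halves, each of which contributes a
  -- factor 2. This is the origin of the constant 4.
  exp-1 : exp≤ 1ℚ ≤ℚ 4ℚ
  exp-1 = ≤-trans (exp-+ 0≤½ 0≤½) (*-mono (0≤exp 0≤½) exp-½ (0≤exp 0≤½) exp-½)
    where 0≤½ = nonNegative⁻¹ ½

  exp-recip : ∀ j → exp≤ (recip (suc j)) * ι (suc j) ≤ℚ ι (suc (suc j))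
  exp-recip j = begin
    e * ι (suc j)
      ≡⟨ solve 2 (λ e a → e :* a := e :* ((con 1ℚ :+ a) :- con 1ℚ)) refl e (ι (suc j)) ⟩
    e * ((1ℚ + ι (suc j)) - 1ℚ)
      ≡⟨ cong₂ (λ a b → e * (a - b)) (sym (ι-suc (suc j))) (sym (recip-cancel (suc j))) ⟩
    e * (n - n * recip (suc j))
      ≡⟨ solve 3 (λ e n u → e :* (n :- n :* u) := n :* (e :* (con 1ℚ :- u))) refl e n (recip (suc j)) ⟩
    n * (e * (1ℚ - recip (suc j)))  ≤⟨ *≤ˡ (0≤ι (suc (suc j))) (exp-bound (0≤recip (suc j))) ⟩
    n ∎
    where
    e = exp≤ (recip (suc j))
    n = ι (suc (suc j))

  exp-log-suc : ∀ j k → exp≤ (logApprox (suc j) k) ≤ℚ 4ℚ * ι (suc j)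
  exp-log-suc zero k = ≤-trans (exp-mono (0≤log 1 k) (begin
      logApprox 1 k          ≤⟨ log-step 0 k ⟩
      logApprox 0 k + 1ℚ     ≡⟨ cong (_+ 1ℚ) (log-one k) ⟩
      1ℚ ∎)) exp-1
  exp-log-suc (suc j) k = begin
    exp≤ (logApprox (suc (suc j)) k)
      ≤⟨ exp-mono (0≤log (suc (suc j)) k) (log-step (suc j) k) ⟩
    exp≤ (logApprox (suc j) k + recip (suc j))
      ≤⟨ exp-+ (0≤log (suc j) k) (0≤recip (suc j)) ⟩
    exp≤ (logApprox (suc j) k) * e
      ≤⟨ *-monoʳ e (0≤exp (0≤recip (suc j))) (exp-log-suc j k) ⟩
    (4ℚ * ι (suc j)) * e
      ≡⟨ solve 3 (λ c a e → (c :* a) :* e := c :* (e :* a)) refl 4ℚ (ι (suc j)) e ⟩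
    4ℚ * (e * ι (suc j))   ≤⟨ *-monoˡ 4ℚ (0≤ι 4) (exp-recip j) ⟩
    4ℚ * ι (suc (suc j)) ∎
    where e = exp≤ (recip (suc j))

  exp-log : ∀ j k → exp≤ (logApprox j k) ≤ℚ 4ℚ * ι (suc j)
  exp-log zero k = begin
    exp≤ (logApprox 0 k)  ≤⟨ exp-mono (0≤log 0 k) (≤-trans (≤-reflexive (log-one k)) 0≤1) ⟩
    exp≤ 1ℚ               ≤⟨ exp-1 ⟩
    4ℚ * ι 1 ∎
  exp-log (suc j) k = ≤-trans (exp-log-suc j k) (*-monoˡ 4ℚ (0≤ι 4) (ι-mono (ℕ.n≤1+n (suc j))))

square-cancel : ∀ {a b} → 0ℚ ≤ℚ b → a * a ≤ℚ b * b → a ≤ℚ b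
square-cancel {a} {b} hb h = ^-cancel 1 hb
  (subst₂ (λ x y → a * x ≤ℚ b * y) (sym (*-identityʳ a)) (sym (*-identityʳ b)) h)

-- With M = 2(j+1), (L/M)^M ≤ (1 + L/M)^M ≤ 4n. Hence the square of L^(j+1) is at most 4 M^M n,
-- which is below (δn)² once n ≥ 4 M^M / δ². The bound on n does not depend on k.
polylog : ∀ j δ → 0ℚ <ℚ δ → ∃[ N ] (∀ i k → N ≤ suc i → logApprox i k ^ suc j ≤ℚ δ * ι (suc i))
polylog j δ hδ = proj₁ lg , λ i k N≤ → square-cancel (0≤* (<⇒≤ hδ) (0≤ι (suc i))) (begin
    logApprox i k ^ suc j * logApprox i k ^ suc j
      ≡⟨ sym (Exp.^-homo-* (logApprox i k) (suc j) (suc j)) ⟩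
    logApprox i k ^ M   ≡⟨ cong (_^ M) (undo (logApprox i k)) ⟩
    (ι M * (logApprox i k * η)) ^ M ≡⟨ Exp.^-distrib-* (ι M) (logApprox i k * η) M ⟩
    c * (logApprox i k * η) ^ M
      ≤⟨ *-monoˡ c (0≤^ M (0≤ι M)) (^-mono M (0≤* (0≤log i k) (0≤recip (j Nat.+ suc j)))
           (x≤1+x (logApprox i k * η))) ⟩
    c * E.exp≤ (logApprox i k) ≤⟨ *-monoˡ c (0≤^ M (0≤ι M)) (E.exp-log i k) ⟩
    c * (ι 4 * ι (suc i))     ≡⟨ sym (*-assoc c (ι 4) (ι (suc i))) ⟩
    (c * ι 4) * ι (suc i)     ≤⟨ *-monoʳ (ι (suc i)) (0≤ι (suc i)) (proj₂ lg (suc i) N≤) ⟩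
    ((δ * δ) * ι (suc i)) * ι (suc i)
      ≡⟨ solve 2 (λ d n → ((d :* d) :* n) :* n := (d :* n) :* (d :* n)) refl δ (ι (suc i)) ⟩
    (δ * ι (suc i)) * (δ * ι (suc i)) ∎)
  where
  open ℚ.≤-Reasoning
  M = suc j Nat.+ suc j
  η = recip (j Nat.+ suc j)
  c = ι M ^ M
  module E = ExpLog M η (0≤recip (j Nat.+ suc j)) (recip-cancel (j Nat.+ suc j))
  undo : ∀ l → l ≡ ι M * (l * η)
  undo l = sym (trans (solve 3 (λ m l e → m :* (l :* e) := (m :* e) :* l) refl (ι M) l η)
    (trans (cong (_* l) (recip-cancel (j Nat.+ suc j))) (*-identityˡ l)))
  lg = large (c * ι 4) (δ * δ) (0<* hδ hδ)

-- Finite sums and products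

Σ[_] Π[_] : ∀ {A : Set} → List A → (A → ℚ) → ℚ
Σ[ [] ]     f = 0ℚ
Σ[ x ∷ xs ] f = f x + Σ[ xs ] f
Π[ [] ]     f = 1ℚ
Π[ x ∷ xs ] f = f x * Π[ xs ] f

module _ {A : Set} where

  Σ-cong : ∀ (xs : List A) {f g} → (∀ x → f x ≡ g x) → Σ[ xs ] f ≡ Σ[ xs ] g
  Σ-cong []       h = refl
  Σ-cong (x ∷ xs) h = cong₂ _+_ (h x) (Σ-cong xs h)

  Σ-mono : ∀ (xs : List A) {f g} → (∀ x → f x ≤ℚ g x) → Σ[ xs ] f ≤ℚ Σ[ xs ] g
  Σ-mono []       h = ≤-refl
  Σ-mono (x ∷ xs) h = +-mono-≤ (h x) (Σ-mono xs h)

  Σ-+ : ∀ (xs : List A) f g → Σ[ xs ] (λ x → f x + g x) ≡ Σ[ xs ] f + Σ[ xs ] g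
  Σ-+ []       f g = refl
  Σ-+ (x ∷ xs) f g = trans (cong (f x + g x +_) (Σ-+ xs f g))
    (solve 4 (λ a b c d → (a :+ b) :+ (c :+ d) := (a :+ c) :+ (b :+ d)) refl
      (f x) (g x) (Σ[ xs ] f) (Σ[ xs ] g))

  Σ-*ˡ : ∀ (xs : List A) c f → Σ[ xs ] (λ x → c * f x) ≡ c * Σ[ xs ] f
  Σ-*ˡ []       c f = sym (*-zeroʳ c)
  Σ-*ˡ (x ∷ xs) c f = trans (cong (c * f x +_) (Σ-*ˡ xs c f)) (sym (ℚ.*-distribˡ-+ c (f x) (Σ[ xs ] f)))

  Σ-*ʳ : ∀ (xs : List A) c f → Σ[ xs ] (λ x → f x * c) ≡ Σ[ xs ] f * c
  Σ-*ʳ []       c f = sym (*-zeroˡ c)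
  Σ-*ʳ (x ∷ xs) c f = trans (cong (f x * c +_) (Σ-*ʳ xs c f)) (sym (ℚ.*-distribʳ-+ c (f x) (Σ[ xs ] f)))

  Σ-const : ∀ (xs : List A) c → Σ[ xs ] (λ _ → c) ≡ ι (length xs) * c
  Σ-const []       c = sym (*-zeroˡ c)
  Σ-const (x ∷ xs) c = trans (cong (c +_) (Σ-const xs c))
    (trans (solve 2 (λ c n → c :+ n :* c := (con 1ℚ :+ n) :* c) refl c (ι (length xs)))
      (cong (_* c) (sym (ι-suc (length xs)))))

  Σ-++ : ∀ (xs ys : List A) f → Σ[ xs ++ ys ] f ≡ Σ[ xs ] f + Σ[ ys ] f
  Σ-++ []       ys f = sym (+-identityˡ _)
  Σ-++ (x ∷ xs) ys f = trans (cong (f x +_) (Σ-++ xs ys f)) (sym (ℚ.+-assoc (f x) _ _))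

  Π-cong : ∀ (xs : List A) {f g} → (∀ x → f x ≡ g x) → Π[ xs ] f ≡ Π[ xs ] g
  Π-cong []       h = refl
  Π-cong (x ∷ xs) h = cong₂ _*_ (h x) (Π-cong xs h)

  0≤Π : ∀ (xs : List A) {f} → (∀ x → 0ℚ ≤ℚ f x) → 0ℚ ≤ℚ Π[ xs ] f
  0≤Π []       h = 0≤1
  0≤Π (x ∷ xs) h = 0≤* (h x) (0≤Π xs h)

  Π-mono : ∀ (xs : List A) {f g} → (∀ x → 0ℚ ≤ℚ f x) → (∀ x → f x ≤ℚ g x) → Π[ xs ] f ≤ℚ Π[ xs ] g
  Π-mono []       h fg = ≤-refl
  Π-mono (x ∷ xs) h fg = *-mono (h x) (fg x) (0≤Π xs h) (Π-mono xs h fg)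

  Π-const : ∀ (xs : List A) c → Π[ xs ] (λ _ → c) ≡ c ^ length xs
  Π-const []       c = refl
  Π-const (x ∷ xs) c = cong (c *_) (Π-const xs c)

  Π-* : ∀ (xs : List A) f g → Π[ xs ] (λ x → f x * g x) ≡ Π[ xs ] f * Π[ xs ] g
  Π-* []       f g = refl
  Π-* (x ∷ xs) f g = trans (cong (f x * g x *_) (Π-* xs f g))
    (solve 4 (λ a b c d → (a :* b) :* (c :* d) := (a :* c) :* (b :* d)) refl
      (f x) (g x) (Π[ xs ] f) (Π[ xs ] g))

  Π-++ : ∀ (xs ys : List A) f → Π[ xs ++ ys ] f ≡ Π[ xs ] f * Π[ ys ] f
  Π-++ []       ys f = sym (*-identityˡ _)
  Π-++ (x ∷ xs) ys f = trans (cong (f x *_) (Π-++ xs ys f)) (sym (*-assoc (f x) _ _))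

Σ-map : ∀ {A B : Set} (g : A → B) xs f → Σ[ map g xs ] f ≡ Σ[ xs ] (f ∘ g)
Σ-map g []       f = refl
Σ-map g (x ∷ xs) f = cong (f (g x) +_) (Σ-map g xs f)

Σ-cartesian : ∀ {A B C : Set} (g : A → B → C) xs ys f →
  Σ[ cartesianProductWith g xs ys ] f ≡ Σ[ xs ] (λ x → Σ[ ys ] (λ y → f (g x y)))
Σ-cartesian g []       ys f = refl
Σ-cartesian g (x ∷ xs) ys f = trans (Σ-++ (map (g x) ys) _ f)
  (cong₂ _+_ (Σ-map (g x) ys f) (Σ-cartesian g xs ys f))

-- Graphs as Boolean adjacency matrices

edge : ∀ {n} → Graph n → Fin n → Fin n → Bool
edge (t ▹ row) zero    zero    = false
edge (t ▹ row) zero    (suc j) = lookup row j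
edge (t ▹ row) (suc i) zero    = lookup row i
edge (t ▹ row) (suc i) (suc j) = edge t i j

Adj⇒edge : ∀ {n} (G : Graph n) u v → Adj G u v → edge G u v ≡ true
Adj⇒edge (t ▹ row) zero    (suc j) e = Maybe.just-injective e
Adj⇒edge (t ▹ row) (suc i) zero    e = Maybe.just-injective e
Adj⇒edge (t ▹ row) (suc i) (suc j) e = Adj⇒edge t i j e

edge-sym : ∀ {n} (G : Graph n) u v → edge G u v ≡ edge G v u
edge-sym (t ▹ row) zero    zero    = refl
edge-sym (t ▹ row) zero    (suc j) = refl
edge-sym (t ▹ row) (suc i) zero    = refl
edge-sym (t ▹ row) (suc i) (suc j) = edge-sym t i j

edge-irrefl : ∀ {n} (G : Graph n) u → edge G u u ≡ false
edge-irrefl (t ▹ row) zero    = refl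
edge-irrefl (t ▹ row) (suc i) = edge-irrefl t i

𝟙 : Bool → ℚ
𝟙 true  = 1ℚ
𝟙 false = 0ℚ

0≤𝟙 : ∀ b → 0ℚ ≤ℚ 𝟙 b
0≤𝟙 true  = 0≤1
0≤𝟙 false = ≤-refl

𝟙≤1 : ∀ b → 𝟙 b ≤ℚ 1ℚ
𝟙≤1 true  = ≤-refl
𝟙≤1 false = 0≤1

-- Measurability with respect to the bits at the pairs in `R`. Independence is always deduced from
-- two functions that read disjoint sets of pairs.
Reads : ∀ {n} → (Fin n → Fin n → Set) → (Graph n → ℚ) → Set
Reads R f = ∀ G H → (∀ i j → R i j → edge G i j ≡ edge H i j) → f G ≡ f H

_is_ : ∀ {n} → Fin n → Fin n → Bool
i is j = isYes (i Fin.≟ j)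

is-refl : ∀ {n} (i : Fin n) → i is i ≡ true
is-refl i with i Fin.≟ i
... | yes _  = refl
... | no i≢i = contradiction refl i≢i

is-≢ : ∀ {n} {i j : Fin n} → i ≢ j → i is j ≡ false
is-≢ {i = i} {j} i≢j with i Fin.≟ j
... | yes e = contradiction e i≢j
... | no _  = refl

-- Expectation over independent bits that are true with probability q

module Expectation (q : ℚ) (0≤q : 0ℚ ≤ℚ q) (q≤1 : q ≤ℚ 1ℚ) where

  0≤1-q : 0ℚ ≤ℚ 1ℚ - q
  0≤1-q = diff-nonneg q≤1

  -- Expectation is defined by conditioning on one bit after another, so that its laws are
  -- inductions over the bits. `Ev-sum` and `Et-sum` identify it with the weighted sum behind `Pr`.
  Ev : ∀ {n} → (Vec Bool n → ℚ) → ℚ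
  Ev {zero}  f = f []
  Ev {suc n} f = q * Ev (λ v → f (true ∷ v)) + (1ℚ - q) * Ev (λ v → f (false ∷ v))

  Et : ∀ {n} → (Graph n → ℚ) → ℚ
  Et {zero}  f = f []
  Et {suc n} f = Et (λ t → Ev (λ row → f (t ▹ row)))

  Ev-cong : ∀ {n} {f g : Vec Bool n → ℚ} → (∀ v → f v ≡ g v) → Ev f ≡ Ev g
  Ev-cong {zero}  h = h []
  Ev-cong {suc n} h = cong₂ (λ a b → q * a + (1ℚ - q) * b)
    (Ev-cong (λ v → h (true ∷ v))) (Ev-cong (λ v → h (false ∷ v)))

  Et-cong : ∀ {n} {f g : Graph n → ℚ} → (∀ G → f G ≡ g G) → Et f ≡ Et g
  Et-cong {zero}  h = h []
  Et-cong {suc n} h = Et-cong (λ t → Ev-cong (λ row → h (t ▹ row)))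

  Ev-mono : ∀ {n} {f g : Vec Bool n → ℚ} → (∀ v → f v ≤ℚ g v) → Ev f ≤ℚ Ev g
  Ev-mono {zero}  h = h []
  Ev-mono {suc n} h = +-mono-≤ (*-monoˡ q 0≤q (Ev-mono (λ v → h (true ∷ v))))
    (*-monoˡ (1ℚ - q) 0≤1-q (Ev-mono (λ v → h (false ∷ v))))

  Et-mono : ∀ {n} {f g : Graph n → ℚ} → (∀ G → f G ≤ℚ g G) → Et f ≤ℚ Et g
  Et-mono {zero}  h = h []
  Et-mono {suc n} h = Et-mono (λ t → Ev-mono (λ row → h (t ▹ row)))

  Ev-const : ∀ {n} c → Ev {n} (λ _ → c) ≡ c
  Ev-const {zero}  c = refl
  Ev-const {suc n} c = trans (cong (λ a → q * a + (1ℚ - q) * a) (Ev-const {n} c))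
    (solve 2 (λ q c → q :* c :+ (con 1ℚ :- q) :* c := c) refl q c)

  Et-const : ∀ {n} c → Et {n} (λ _ → c) ≡ c
  Et-const {zero}  c = refl
  Et-const {suc n} c = trans (Et-cong {n} (λ t → Ev-const {n} c)) (Et-const {n} c)

  Ev-linear : ∀ {n} a b (f g : Vec Bool n → ℚ) →
    Ev (λ v → a * f v + b * g v) ≡ a * Ev f + b * Ev g
  Ev-linear {zero}  a b f g = refl
  Ev-linear {suc n} a b f g = trans
    (cong₂ (λ x y → q * x + (1ℚ - q) * y)
      (Ev-linear a b (λ v → f (true ∷ v)) (λ v → g (true ∷ v)))
      (Ev-linear a b (λ v → f (false ∷ v)) (λ v → g (false ∷ v))))
    (solve 7 (λ q a b f g h k → q :* (a :* f :+ b :* g) :+ (con 1ℚ :- q) :* (a :* h :+ b :* k)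
      := a :* (q :* f :+ (con 1ℚ :- q) :* h) :+ b :* (q :* g :+ (con 1ℚ :- q) :* k)) refl
      q a b (Ev (λ v → f (true ∷ v))) (Ev (λ v → g (true ∷ v)))
            (Ev (λ v → f (false ∷ v))) (Ev (λ v → g (false ∷ v))))

  Et-linear : ∀ {n} a b (f g : Graph n → ℚ) →
    Et (λ G → a * f G + b * g G) ≡ a * Et f + b * Et g
  Et-linear {zero}  a b f g = refl
  Et-linear {suc n} a b f g = trans
    (Et-cong (λ t → Ev-linear a b (λ row → f (t ▹ row)) (λ row → g (t ▹ row))))
    (Et-linear a b (λ t → Ev (λ row → f (t ▹ row))) (λ t → Ev (λ row → g (t ▹ row))))

  Et-+ : ∀ {n} (f g : Graph n → ℚ) → Et (λ G → f G + g G) ≡ Et f + Et g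
  Et-+ f g = trans (Et-cong (λ G → sym (cong₂ _+_ (*-identityˡ (f G)) (*-identityˡ (g G)))))
    (trans (Et-linear 1ℚ 1ℚ f g) (cong₂ _+_ (*-identityˡ (Et f)) (*-identityˡ (Et g))))

  Et-*ˡ : ∀ {n} c (f : Graph n → ℚ) → Et (λ G → c * f G) ≡ c * Et f
  Et-*ˡ c f = trans (Et-cong (λ G → solve 2 (λ c f → c :* f := c :* f :+ con 0ℚ :* f) refl c (f G)))
    (trans (Et-linear c 0ℚ f f) (solve 2 (λ c f → c :* f :+ con 0ℚ :* f := c :* f) refl c (Et f)))

  Et-Σ : ∀ {n} {A : Set} (xs : List A) (f : A → Graph n → ℚ) →
    Et (λ G → Σ[ xs ] (λ x → f x G)) ≡ Σ[ xs ] (λ x → Et (f x))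
  Et-Σ {n} []       f = Et-const {n} 0ℚ
  Et-Σ     (x ∷ xs) f = trans (Et-+ (f x) (λ G → Σ[ xs ] (λ x → f x G))) (cong (Et (f x) +_) (Et-Σ xs f))

  0≤Et : ∀ {n} {f : Graph n → ℚ} → (∀ G → 0ℚ ≤ℚ f G) → 0ℚ ≤ℚ Et f
  0≤Et {n} h = ≤-trans (≤-reflexive (sym (Et-const {n} 0ℚ))) (Et-mono h)

  Ev-lookup : ∀ {n} (F : Bool → ℚ) (j : Fin n) →
    Ev (λ v → F (lookup v j)) ≡ q * F true + (1ℚ - q) * F false
  Ev-lookup {suc n} F zero = cong₂ (λ a b → q * a + (1ℚ - q) * b) (Ev-const {n} (F true)) (Ev-const {n} (F false))
  Ev-lookup {suc n} F (suc j) = trans (cong (λ a → q * a + (1ℚ - q) * a) (Ev-lookup F j))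
    (solve 2 (λ q c → q :* c :+ (con 1ℚ :- q) :* c := c) refl q (q * F true + (1ℚ - q) * F false))

  Et-edge : ∀ {n} (F : Bool → ℚ) (u v : Fin n) → u ≢ v →
    Et (λ G → F (edge G u v)) ≡ q * F true + (1ℚ - q) * F false
  Et-edge F zero    zero    u≢v = contradiction refl u≢v
  Et-edge {suc n} F zero (suc j) _ = trans (Et-cong {n} (λ t → Ev-lookup F j)) (Et-const {n} _)
  Et-edge {suc n} F (suc i) zero _ = trans (Et-cong {n} (λ t → Ev-lookup F i)) (Et-const {n} _)
  Et-edge {suc n} F (suc i) (suc j) u≢v = trans (Et-cong (λ t → Ev-const {n} (F (edge t i j))))
    (Et-edge F i j (λ e → u≢v (cong suc e)))

  ReadsV : ∀ {n} → (Fin n → Set) → (Vec Bool n → ℚ) → Set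
  ReadsV R f = ∀ v w → (∀ i → R i → lookup v i ≡ lookup w i) → f v ≡ f w

  ReadsV-tail : ∀ {n b} {M : Fin (suc n) → Bool} {f} → ReadsV (λ i → M i ≡ b) f → ∀ x →
    ReadsV (λ i → M (suc i) ≡ b) (λ v → f (x ∷ v))
  ReadsV-tail rf x v w h = rf (x ∷ v) (x ∷ w) λ { zero _ → refl ; (suc i) e → h i e }

  ReadsV-head : ∀ {n b} {M : Fin (suc n) → Bool} {f} → ReadsV (λ i → M i ≡ b) f → M zero ≢ b →
    ∀ v → f (true ∷ v) ≡ f (false ∷ v)
  ReadsV-head rf M0 v = rf (true ∷ v) (false ∷ v) λ { zero e → contradiction e M0 ; (suc i) e → refl }

  -- The mask `M` assigns the first bit to f or to g. The function that does not own the bit has the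
  -- same conditional expectation for both of its values, and this common factor can be pulled out.
  Ev-indep : ∀ {n} (M : Fin n → Bool) {f g : Vec Bool n → ℚ} →
    ReadsV (λ i → M i ≡ true) f → ReadsV (λ i → M i ≡ false) g →
    Ev (λ v → f v * g v) ≡ Ev f * Ev g
  Ev-indep {zero}  M rf rg = refl
  Ev-indep {suc n} M {f} {g} rf rg with M zero in M0
  ... | true = begin
      q * Ev (λ v → f (true ∷ v) * g (true ∷ v)) + (1ℚ - q) * Ev (λ v → f (false ∷ v) * g (false ∷ v))
        ≡⟨ cong₂ (λ a b → q * a + (1ℚ - q) * b) (ih true) (trans (ih false) (cong (Ev (λ v → f (false ∷ v)) *_) (sym gg))) ⟩
      q * (Ev (λ v → f (true ∷ v)) * Ev (λ v → g (true ∷ v))) + (1ℚ - q) * (Ev (λ v → f (false ∷ v)) * Ev (λ v → g (true ∷ v)))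
        ≡⟨ solve 4 (λ q a b c → q :* (a :* c) :+ (con 1ℚ :- q) :* (b :* c) := (q :* a :+ (con 1ℚ :- q) :* b) :*
          (q :* c :+ (con 1ℚ :- q) :* c))
             refl q (Ev (λ v → f (true ∷ v))) (Ev (λ v → f (false ∷ v))) (Ev (λ v → g (true ∷ v))) ⟩
      Ev f * (q * Ev (λ v → g (true ∷ v)) + (1ℚ - q) * Ev (λ v → g (true ∷ v)))
        ≡⟨ cong (λ z → Ev f * (q * Ev (λ v → g (true ∷ v)) + (1ℚ - q) * z)) gg ⟩
      Ev f * Ev g ∎
    where
    open ≡-Reasoning
    ih : ∀ x → Ev (λ v → f (x ∷ v) * g (x ∷ v)) ≡ Ev (λ v → f (x ∷ v)) * Ev (λ v → g (x ∷ v))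
    ih x = Ev-indep (M ∘ suc) (ReadsV-tail {M = M} rf x) (ReadsV-tail {M = M} rg x)
    gg = Ev-cong (ReadsV-head {M = M} rg (λ e → case trans (sym M0) e of λ ()))
  ... | false = begin
      q * Ev (λ v → f (true ∷ v) * g (true ∷ v)) + (1ℚ - q) * Ev (λ v → f (false ∷ v) * g (false ∷ v))
        ≡⟨ cong₂ (λ a b → q * a + (1ℚ - q) * b) (ih true) (trans (ih false) (cong (_* Ev (λ v → g (false ∷ v))) (sym ff))) ⟩
      q * (Ev (λ v → f (true ∷ v)) * Ev (λ v → g (true ∷ v))) + (1ℚ - q) * (Ev (λ v → f (true ∷ v)) * Ev (λ v → g (false ∷ v)))
        ≡⟨ solve 4 (λ q a b c → q :* (c :* a) :+ (con 1ℚ :- q) :* (c :* b) := (q :* c :+ (con 1ℚ :- q) :* c) :*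
          (q :* a :+ (con 1ℚ :- q) :* b))
             refl q (Ev (λ v → g (true ∷ v))) (Ev (λ v → g (false ∷ v))) (Ev (λ v → f (true ∷ v))) ⟩
      (q * Ev (λ v → f (true ∷ v)) + (1ℚ - q) * Ev (λ v → f (true ∷ v))) * Ev g
        ≡⟨ cong (λ z → (q * Ev (λ v → f (true ∷ v)) + (1ℚ - q) * z) * Ev g) ff ⟩
      Ev f * Ev g ∎
    where
    open ≡-Reasoning
    ih : ∀ x → Ev (λ v → f (x ∷ v) * g (x ∷ v)) ≡ Ev (λ v → f (x ∷ v)) * Ev (λ v → g (x ∷ v))
    ih x = Ev-indep (M ∘ suc) (ReadsV-tail {M = M} rf x) (ReadsV-tail {M = M} rg x)
    ff = Ev-cong (ReadsV-head {M = M} rf (λ e → case trans (sym M0) e of λ ()))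

  -- The last row is integrated first, and what remains are functions of the smaller triangle with
  -- the same property. `D` has to be symmetric because the triangle stores one bit for both orders
  -- of a pair.
  Et-indep : ∀ {n} (D : Fin n → Fin n → Bool) → (∀ i j → D i j ≡ D j i) → {f g : Graph n → ℚ} →
    Reads (λ i j → D i j ≡ true) f → Reads (λ i j → D i j ≡ false) g →
    Et (λ G → f G * g G) ≡ Et f * Et g
  Et-indep {zero}  D D-sym rf rg = refl
  Et-indep {suc n} D D-sym {f} {g} rf rg = trans
    (Et-cong (λ t → Ev-indep (λ j → D zero (suc j)) (row-reads rf t) (row-reads rg t)))
    (Et-indep (λ i j → D (suc i) (suc j)) (λ i j → D-sym (suc i) (suc j)) (rest-reads rf) (rest-reads rg))
    where
    row-reads : ∀ {b f} → Reads (λ i j → D i j ≡ b) f → ∀ t →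
      ReadsV (λ j → D zero (suc j) ≡ b) (λ row → f (t ▹ row))
    row-reads r t v w h = r (t ▹ v) (t ▹ w) λ
      { zero    zero    e → refl
      ; zero    (suc j) e → h j e
      ; (suc i) zero    e → h i (trans (D-sym zero (suc i)) e)
      ; (suc i) (suc j) e → refl }
    rest-reads : ∀ {b f} → Reads (λ i j → D i j ≡ b) f →
      Reads (λ i j → D (suc i) (suc j) ≡ b) (λ t → Ev (λ row → f (t ▹ row)))
    rest-reads r G H h = Ev-cong λ row → r (G ▹ row) (H ▹ row) λ
      { zero    zero    e → refl
      ; zero    (suc j) e → refl
      ; (suc i) zero    e → refl
      ; (suc i) (suc j) e → h i j e }

  Et-indep-meeting : ∀ {n} (P : Fin n → Bool) {f g : Graph n → ℚ} →
    Reads (λ i j → P i ≡ true ⊎ P j ≡ true) f → Reads (λ i j → P i ≡ false × P j ≡ false) g →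
    Et (λ G → f G * g G) ≡ Et f * Et g
  Et-indep-meeting P rf rg = Et-indep (λ i j → P i ∨ P j) (λ i j → Bool.∨-comm (P i) (P j))
    (λ G H h → rf G H λ i j e → h i j (meets i j e))
    (λ G H h → rg G H λ i j e → h i j (avoids i j e))
    where
    meets : ∀ i j → P i ≡ true ⊎ P j ≡ true → P i ∨ P j ≡ true
    meets i j (inj₁ e) = cong (_∨ P j) e
    meets i j (inj₂ e) = trans (cong (P i ∨_) e) (Bool.∨-zeroʳ (P i))
    avoids : ∀ i j → P i ≡ false × P j ≡ false → P i ∨ P j ≡ false
    avoids i j (e , e′) = cong₂ _∨_ e e′

  -- The edges from y to distinct other vertices are independent bits. The edge to `a zero` is split
  -- off: it meets the vertex `a zero`, while by injectivity all further edges from y avoid that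
  -- vertex.
  Et-marginal : ∀ {n k} (y : Fin n) (a : Fin k → Fin n) → (∀ {i j} → a i ≡ a j → i ≡ j) →
    (∀ i → a i ≢ y) → (F : Vec Bool k → ℚ) → Et (λ G → F (tabulate (λ i → edge G y (a i)))) ≡ Ev F
  Et-marginal {n} {zero}  y a inj a≢y F = Et-const {n} (F [])
  Et-marginal {n} {suc k} y a inj a≢y F = begin
    Et (λ G → F (edge G y x ∷ rest G)) ≡⟨ Et-cong (λ G → split (edge G y x) (rest G)) ⟩
    Et (λ G → 𝟙 (edge G y x) * F (true ∷ rest G) + 𝟙 (not (edge G y x)) * F (false ∷ rest G))
      ≡⟨ Et-+ (λ G → 𝟙 (edge G y x) * F (true ∷ rest G)) (λ G → 𝟙 (not (edge G y x)) * F (false ∷ rest G)) ⟩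
    Et (λ G → 𝟙 (edge G y x) * F (true ∷ rest G)) + Et (λ G → 𝟙 (not (edge G y x)) * F (false ∷ rest G))
      ≡⟨ cong₂ _+_ (factor 𝟙 true) (factor (𝟙 ∘ not) false) ⟩
    (q * 1ℚ + (1ℚ - q) * 0ℚ) * Ev (λ v → F (true ∷ v)) + (q * 0ℚ + (1ℚ - q) * 1ℚ) * Ev (λ v → F (false ∷ v))
      ≡⟨ solve 3 (λ q a b → (q :* con 1ℚ :+ (con 1ℚ :- q) :* con 0ℚ) :* a :+ (q :* con 0ℚ :+ (con 1ℚ :- q) :* con 1ℚ) :* b
           := q :* a :+ (con 1ℚ :- q) :* b) refl q (Ev (λ v → F (true ∷ v))) (Ev (λ v → F (false ∷ v))) ⟩
    Ev F ∎
    where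
    open ≡-Reasoning
    x = a zero
    rest : Graph n → Vec Bool k
    rest G = tabulate (λ i → edge G y (a (suc i)))
    split : ∀ b v → F (b ∷ v) ≡ 𝟙 b * F (true ∷ v) + 𝟙 (not b) * F (false ∷ v)
    split true  v = solve 2 (λ a b → a := con 1ℚ :* a :+ con 0ℚ :* b) refl (F (true ∷ v)) (F (false ∷ v))
    split false v = solve 2 (λ a b → b := con 0ℚ :* a :+ con 1ℚ :* b) refl (F (true ∷ v)) (F (false ∷ v))
    factor : ∀ (φ : Bool → ℚ) b → Et (λ G → φ (edge G y x) * F (b ∷ rest G))
      ≡ (q * φ true + (1ℚ - q) * φ false) * Ev (λ v → F (b ∷ v))
    factor φ b = trans
      (Et-indep-meeting (_is x)
        (λ G H h → cong φ (h y x (inj₂ (is-refl x))))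
        (λ G H h → cong (λ v → F (b ∷ v)) (Vec.tabulate-cong λ i →
          h y (a (suc i)) (is-≢ (a≢y zero ∘ sym) , is-≢ (λ e → case inj e of λ ())))))
      (cong₂ _*_ (Et-edge φ y x (a≢y zero ∘ sym))
        (Et-marginal y (a ∘ suc) (Fin.suc-injective ∘ inj) (a≢y ∘ suc) (λ v → F (b ∷ v))))

  -- For y outside S, ψ y reads only edges from y into S. Neither h, which reads pairs inside S, nor
  -- ψ at another vertex looks at a pair containing y, so the factor at y splits off. The value 1 on
  -- S lets the product run over all vertices.
  Et-peel : ∀ {n} (S : Fin n → Bool) (ψ : Fin n → Graph n → ℚ) (h : Graph n → ℚ) →
    Reads (λ i j → S i ≡ true × S j ≡ true) h →
    (∀ y → S y ≡ true → ∀ G → ψ y G ≡ 1ℚ) →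
    (∀ y → S y ≡ false → Reads (λ i j → i ≡ y × S j ≡ true) (ψ y)) →
    ∀ ys → Unique ys → Et (λ G → h G * Π[ ys ] (λ y → ψ y G)) ≡ Et h * Π[ ys ] (λ y → Et (ψ y))
  Et-peel S ψ h rh ψ1 rψ [] _ = trans (Et-cong (λ G → *-identityʳ (h G))) (sym (*-identityʳ (Et h)))
  Et-peel {n} S ψ h rh ψ1 rψ (y ∷ ys) (y∉ ∷ uniq) = begin
    Et (λ G → h G * (ψ y G * Π[ ys ] (λ y → ψ y G)))
      ≡⟨ Et-cong (λ G → solve 3 (λ h a p → h :* (a :* p) := a :* (h :* p)) refl (h G) (ψ y G) _) ⟩
    Et (λ G → ψ y G * (h G * Π[ ys ] (λ y → ψ y G)))   ≡⟨ split (S y) refl ⟩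
    Et (ψ y) * Et (λ G → h G * Π[ ys ] (λ y → ψ y G))
      ≡⟨ cong (Et (ψ y) *_) (Et-peel S ψ h rh ψ1 rψ ys uniq) ⟩
    Et (ψ y) * (Et h * Π[ ys ] (λ y → Et (ψ y)))
      ≡⟨ solve 3 (λ h a p → a :* (h :* p) := h :* (a :* p)) refl (Et h) (Et (ψ y)) _ ⟩
    Et h * (Et (ψ y) * Π[ ys ] (λ y → Et (ψ y))) ∎
    where
    open ≡-Reasoning
    avoid : S y ≡ false → ∀ {i} → S i ≡ true → i is y ≡ false
    avoid Sy Si = is-≢ (λ e → case trans (sym Sy) (trans (cong S (sym e)) Si) of λ ())
    reads : S y ≡ false → ∀ zs → All (y ≢_) zs →
      Reads (λ i j → i is y ≡ false × j is y ≡ false) (λ G → Π[ zs ] (λ z → ψ z G))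
    reads Sy []       _          G H hyp = refl
    reads Sy (z ∷ zs) (y≢z ∷ y∉) G H hyp = cong₂ _*_ (one (S z) refl) (reads Sy zs y∉ G H hyp)
      where
      one : ∀ b → S z ≡ b → ψ z G ≡ ψ z H
      one true  e = trans (ψ1 z e G) (sym (ψ1 z e H))
      one false e = rψ z e G H λ { i j (refl , Sj) → hyp i j (is-≢ (y≢z ∘ sym) , avoid Sy Sj) }
    split : ∀ b → S y ≡ b → Et (λ G → ψ y G * (h G * Π[ ys ] (λ y → ψ y G)))
      ≡ Et (ψ y) * Et (λ G → h G * Π[ ys ] (λ y → ψ y G))
    split true e = trans (Et-cong (λ G → trans (cong (_* (h G * Π[ ys ] (λ y → ψ y G))) (ψ1 y e G)) (*-identityˡ _)))
      (sym (trans (cong (_* Et (λ G → h G * Π[ ys ] (λ y → ψ y G))) (trans (Et-cong (ψ1 y e)) (Et-const {n} 1ℚ)))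
        (*-identityˡ _)))
    split false e = Et-indep-meeting (_is y)
      (λ G H hyp → rψ y e G H λ { i j (refl , _) → hyp i j (inj₁ (is-refl i)) })
      (λ G H hyp → cong₂ _*_
        (rh G H λ i j (Si , Sj) → hyp i j (avoid e Si , avoid e Sj))
        (reads e ys y∉ G H hyp))

-- Counting

mem : ∀ {n} → List (Fin n) → Fin n → Bool
mem []      y = false
mem (x ∷ L) y = (y is x) ∨ mem L y

mem⁺ : ∀ {n} {L : List (Fin n)} {y} → y ∈ₗ L → mem L y ≡ true
mem⁺ {L = x ∷ L} (here refl) = cong (_∨ mem L x) (is-refl x)
mem⁺ {L = x ∷ L} {y} (there p) = trans (cong (y is x ∨_) (mem⁺ p)) (Bool.∨-zeroʳ (y is x))

mem⁻ : ∀ {n} (L : List (Fin n)) {y} → mem L y ≡ true → y ∈ₗ L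
mem⁻ (x ∷ L) {y} e with y Fin.≟ x
... | yes y≡x = here y≡x
... | no _    = there (mem⁻ L e)

mem-false : ∀ {n} {L : List (Fin n)} {y} → mem L y ≡ false → ∀ {x} → x ∈ₗ L → x ≢ y
mem-false {L = L} e p refl = case trans (sym e) (mem⁺ p) of λ ()

misses : ∀ {n} → List (Fin n) → List (Fin n) → ℕ
misses L []       = 0
misses L (y ∷ ys) = if mem L y then misses L ys else suc (misses L ys)

-- Enlarging L by x removes at most one position from the count, since x occurs at most once in
-- `ys`.
misses-cons : ∀ {n} (x : Fin n) L ys → Unique ys → misses L ys ≤ suc (misses (x ∷ L) ys)
misses-cons x L [] _ = Nat.z≤n
misses-cons x L (y ∷ ys) (y∉ ∷ u) with y Fin.≟ x
... | yes refl = ℕ.≤-trans (step (mem L y)) (Nat.s≤s (ℕ.≤-reflexive (same ys y∉)))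
  where
  step : ∀ b → (if b then misses L ys else suc (misses L ys)) ≤ suc (misses L ys)
  step true  = ℕ.n≤1+n _
  step false = ℕ.≤-refl
  same : ∀ ys → All (y ≢_) ys → misses L ys ≡ misses (y ∷ L) ys
  same []       _        = refl
  same (w ∷ ys) (p ∷ ps) = trans (cong (λ k → if mem L w then k else suc k) (same ys ps))
    (cong (λ b → if b ∨ mem L w then misses (y ∷ L) ys else suc (misses (y ∷ L) ys)) (sym (is-≢ (p ∘ sym))))
... | no y≢x with mem L y
...   | true  = misses-cons x L ys u
...   | false = Nat.s≤s (misses-cons x L ys u)

length≤misses : ∀ {n} (L ys : List (Fin n)) → Unique ys → length ys ≤ misses L ys Nat.+ length L
length≤misses [] ys u = ℕ.≤-reflexive (sym (trans (ℕ.+-identityʳ _) (all ys)))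
  where
  all : ∀ ys → misses [] ys ≡ length ys
  all []       = refl
  all (y ∷ ys) = cong suc (all ys)
length≤misses (x ∷ L) ys u = begin
    length ys                              ≤⟨ length≤misses L ys u ⟩
    misses L ys Nat.+ length L             ≤⟨ ℕ.+-monoˡ-≤ (length L) (misses-cons x L ys u) ⟩
    suc (misses (x ∷ L) ys) Nat.+ length L ≡⟨ sym (ℕ.+-suc (misses (x ∷ L) ys) (length L)) ⟩
    misses (x ∷ L) ys Nat.+ suc (length L) ∎
  where open ℕ.≤-Reasoning

outside : ∀ {n} → List (Fin n) → ℚ → Fin n → ℚ
outside L w y = if mem L y then 1ℚ else w

-- The list L may repeat vertices (two reserved lists both contain z), so the number of vertices
-- outside it is only bounded below. As w ≤ 1, this is the direction needed.
Π-outside : ∀ {n} L {w} → 0ℚ ≤ℚ w → w ≤ℚ 1ℚ → Π[ allFin n ] (outside L w) ≤ℚ w ^ (n Nat.∸ length L)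
Π-outside {n} L {w} 0≤w w≤1 = subst (_≤ℚ w ^ (n Nat.∸ length L)) (sym (exact (allFin n)))
    (^-anti 0≤w w≤1 (ℕ.m≤n+o⇒m∸n≤o n (length L)
      (subst₂ _≤_ (List.length-tabulate {n = n} id) (ℕ.+-comm (misses L (allFin n)) (length L))
        (length≤misses L (allFin n) (Unique.allFin⁺ n)))))
  where
  exact : ∀ ys → Π[ ys ] (outside L w) ≡ w ^ misses L ys
  exact [] = refl
  exact (y ∷ ys) with mem L y
  ... | true  = trans (*-identityˡ _) (exact ys)
  ... | false = cong (w *_) (exact ys)

Π-cong-∈ : ∀ {A : Set} (xs : List A) {f g} → (∀ x → x ∈ₗ xs → f x ≡ g x) → Π[ xs ] f ≡ Π[ xs ] g
Π-cong-∈ []       h = refl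
Π-cong-∈ (x ∷ xs) h = cong₂ _*_ (h x (here refl)) (Π-cong-∈ xs (λ y p → h y (there p)))

Π≤1 : ∀ {A : Set} (xs : List A) {f} → (∀ x → 0ℚ ≤ℚ f x) → (∀ x → f x ≤ℚ 1ℚ) → Π[ xs ] f ≤ℚ 1ℚ
Π≤1 []       h h1 = ≤-refl
Π≤1 (x ∷ xs) h h1 = *-≤1 (h x) (h1 x) (Π≤1 xs h h1)

length-cartesianProductWith : ∀ {A B C : Set} (f : A → B → C) xs ys →
  length (cartesianProductWith f xs ys) ≡ length xs Nat.* length ys
length-cartesianProductWith f []       ys = refl
length-cartesianProductWith f (x ∷ xs) ys = trans (List.length-++ (map (f x) ys))
  (cong₂ Nat._+_ (List.length-map (f x) ys) (length-cartesianProductWith f xs ys))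

ones : ∀ {k} → Vec Bool k → ℕ
ones []          = 0
ones (true  ∷ v) = suc (ones v)
ones (false ∷ v) = ones v

few : ∀ {k} → ℕ → Vec Bool k → Bool
few r v = ones v Nat.<ᵇ r

∧-all : ∀ {k} → Vec Bool k → ℚ
∧-all []      = 1ℚ
∧-all (b ∷ v) = 𝟙 b * ∧-all v

0≤∧-all : ∀ {k} (v : Vec Bool k) → 0ℚ ≤ℚ ∧-all v
0≤∧-all []      = 0≤1
0≤∧-all (b ∷ v) = 0≤* (0≤𝟙 b) (0≤∧-all v)

∧-all≤1 : ∀ {k} (v : Vec Bool k) → ∧-all v ≤ℚ 1ℚ
∧-all≤1 []      = ≤-refl
∧-all≤1 (b ∷ v) = *-≤1 (0≤𝟙 b) (𝟙≤1 b) (∧-all≤1 v)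

∧-all≤ : ∀ {k} (v : Vec Bool k) i → ∧-all v ≤ℚ 𝟙 (lookup v i)
∧-all≤ (b ∷ v) zero    = *≤ˡ (0≤𝟙 b) (∧-all≤1 v)
∧-all≤ (b ∷ v) (suc i) = ≤-trans (*≤ʳ (0≤∧-all v) (𝟙≤1 b)) (∧-all≤ v i)

ones≤ : ∀ {k} (v : Vec Bool k) → ones v ≤ k
ones≤ []          = Nat.z≤n
ones≤ (true  ∷ v) = Nat.s≤s (ones≤ v)
ones≤ (false ∷ v) = ℕ.m≤n⇒m≤1+n (ones≤ v)

<⇒<ᵇ : ∀ {m n} → m Nat.< n → (m Nat.<ᵇ n) ≡ true
<⇒<ᵇ {zero}  (Nat.s≤s _) = refl
<⇒<ᵇ {suc m} (Nat.s≤s p) = <⇒<ᵇ p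

few-all : ∀ {k} (v : Vec Bool k) → 𝟙 (few k v) ≡ 1ℚ - ∧-all v
few-all []          = refl
few-all (true  ∷ v) = trans (few-all v) (cong (λ z → 1ℚ - z) (sym (*-identityˡ (∧-all v))))
few-all (false ∷ v) = trans (cong 𝟙 (<⇒<ᵇ (Nat.s≤s (ones≤ v))))
  (sym (cong (λ z → 1ℚ - z) (*-zeroˡ (∧-all v))))

module Binomial (q : ℚ) (0≤q : 0ℚ ≤ℚ q) (q≤1 : q ≤ℚ 1ℚ) where
  open Expectation q 0≤q q≤1

  few-prob : ∀ k r → ℚ
  few-prob k r = Ev {k} (λ v → 𝟙 (few r v))

  0≤few-prob : ∀ k r → 0ℚ ≤ℚ few-prob k r
  0≤few-prob k r = ≤-trans (≤-reflexive (sym (Ev-const {k} 0ℚ))) (Ev-mono {k} (λ v → 0≤𝟙 (few r v)))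

  few-prob≤1 : ∀ k r → few-prob k r ≤ℚ 1ℚ
  few-prob≤1 k r = ≤-trans (Ev-mono {k} (λ v → 𝟙≤1 (few r v))) (≤-reflexive (Ev-const {k} 1ℚ))

  Ev-∧-all : ∀ k → Ev {k} ∧-all ≡ q ^ k
  Ev-∧-all zero    = refl
  Ev-∧-all (suc k) = begin
      q * Ev {k} (λ v → 1ℚ * ∧-all v) + (1ℚ - q) * Ev {k} (λ v → 0ℚ * ∧-all v)
        ≡⟨ cong₂ (λ a b → q * a + (1ℚ - q) * b)
             (trans (Ev-cong {k} (λ v → *-identityˡ (∧-all v))) (Ev-∧-all k))
             (trans (Ev-cong {k} (λ v → *-zeroˡ (∧-all v))) (Ev-const {k} 0ℚ)) ⟩
      q * q ^ k + (1ℚ - q) * 0ℚ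
        ≡⟨ solve 2 (λ q p → q :* p :+ (con 1ℚ :- q) :* con 0ℚ := q :* p) refl q (q ^ k) ⟩
      q * q ^ k ∎
    where open ≡-Reasoning

  few-prob-all : ∀ k → few-prob k k ≡ 1ℚ - q ^ k
  few-prob-all k = begin
      Ev {k} (λ v → 𝟙 (few k v))
        ≡⟨ Ev-cong {k} (λ v → trans (few-all v) (solve 1 (λ a → con 1ℚ :- a := con 1ℚ :* con 1ℚ :+
          (:- con 1ℚ) :* a) refl (∧-all v))) ⟩
      Ev {k} (λ v → 1ℚ * 1ℚ + (- 1ℚ) * ∧-all v) ≡⟨ Ev-linear {k} 1ℚ (- 1ℚ) (λ _ → 1ℚ) ∧-all ⟩
      1ℚ * Ev {k} (λ _ → 1ℚ) + (- 1ℚ) * Ev {k} ∧-all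
        ≡⟨ cong₂ (λ a b → 1ℚ * a + (- 1ℚ) * b) (Ev-const {k} 1ℚ) (Ev-∧-all k) ⟩
      1ℚ * 1ℚ + (- 1ℚ) * q ^ k
        ≡⟨ solve 1 (λ a → con 1ℚ :* con 1ℚ :+ (:- con 1ℚ) :* a := con 1ℚ :- a) refl (q ^ k) ⟩
      1ℚ - q ^ k ∎
    where open ≡-Reasoning

  -- A union bound over the sets of r positions, with 2^k in place of the binomial coefficient.
  -- Conditioning on the first bit gives the recursion of Pascal's triangle.
  few-prob-lower : ∀ k r → 1ℚ - ι 2 ^ k * q ^ r ≤ℚ few-prob k r
  few-prob-lower k zero = begin
      1ℚ - ι 2 ^ k * 1ℚ  ≤⟨ ≤-by (ι 2 ^ k - 1ℚ) (diff-nonneg (1≤^ k (ι-mono {1} {2} (Nat.s≤s Nat.z≤n))))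
                              (solve 1 (λ c → con 0ℚ :- (con 1ℚ :- c :* con 1ℚ) := c :- con 1ℚ) refl (ι 2 ^ k)) ⟩
      0ℚ                 ≤⟨ 0≤few-prob k 0 ⟩
      few-prob k 0 ∎
    where open ℚ.≤-Reasoning
  few-prob-lower zero (suc r) =
    ≤-by (1ℚ * q ^ suc r) (0≤* 0≤1 (0≤^ (suc r) 0≤q))
      (solve 1 (λ p → con 1ℚ :- (con 1ℚ :- con 1ℚ :* p) := con 1ℚ :* p) refl (q ^ suc r))
  few-prob-lower (suc k) (suc r) = begin
      1ℚ - (ι 2 * C) * (q * p)
        ≤⟨ ≤-by (q * (C * (q * p))) (0≤* 0≤q (0≤* (0≤^ k (0≤ι 2)) (0≤* 0≤q (0≤^ r 0≤q))))
             (solve 3 (λ q C p → (q :* (con 1ℚ :- C :* p) :+ (con 1ℚ :- q) :* (con 1ℚ :- C :* (q :* p)))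
                :- (con 1ℚ :- (con (ι 2) :* C) :* (q :* p)) := q :* (C :* (q :* p))) refl q C p) ⟩
      q * (1ℚ - C * p) + (1ℚ - q) * (1ℚ - C * (q * p))
        ≤⟨ +-mono-≤ (*-monoˡ q 0≤q (few-prob-lower k r)) (*-monoˡ (1ℚ - q) 0≤1-q (few-prob-lower k (suc r))) ⟩
      few-prob (suc k) (suc r) ∎
    where
    open ℚ.≤-Reasoning
    C = ι 2 ^ k
    p = q ^ r

-- Tuples, counted by the coordinates in which they agree

is-suc : ∀ {n} (i j : Fin n) → (suc i is suc j) ≡ (i is j)
is-suc i j with i Fin.≟ j
... | yes _ = refl
... | no _  = refl

Σ-is : ∀ {m} (x : Fin m) → Σ[ allFin m ] (λ y → 𝟙 (x is y)) ≡ 1ℚ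
Σ-is {suc m} x = trans (cong (𝟙 (x is zero) +_)
    (trans (cong (λ l → Σ[ l ] (λ y → 𝟙 (x is y))) (sym (List.map-tabulate id suc))) (Σ-map suc (allFin m) _)))
    (tail x)
  where
  tail : ∀ x → 𝟙 (x is zero) + Σ[ allFin m ] (λ y → 𝟙 (x is suc y)) ≡ 1ℚ
  tail zero    = cong (1ℚ +_) (trans (Σ-const (allFin m) 0ℚ) (*-zeroʳ (ι (length (allFin m)))))
  tail (suc x) = trans (+-identityˡ _) (trans (Σ-cong (allFin m) (λ y → cong 𝟙 (is-suc x y))) (Σ-is x))

tuples : ∀ m t → List (Vec (Fin m) t)
tuples m = allVecs (allFin m)

length-tuples : ∀ m t → ι (length (tuples m t)) ≡ ι m ^ t
length-tuples m zero    = refl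
length-tuples m (suc t) = trans (cong ι (length-cartesianProductWith _∷_ (allFin m) (tuples m t)))
  (trans (ι-* (length (allFin m)) (length (tuples m t))) (cong₂ _*_ (cong ι (List.length-tabulate {n = m} id))
    (length-tuples m t)))

-- `agreements` dominates the indicator that two tuples meet, and `same` is the indicator of
-- equality. Both have explicit sums over the second tuple.
agreements same : ∀ {m t} → Vec (Fin m) t → Vec (Fin m) t → ℚ
agreements []      []      = 0ℚ
agreements (x ∷ a) (y ∷ b) = 𝟙 (x is y) + agreements a b
same []      []      = 1ℚ
same (x ∷ a) (y ∷ b) = 𝟙 (x is y) * same a b

0≤agreements : ∀ {m t} (a b : Vec (Fin m) t) → 0ℚ ≤ℚ agreements a b
0≤agreements []      []      = ≤-refl
0≤agreements (x ∷ a) (y ∷ b) = 0≤+ (0≤𝟙 (x is y)) (0≤agreements a b)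

0≤same : ∀ {m t} (a b : Vec (Fin m) t) → 0ℚ ≤ℚ same a b
0≤same []      []      = 0≤1
0≤same (x ∷ a) (y ∷ b) = 0≤* (0≤𝟙 (x is y)) (0≤same a b)

same-refl : ∀ {m t} (a : Vec (Fin m) t) → same a a ≡ 1ℚ
same-refl []      = refl
same-refl (x ∷ a) = cong₂ _*_ (cong 𝟙 (is-refl x)) (same-refl a)

1≤agreements : ∀ {m t} (a b : Vec (Fin m) t) i → lookup a i ≡ lookup b i → 1ℚ ≤ℚ agreements a b
1≤agreements (x ∷ a) (.x ∷ b) zero    refl = begin
    1ℚ                            ≤⟨ +-monoʳ-≤ 1ℚ (0≤agreements a b) ⟩
    1ℚ + agreements a b           ≡⟨ cong (λ c → 𝟙 c + agreements a b) (sym (is-refl x)) ⟩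
    𝟙 (x is x) + agreements a b ∎
  where open ℚ.≤-Reasoning
1≤agreements (x ∷ a) (y ∷ b) (suc i) e = begin
    1ℚ                            ≤⟨ 1≤agreements a b i e ⟩
    agreements a b                ≡⟨ sym (+-identityˡ _) ⟩
    0ℚ + agreements a b           ≤⟨ +-monoˡ-≤ (agreements a b) (0≤𝟙 (x is y)) ⟩
    𝟙 (x is y) + agreements a b ∎
  where open ℚ.≤-Reasoning

Σ-same : ∀ {m t} (a : Vec (Fin m) t) → Σ[ tuples m t ] (same a) ≡ 1ℚ
Σ-same []      = refl
Σ-same {m} {suc t} (x ∷ a) = begin
    Σ[ tuples m (suc t) ] (same (x ∷ a))
      ≡⟨ Σ-cartesian _∷_ (allFin m) (tuples m t) (same (x ∷ a)) ⟩
    Σ[ allFin m ] (λ y → Σ[ tuples m t ] (λ b → 𝟙 (x is y) * same a b))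
      ≡⟨ Σ-cong (allFin m) (λ y → trans (Σ-*ˡ (tuples m t) (𝟙 (x is y)) (same a))
           (trans (cong (𝟙 (x is y) *_) (Σ-same a)) (*-identityʳ _))) ⟩
    Σ[ allFin m ] (λ y → 𝟙 (x is y)) ≡⟨ Σ-is x ⟩
    1ℚ ∎
  where open ≡-Reasoning

-- For each of the t coordinates, m^(t-1) tuples agree with `a` there. Multiplying by m avoids the
-- exponent t - 1.
Σ-agreements : ∀ {m t} (a : Vec (Fin m) t) → Σ[ tuples m t ] (agreements a) * ι m ≡ ι t * ι m ^ t
Σ-agreements {m} [] = trans (cong (_* ι m) (+-identityʳ 0ℚ)) (trans (*-zeroˡ (ι m)) (sym (*-zeroˡ 1ℚ)))
Σ-agreements {m} {suc t} (x ∷ a) = begin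
    Σ[ tuples m (suc t) ] (agreements (x ∷ a)) * ι m
      ≡⟨ cong (_* ι m) (trans (Σ-cartesian _∷_ (allFin m) (tuples m t) (agreements (x ∷ a)))
           (Σ-cong (allFin m) (λ y → trans (Σ-+ (tuples m t) (λ _ → 𝟙 (x is y)) (agreements a))
             (cong (_+ K) (trans (Σ-const (tuples m t) (𝟙 (x is y))) (cong (_* 𝟙 (x is y)) (length-tuples m t))))))) ⟩
    Σ[ allFin m ] (λ y → ι m ^ t * 𝟙 (x is y) + K) * ι m
      ≡⟨ cong (_* ι m) (trans (Σ-+ (allFin m) (λ y → ι m ^ t * 𝟙 (x is y)) (λ _ → K))
           (cong₂ _+_ (trans (Σ-*ˡ (allFin m) (ι m ^ t) (λ y → 𝟙 (x is y))) (cong (ι m ^ t *_) (Σ-is x)))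
             (trans (Σ-const (allFin m) K) (cong (λ l → ι l * K) (List.length-tabulate {n = m} id))))) ⟩
    (ι m ^ t * 1ℚ + ι m * K) * ι m
      ≡⟨ solve 3 (λ p m k → (p :* con 1ℚ :+ m :* k) :* m := m :* p :+ m :* (k :* m)) refl (ι m ^ t) (ι m) K ⟩
    ι m * ι m ^ t + ι m * (K * ι m)     ≡⟨ cong (λ z → ι m * ι m ^ t + ι m * z) (Σ-agreements a) ⟩
    ι m * ι m ^ t + ι m * (ι t * ι m ^ t)
      ≡⟨ solve 3 (λ p m t → m :* p :+ m :* (t :* p) := (con 1ℚ :+ t) :* (m :* p)) refl (ι m ^ t) (ι m) (ι t) ⟩
    (1ℚ + ι t) * (ι m * ι m ^ t)        ≡⟨ cong (_* (ι m * ι m ^ t)) (sym (ι-suc t)) ⟩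
    ι (suc t) * (ι m * ι m ^ t) ∎
  where
  open ≡-Reasoning
  K = Σ[ tuples m t ] (agreements a)

-- Tuples of vertices without popular neighbours

-- `x i k` is the k-th vertex of part i. Injectivity in both arguments says that the parts are
-- disjoint, so two tuples can share a vertex only in the same coordinate.
module Configuration {n t m : ℕ} (r : ℕ) (x : Fin t → Fin m → Fin n)
  (x-inj : ∀ {i j k l} → x i k ≡ x j l → i ≡ j × k ≡ l)
  (z : Fin n) (x≢z : ∀ i k → x i k ≢ z) where

  vertex : Vec (Fin m) t → Fin t → Fin n
  vertex a i = x i (lookup a i)

  vertex-inj : ∀ a {i j} → vertex a i ≡ vertex a j → i ≡ j
  vertex-inj a e = proj₁ (x-inj e)

  selected : Vec (Fin m) t → List (Fin n)
  selected a = List.tabulate (vertex a)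

  reserved : Vec (Fin m) t → List (Fin n)
  reserved a = z ∷ selected a

  pairs : Vec (Fin m) t → List (Fin n × Fin n)
  pairs a = List.cartesianProduct (reserved a) (reserved a)

  neighbours : Vec (Fin m) t → Graph n → Fin n → Vec Bool t
  neighbours a G y = tabulate (λ i → edge G y (vertex a i))

  -- All ordered pairs occur, the diagonal included, where the factor is 1. This affects only the
  -- constant (t+1)² in the union bound.
  independent : Vec (Fin m) t → Graph n → ℚ
  independent a G = Π[ pairs a ] (λ p → 𝟙 (not (edge G (proj₁ p) (proj₂ p))))

  fewAt : Vec (Fin m) t → Fin n → Graph n → ℚ
  fewAt a y G = 𝟙 (few r (neighbours a G y))

  good : Vec (Fin m) t → Graph n → ℚ
  good a G = independent a G * Π[ allFin n ] (λ y → outside (reserved a) (fewAt a y G) y)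

  goodCount : Graph n → ℚ
  goodCount G = Σ[ tuples m t ] (λ a → good a G)

  length-reserved : ∀ a → length (reserved a) ≡ suc t
  length-reserved a = cong suc (List.length-tabulate (vertex a))

  length-pairs : ∀ a → length (pairs a) ≡ suc t Nat.* suc t
  length-pairs a = trans (length-cartesianProductWith _,_ (reserved a) (reserved a))
    (cong₂ Nat._*_ (length-reserved a) (length-reserved a))

  0≤independent : ∀ a G → 0ℚ ≤ℚ independent a G
  0≤independent a G = 0≤Π (pairs a) (λ p → 0≤𝟙 (not (edge G (proj₁ p) (proj₂ p))))

  0≤outside : ∀ L {w} y → 0ℚ ≤ℚ w → 0ℚ ≤ℚ outside {n} L w y
  0≤outside L y h with mem L y
  ... | true  = 0≤1
  ... | false = h

  0≤fewAt : ∀ a y G → 0ℚ ≤ℚ fewAt a y G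
  0≤fewAt a y G = 0≤𝟙 (few r (neighbours a G y))

  fewAt≤1 : ∀ a y G → fewAt a y G ≤ℚ 1ℚ
  fewAt≤1 a y G = 𝟙≤1 (few r (neighbours a G y))

  module Moments (q : ℚ) (0≤q : 0ℚ ≤ℚ q) (q≤1 : q ≤ℚ 1ℚ) where
    open Expectation q 0≤q q≤1
    open Binomial q 0≤q q≤1

    v : ℚ
    v = few-prob t r

    0≤v : 0ℚ ≤ℚ v
    0≤v = 0≤few-prob t r

    v≤1 : v ≤ℚ 1ℚ
    v≤1 = few-prob≤1 t r

    Et-edge-≤ : ∀ (u w : Fin n) → Et (λ G → 𝟙 (edge G u w)) ≤ℚ q
    Et-edge-≤ u w with u Fin.≟ w
    ... | yes refl = ≤-trans (≤-reflexive (trans (Et-cong (λ G → cong 𝟙 (edge-irrefl G u))) (Et-const {n} 0ℚ))) 0≤q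
    ... | no u≢w   = ≤-reflexive (trans (Et-edge 𝟙 u w u≢w)
      (solve 1 (λ q → q :* con 1ℚ :+ (con 1ℚ :- q) :* con 0ℚ := q) refl q))

    -- A union bound instead of independence, since a list of pairs such as `pairs a` contains the
    -- same pair in both orders.
    Et-no-edges : ∀ (ps : List (Fin n × Fin n)) →
      1ℚ - ι (length ps) * q ≤ℚ Et (λ G → Π[ ps ] (λ p → 𝟙 (not (edge G (proj₁ p) (proj₂ p)))))
    Et-no-edges [] = ≤-reflexive (trans (solve 1 (λ q → con 1ℚ :- con 0ℚ :* q := con 1ℚ) refl q) (sym (Et-const {n} 1ℚ)))
    Et-no-edges ((u , w) ∷ ps) = begin
        1ℚ - ι (suc (length ps)) * q
          ≡⟨ cong (λ z → 1ℚ - z * q) (ι-suc (length ps)) ⟩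
        1ℚ - (1ℚ + ι (length ps)) * q
          ≡⟨ solve 2 (λ k q → con 1ℚ :- (con 1ℚ :+ k) :* q := (con 1ℚ :- k :* q) :- q) refl (ι (length ps)) q ⟩
        (1ℚ - ι (length ps) * q) - q
          ≤⟨ +-mono-≤ (Et-no-edges ps) (neg-antimono-≤ (Et-edge-≤ u w)) ⟩
        Et rest - Et (λ G → 𝟙 (edge G u w))
          ≡⟨ solve 2 (λ a b → a :- b := con 1ℚ :* a :+ (:- con 1ℚ) :* b) refl (Et rest) (Et (λ G → 𝟙 (edge G u w))) ⟩
        1ℚ * Et rest + (- 1ℚ) * Et (λ G → 𝟙 (edge G u w))
          ≡⟨ sym (Et-linear 1ℚ (- 1ℚ) rest (λ G → 𝟙 (edge G u w))) ⟩
        Et (λ G → 1ℚ * rest G + (- 1ℚ) * 𝟙 (edge G u w))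
          ≤⟨ Et-mono (λ G → step (edge G u w) (rest G)
               (Π≤1 ps (λ p → 0≤𝟙 (not (edge G (proj₁ p) (proj₂ p)))) (λ p → 𝟙≤1 (not (edge G (proj₁ p) (proj₂ p)))))) ⟩
        Et (λ G → 𝟙 (not (edge G u w)) * rest G) ∎
      where
      open ℚ.≤-Reasoning
      rest : Graph n → ℚ
      rest G = Π[ ps ] (λ p → 𝟙 (not (edge G (proj₁ p) (proj₂ p))))
      step : ∀ b x → x ≤ℚ 1ℚ → 1ℚ * x + (- 1ℚ) * 𝟙 b ≤ℚ 𝟙 (not b) * x
      step true x h = ≤-by (1ℚ - x) (diff-nonneg h)
        (solve 1 (λ x → con 0ℚ :* x :- (con 1ℚ :* x :+ (:- con 1ℚ) :* con 1ℚ) := con 1ℚ :- x) refl x)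
      step false x h = ≤-reflexive (solve 1 (λ x → con 1ℚ :* x :+ (:- con 1ℚ) :* con 0ℚ := con 1ℚ :* x) refl x)

    fewAt-reads : ∀ a y → Reads (λ i j → i ≡ y × j ∈ₗ selected a) (fewAt a y)
    fewAt-reads a y G H h = cong (λ w → 𝟙 (few r w))
      (Vec.tabulate-cong (λ i → h y (vertex a i) (refl , ∈-tabulate⁺ i)))

    outside-reads : ∀ (L : List (Fin n)) {R : Fin n → Fin n → Set} y (f : Graph n → ℚ) → (mem L y ≡ false → Reads R f) →
      Reads R (λ G → outside L (f G) y)
    outside-reads L y f rf G H h with mem L y
    ... | true  = refl
    ... | false = rf refl G H h

    outside-inside : ∀ (L : List (Fin n)) {w} y → mem L y ≡ true → outside {n} L w y ≡ 1ℚ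
    outside-inside L {w} y e = cong (λ b → if b then 1ℚ else w) e

    Et-fewAt : ∀ a y → mem (selected a) y ≡ false → Et (fewAt a y) ≡ v
    Et-fewAt a y y∉ = Et-marginal y (vertex a) (vertex-inj a)
      (λ i → mem-false {L = selected a} y∉ (∈-tabulate⁺ i)) (λ w → 𝟙 (few r w))

    Et-good : ∀ a → (1ℚ - ι (suc t Nat.* suc t) * q) * v ^ n ≤ℚ Et (good a)
    Et-good a = begin
        (1ℚ - ι (suc t Nat.* suc t) * q) * v ^ n
          ≤⟨ *-monoʳ (v ^ n) (0≤^ n 0≤v)
               (subst (λ k → 1ℚ - ι k * q ≤ℚ Et (independent a)) (length-pairs a) (Et-no-edges (pairs a))) ⟩
        Et (independent a) * v ^ n
          ≤⟨ *-monoˡ (Et (independent a)) (0≤Et {n} (0≤independent a)) v^n≤ ⟩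
        Et (independent a) * Π[ allFin n ] (λ y → Et (ψ y))
          ≡⟨ sym (Et-peel (mem S) ψ (independent a) reads-ind (λ y e G → outside-inside S {fewAt a y G} y e)
               (λ y _ → outside-reads S {λ i j → i ≡ y × mem S j ≡ true} y (fewAt a y) (λ _ G H h → fewAt-reads a y G H
                  λ i j (i≡y , j∈) → h i j (i≡y , mem⁺ {L = S} (there j∈))))
               (allFin n) (Unique.allFin⁺ n)) ⟩
        Et (good a) ∎
      where
      open ℚ.≤-Reasoning
      S = reserved a
      ψ : Fin n → Graph n → ℚ
      ψ y G = outside S (fewAt a y G) y
      reads-ind : Reads (λ i j → mem S i ≡ true × mem S j ≡ true) (independent a)
      reads-ind G H h = Π-cong-∈ (pairs a) λ p p∈ → cong (𝟙 ∘ not)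
        (h (proj₁ p) (proj₂ p) (mem⁺ (proj₁ (∈-cartesianProduct⁻ S S p∈)) , mem⁺ (proj₂ (∈-cartesianProduct⁻ S S p∈))))
      v≤ψ : ∀ y → v ≤ℚ Et (ψ y)
      v≤ψ y with mem S y in e
      -- A reserved vertex carries no condition; a factor v ≤ 1 is charged for it as well, so that
      -- the exponent is n.
      ... | true  = ≤-trans v≤1 (≤-reflexive (sym (Et-const {n} 1ℚ)))
      ... | false = ≤-reflexive (sym (Et-fewAt a y (Bool.∨-conicalʳ (y is z) (mem (selected a) y) e)))
      v^n≤ : v ^ n ≤ℚ Π[ allFin n ] (λ y → Et (ψ y))
      v^n≤ = begin
        v ^ n                        ≡⟨ cong (v ^_) (sym (List.length-tabulate {n = n} id)) ⟩
        v ^ length (allFin n)        ≡⟨ sym (Π-const (allFin n) v) ⟩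
        Π[ allFin n ] (λ _ → v)      ≤⟨ Π-mono (allFin n) (λ _ → 0≤v) v≤ψ ⟩
        Π[ allFin n ] (λ y → Et (ψ y)) ∎

    -- The size of two reserved sets together, counted with multiplicity. At least n - D vertices
    -- have to satisfy the conditions of both tuples.
    D : ℕ
    D = suc t Nat.+ suc t

    -- For an upper bound, both independence requirements are dropped, and so are the conditions at
    -- vertices reserved for either tuple. The remaining conditions at different vertices read
    -- disjoint sets of edges, so `Et-peel` factors them.
    Et-good-pair : ∀ a b {w} → 0ℚ ≤ℚ w → w ≤ℚ 1ℚ →
      (∀ y → mem (selected a) y ≡ false → mem (selected b) y ≡ false →
        Et (λ G → fewAt a y G * fewAt b y G) ≤ℚ w) →
      Et (λ G → good a G * good b G) ≤ℚ w ^ (n Nat.∸ D)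
    Et-good-pair a b {w} 0≤w w≤1 hw = begin
        Et (λ G → good a G * good b G)    ≤⟨ Et-mono pointwise ⟩
        Et (λ G → 1ℚ * Π[ allFin n ] (λ y → ψ y G))
          ≡⟨ Et-peel (mem S) ψ (λ _ → 1ℚ) (λ _ _ _ → refl) (λ y e G → outside-inside S {fewAt a y G * fewAt b y G} y e)
               (λ y _ → outside-reads S {λ i j → i ≡ y × mem S j ≡ true} y (λ G → fewAt a y G * fewAt b y G)
                 (λ _ G H h → cong₂ _*_
                  (fewAt-reads a y G H λ i j (i≡y , j∈) → h i j (i≡y , mem⁺ {L = S} (there (∈-++⁺ˡ j∈))))
                  (fewAt-reads b y G H λ i j (i≡y , j∈) → h i j (i≡y , mem⁺ {L = S} (∈-++⁺ʳ (reserved a) (there j∈))))))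
               (allFin n) (Unique.allFin⁺ n) ⟩
        Et {n} (λ _ → 1ℚ) * Π[ allFin n ] (λ y → Et (ψ y))
          ≡⟨ trans (cong (_* Π[ allFin n ] (λ y → Et (ψ y))) (Et-const {n} 1ℚ)) (*-identityˡ _) ⟩
        Π[ allFin n ] (λ y → Et (ψ y))
          ≤⟨ Π-mono (allFin n) (λ y → 0≤Et {n} (λ G → 0≤outside S y (0≤few G y))) ψ≤ ⟩
        Π[ allFin n ] (outside S w)         ≤⟨ Π-outside S 0≤w w≤1 ⟩
        w ^ (n Nat.∸ length S)
          ≡⟨ cong (λ k → w ^ (n Nat.∸ k)) (trans (List.length-++ (reserved a))
               (cong₂ Nat._+_ (length-reserved a) (length-reserved b))) ⟩
        w ^ (n Nat.∸ D) ∎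
      where
      open ℚ.≤-Reasoning
      S = reserved a ++ reserved b
      ψ : Fin n → Graph n → ℚ
      ψ y G = outside S (fewAt a y G * fewAt b y G) y
      0≤few : ∀ G y → 0ℚ ≤ℚ fewAt a y G * fewAt b y G
      0≤few G y = 0≤* (0≤fewAt a y G) (0≤fewAt b y G)
      shrink : ∀ a y {w} → w ≤ℚ 1ℚ → 0ℚ ≤ℚ w → (∀ {u} → u ∈ₗ reserved a → u ∈ₗ S) →
        outside (reserved a) w y ≤ℚ outside S w y
      shrink a y {w} w1 w0 sub with mem (reserved a) y in e
      ... | true rewrite mem⁺ {L = S} (sub (mem⁻ (reserved a) e)) = ≤-refl
      ... | false with mem S y
      ...   | true  = w1
      ...   | false = ≤-refl
      merge : ∀ y {u w} → outside S u y * outside S w y ≡ outside S (u * w) y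
      merge y with mem S y
      ... | true  = refl
      ... | false = refl
      pointwise : ∀ G → good a G * good b G ≤ℚ 1ℚ * Π[ allFin n ] (λ y → ψ y G)
      pointwise G = begin
        (ia * Πa) * (ib * Πb) ≡⟨ solve 4 (λ i p j s → (i :* p) :* (j :* s) := (i :* j) :* (p :* s)) refl ia Πa ib Πb ⟩
        (ia * ib) * (Πa * Πb)
          ≤⟨ *-mono (0≤* (0≤independent a G) (0≤independent b G))
               (*-≤1 (0≤independent a G) (independent≤1 a) (independent≤1 b))
               (0≤* (0≤Π (allFin n) (0≤ψ a)) (0≤Π (allFin n) (0≤ψ b)))
               (begin
                 Πa * Πb ≡⟨ sym (Π-* (allFin n) _ _) ⟩
                 Π[ allFin n ] (λ y → outside (reserved a) (fewAt a y G) y * outside (reserved b) (fewAt b y G) y)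
                   ≤⟨ Π-mono (allFin n) (λ y → 0≤* (0≤ψ a y) (0≤ψ b y)) (λ y → ≤-trans
                        (*-mono (0≤ψ a y) (shrink a y (fewAt≤1 a y G) (0≤fewAt a y G) ∈-++⁺ˡ)
                                (0≤ψ b y) (shrink b y (fewAt≤1 b y G) (0≤fewAt b y G) (∈-++⁺ʳ (reserved a))))
                        (≤-reflexive (merge y))) ⟩
                 Π[ allFin n ] (λ y → ψ y G) ∎) ⟩
        1ℚ * Π[ allFin n ] (λ y → ψ y G) ∎
        where
        ia = independent a G
        ib = independent b G
        Πa = Π[ allFin n ] (λ y → outside (reserved a) (fewAt a y G) y)
        Πb = Π[ allFin n ] (λ y → outside (reserved b) (fewAt b y G) y)
        independent≤1 : ∀ a → independent a G ≤ℚ 1ℚ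
        independent≤1 a = Π≤1 (pairs a) (λ p → 0≤𝟙 (not (edge G (proj₁ p) (proj₂ p)))) (λ p → 𝟙≤1 (not (edge G
          (proj₁ p) (proj₂ p))))
        0≤ψ : ∀ a y → 0ℚ ≤ℚ outside (reserved a) (fewAt a y G) y
        0≤ψ a y = 0≤outside (reserved a) y (0≤𝟙 (few r (neighbours a G y)))
      ψ≤ : ∀ y → Et (ψ y) ≤ℚ outside S w y
      ψ≤ y with mem S y in e
      ... | true  = ≤-reflexive (Et-const {n} 1ℚ)
      ... | false = hw y (not-in {selected a} (λ p → there (∈-++⁺ˡ p))) (not-in {selected b} (λ p → ∈-++⁺ʳ
        (reserved a) (there p)))
        where
        not-in : ∀ {L} → (∀ {u} → u ∈ₗ L → u ∈ₗ S) → mem L y ≡ false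
        not-in {L} sub with mem L y in e′
        ... | false = refl
        ... | true  = case trans (sym e) (mem⁺ (sub (mem⁻ L e′))) of λ ()

    -- The condition for `b` is dropped. This serves equal tuples, and in case (ii) all intersecting
    -- pairs.
    Et-few-same : ∀ a b y → mem (selected a) y ≡ false → Et (λ G → fewAt a y G * fewAt b y G) ≤ℚ v
    Et-few-same a b y y∉ = ≤-trans
      (Et-mono (λ G → *≤ˡ (0≤𝟙 (few r (neighbours a G y))) (𝟙≤1 (few r (neighbours b G y)))))
      (≤-reflexive (Et-fewAt a y y∉))

    Et-few-disjoint : ∀ a b y → (∀ i → lookup a i ≢ lookup b i) →
      mem (selected a) y ≡ false → mem (selected b) y ≡ false →
      Et (λ G → fewAt a y G * fewAt b y G) ≡ v * v
    Et-few-disjoint a b y a≢b y∉a y∉b = trans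
      (Et-indep-meeting (mem (selected a))
        (λ G H h → fewAt-reads a y G H λ i j (_ , j∈) → h i j (inj₂ (mem⁺ {L = selected a} j∈)))
        (λ G H h → fewAt-reads b y G H λ { i j (refl , j∈) → h i j (y∉a , apart j∈) }))
      (cong₂ _*_ (Et-fewAt a y y∉a) (Et-fewAt b y y∉b))
      where
      apart : ∀ {j} → j ∈ₗ selected b → mem (selected a) j ≡ false
      apart {j} j∈ with mem (selected a) j in e
      ... | false = refl
      ... | true with ∈-tabulate⁻ {f = vertex b} j∈ | ∈-tabulate⁻ {f = vertex a} (mem⁻ (selected a) e)
      ...   | k , refl | l , e′ with x-inj e′
      ...     | refl , bk≡al = contradiction (sym bk≡al) (a≢b k)

    -- Inclusion–exclusion: if both neighbourhoods are full, then so is that of a with one more vertex.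
    Et-few-distinct : t ≡ r → ∀ a b y i → lookup a i ≢ lookup b i →
      mem (selected a) y ≡ false → mem (selected b) y ≡ false →
      Et (λ G → fewAt a y G * fewAt b y G) ≤ℚ (1ℚ - q ^ t) - q ^ t + q ^ suc t
    Et-few-distinct refl a b y i ai≢bi y∉a y∉b = begin
        Et (λ G → fewAt a y G * fewAt b y G) ≤⟨ Et-mono pointwise ⟩
        Et (λ G → 1ℚ * (1ℚ * fewAt a y G + (- 1ℚ) * A b G) + 1ℚ * A⁺ G)
          ≡⟨ Et-linear 1ℚ 1ℚ (λ G → 1ℚ * fewAt a y G + (- 1ℚ) * A b G) A⁺ ⟩
        1ℚ * Et (λ G → 1ℚ * fewAt a y G + (- 1ℚ) * A b G) + 1ℚ * Et A⁺
          ≡⟨ cong (λ e → 1ℚ * e + 1ℚ * Et A⁺) (Et-linear 1ℚ (- 1ℚ) (fewAt a y) (A b)) ⟩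
        1ℚ * (1ℚ * Et (fewAt a y) + (- 1ℚ) * Et (A b)) + 1ℚ * Et A⁺
          ≡⟨ solve 3 (λ a b c → con 1ℚ :* (con 1ℚ :* a :+ (:- con 1ℚ) :* b) :+ con 1ℚ :* c := (a :- b) :+ c) refl
               (Et (fewAt a y)) (Et (A b)) (Et A⁺) ⟩
        (Et (fewAt a y) - Et (A b)) + Et A⁺
          ≡⟨ cong₂ _+_ (cong₂ _-_ (trans (Et-fewAt a y y∉a) (few-prob-all t)) EtAb) EtA⁺ ⟩
        (1ℚ - q ^ t) - q ^ t + q ^ suc t ∎
      where
      open ℚ.≤-Reasoning
      A : Vec (Fin m) t → Graph n → ℚ
      A a G = ∧-all (neighbours a G y)
      c : Fin (suc t) → Fin n
      c zero    = vertex b i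
      c (suc j) = vertex a j
      c-inj : ∀ {j k} → c j ≡ c k → j ≡ k
      c-inj {zero}  {zero}  e = refl
      c-inj {zero}  {suc k} e with x-inj e
      ... | refl , e′ = contradiction (sym e′) ai≢bi
      c-inj {suc j} {zero}  e with x-inj e
      ... | refl , e′ = contradiction e′ ai≢bi
      c-inj {suc j} {suc k} e = cong suc (vertex-inj a e)
      c≢y : ∀ j → c j ≢ y
      c≢y zero    = mem-false {L = selected b} y∉b (∈-tabulate⁺ i)
      c≢y (suc j) = mem-false {L = selected a} y∉a (∈-tabulate⁺ j)
      A⁺ : Graph n → ℚ
      A⁺ G = ∧-all (tabulate (λ j → edge G y (c j)))
      EtAb : Et (A b) ≡ q ^ t
      EtAb = trans (Et-marginal y (vertex b) (vertex-inj b) (λ j → mem-false {L = selected b} y∉b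
        (∈-tabulate⁺ j)) ∧-all) (Ev-∧-all t)
      EtA⁺ : Et A⁺ ≡ q ^ suc t
      EtA⁺ = trans (Et-marginal y c c-inj c≢y ∧-all) (Ev-∧-all (suc t))
      pointwise : ∀ G → fewAt a y G * fewAt b y G ≤ℚ 1ℚ * (1ℚ * fewAt a y G + (- 1ℚ) * A b G) + 1ℚ * A⁺ G
      pointwise G = begin
        fewAt a y G * fewAt b y G ≡⟨ cong₂ _*_ (few-all (neighbours a G y)) (few-all (neighbours b G y)) ⟩
        (1ℚ - A a G) * (1ℚ - A b G)
          ≤⟨ ≤-by (A a G * (bit - A b G)) (0≤* (0≤∧-all (neighbours a G y)) (diff-nonneg
               (subst (λ e → A b G ≤ℚ 𝟙 e) (Vec.lookup∘tabulate (λ j → edge G y (vertex b j)) i) (∧-all≤ (neighbours b G y) i))))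
               (solve 3 (λ a b e → (con 1ℚ :* (con 1ℚ :* (con 1ℚ :- a) :+ (:- con 1ℚ) :* b) :+ con 1ℚ :* (e :* a))
                  :- (con 1ℚ :- a) :* (con 1ℚ :- b) := a :* (e :- b)) refl (A a G) (A b G) bit) ⟩
        1ℚ * (1ℚ * (1ℚ - A a G) + (- 1ℚ) * A b G) + 1ℚ * A⁺ G
          ≡⟨ cong (λ e → 1ℚ * (1ℚ * e + (- 1ℚ) * A b G) + 1ℚ * A⁺ G) (sym (few-all (neighbours a G y))) ⟩
        1ℚ * (1ℚ * fewAt a y G + (- 1ℚ) * A b G) + 1ℚ * A⁺ G ∎
        where bit = 𝟙 (edge G y (vertex b i))

    N′ : ℕ
    N′ = n Nat.∸ D

    -- `w` bounds the joint probability at one outer vertex for two unequal tuples. It stays a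
    -- parameter because the cases supply different values: 1 - 2q^r + q^(r+1) in (i), and v itself
    -- in (ii).
    module SecondMoment (w : ℚ) (0≤w : 0ℚ ≤ℚ w) (w≤1 : w ≤ℚ 1ℚ)
      (hw : ∀ a b y i → lookup a i ≢ lookup b i → mem (selected a) y ≡ false → mem (selected b) y ≡ false →
        Et (λ G → fewAt a y G * fewAt b y G) ≤ℚ w) where

      M g V W c : ℚ
      M = ι m ^ t
      g = 1ℚ - ι (suc t Nat.* suc t) * q
      V = v ^ N′
      W = w ^ N′
      c = M * (g * (V * v ^ D))

      0≤M : 0ℚ ≤ℚ M
      0≤M = 0≤^ t (0≤ι m)
      0≤V : 0ℚ ≤ℚ V
      0≤V = 0≤^ N′ 0≤v
      0≤W : 0ℚ ≤ℚ W
      0≤W = 0≤^ N′ 0≤w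

      -- Disjoint, intersecting and equal pairs contribute at most V², W and V. Weighting W by
      -- `agreements` and V by `same` merges the three cases into one expression that can be summed
      -- over `b`.
      pair-bound : ∀ a b → Et (λ G → good a G * good b G) ≤ℚ (V * V + agreements a b * W) + same a b * V
      pair-bound a b with Fin.any? (λ i → lookup a i Fin.≟ lookup b i) | Vec.≡-dec Fin._≟_ a b
      ... | no none | _ = begin
          Et (λ G → good a G * good b G)
            ≤⟨ Et-good-pair a b (0≤* 0≤v 0≤v) (*-≤1 0≤v v≤1 v≤1)
                 (λ y y∉a y∉b → ≤-reflexive (Et-few-disjoint a b y (λ i e → none (i , e)) y∉a y∉b)) ⟩
          (v * v) ^ N′ ≡⟨ Exp.^-distrib-* v v N′ ⟩
          V * V
            ≤⟨ ≤-by _ (0≤+ (0≤* (0≤agreements a b) 0≤W) (0≤* (0≤same a b) 0≤V))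
                 (solve 3 (λ x y z → ((x :+ y) :+ z) :- x := y :+ z) refl (V * V) (agreements a b * W) (same a b * V)) ⟩
          (V * V + agreements a b * W) + same a b * V ∎
        where
        open ℚ.≤-Reasoning
      ... | yes _ | yes refl = begin
          Et (λ G → good a G * good a G)
            ≤⟨ Et-good-pair a a 0≤v v≤1 (λ y y∉ _ → Et-few-same a a y y∉) ⟩
          V
            ≤⟨ ≤-by _ (0≤+ (0≤* 0≤V 0≤V) (0≤* (0≤agreements a a) 0≤W))
                 (solve 2 (λ x y → (x :+ con 1ℚ :* y) :- y := x) refl (V * V + agreements a a * W) V) ⟩
          (V * V + agreements a a * W) + 1ℚ * V
            ≡⟨ cong (λ e → (V * V + agreements a a * W) + e * V) (sym (same-refl a)) ⟩
          (V * V + agreements a a * W) + same a a * V ∎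
        where
        open ℚ.≤-Reasoning
      ... | yes (j , aj≡bj) | no a≢b = begin
          Et (λ G → good a G * good b G)
            ≤⟨ Et-good-pair a b 0≤w w≤1 (λ y → hw a b y (proj₁ differ) (proj₂ differ)) ⟩
          W
            ≤⟨ ≤-by _ (0≤+ (0≤+ (0≤* 0≤V 0≤V) (0≤* (diff-nonneg (1≤agreements a b j aj≡bj)) 0≤W)) (0≤* (0≤same a b) 0≤V))
                 (solve 4 (λ x k w y → ((x :+ k :* w) :+ y) :- w := (x :+ (k :- con 1ℚ) :* w) :+ y) refl
                   (V * V) (agreements a b) W (same a b * V)) ⟩
          (V * V + agreements a b * W) + same a b * V ∎
        where
        open ℚ.≤-Reasoning
        ext : ∀ {k} (a b : Vec (Fin m) k) → (∀ i → lookup a i ≡ lookup b i) → a ≡ b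
        ext []      []      h = refl
        ext (x ∷ a) (y ∷ b) h = cong₂ _∷_ (h zero) (ext a b (h ∘ suc))
        differ : ∃[ i ] lookup a i ≢ lookup b i
        differ = Fin.¬∀⟶∃¬ t _ (λ i → lookup a i Fin.≟ lookup b i) (λ h → a≢b (ext a b h))

      goodCount-mean : 0ℚ ≤ℚ g → c ≤ℚ Et goodCount
      goodCount-mean 0≤g = begin
          M * (g * (V * v ^ D))
            ≤⟨ *-monoˡ M 0≤M (*-monoˡ g 0≤g (begin
                 V * v ^ D       ≡⟨ sym (Exp.^-homo-* v N′ D) ⟩
                 -- Truncated subtraction still satisfies n ≤ (n ∸ D) + D, so n < D needs no
                 -- separate treatment.
                 v ^ (N′ Nat.+ D) ≤⟨ ^-anti 0≤v v≤1 (subst (n ≤_) (ℕ.+-comm D N′) (ℕ.m≤n+m∸n n D)) ⟩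
                 v ^ n ∎)) ⟩
          M * (g * v ^ n)  ≡⟨ cong (_* (g * v ^ n)) (sym (length-tuples m t)) ⟩
          ι (length (tuples m t)) * (g * v ^ n)  ≡⟨ sym (Σ-const (tuples m t) (g * v ^ n)) ⟩
          Σ[ tuples m t ] (λ _ → g * v ^ n)      ≤⟨ Σ-mono (tuples m t) Et-good ⟩
          Σ[ tuples m t ] (λ a → Et (good a))    ≡⟨ sym (Et-Σ (tuples m t) good) ⟩
          Et goodCount ∎
        where open ℚ.≤-Reasoning

      goodCount-square : ∀ β → 0ℚ <ℚ ι m → (ι t * M) * W ≤ℚ β * ι m →
        Et (λ G → goodCount G * goodCount G) ≤ℚ M * ((M * (V * V) + β) + V)
      goodCount-square β 0<m hβ = begin
          Et (λ G → goodCount G * goodCount G)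
            ≡⟨ Et-cong (λ G → trans (sym (Σ-*ʳ T (goodCount G) (λ a → good a G)))
                 (Σ-cong T (λ a → sym (Σ-*ˡ T (good a G) (λ b → good b G))))) ⟩
          Et (λ G → Σ[ T ] (λ a → Σ[ T ] (λ b → good a G * good b G)))
            ≡⟨ trans (Et-Σ T (λ a G → Σ[ T ] (λ b → good a G * good b G)))
                 (Σ-cong T (λ a → Et-Σ T (λ b G → good a G * good b G))) ⟩
          Σ[ T ] (λ a → Σ[ T ] (λ b → Et (λ G → good a G * good b G)))
            ≤⟨ Σ-mono T (λ a → ≤-trans (Σ-mono T (pair-bound a)) (row a)) ⟩
          Σ[ T ] (λ _ → (M * (V * V) + β) + V)  ≡⟨ Σ-const T _ ⟩
          ι (length T) * ((M * (V * V) + β) + V)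
            ≡⟨ cong (_* ((M * (V * V) + β) + V)) (length-tuples m t) ⟩
          M * ((M * (V * V) + β) + V) ∎
        where
        open ℚ.≤-Reasoning
        T = tuples m t
        K : Vec (Fin m) t → ℚ
        K a = Σ[ T ] (agreements a)
        KW≤ : ∀ a → K a * W ≤ℚ β
        KW≤ a = *-cancelˡ (ι m) 0<m (begin
          ι m * (K a * W)  ≡⟨ solve 3 (λ m k w → m :* (k :* w) := (k :* m) :* w) refl (ι m) (K a) W ⟩
          (K a * ι m) * W  ≡⟨ cong (_* W) (Σ-agreements a) ⟩
          (ι t * M) * W    ≤⟨ hβ ⟩
          β * ι m          ≡⟨ *-comm β (ι m) ⟩
          ι m * β ∎)
        row : ∀ a → Σ[ T ] (λ b → (V * V + agreements a b * W) + same a b * V) ≤ℚ (M * (V * V) + β) + V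
        row a = begin
          Σ[ T ] (λ b → (V * V + agreements a b * W) + same a b * V)
            ≡⟨ trans (Σ-+ T (λ b → V * V + agreements a b * W) (λ b → same a b * V))
                 (cong₂ _+_ (Σ-+ T (λ _ → V * V) (λ b → agreements a b * W)) (Σ-*ʳ T V (same a))) ⟩
          (Σ[ T ] (λ _ → V * V) + Σ[ T ] (λ b → agreements a b * W)) + Σ[ T ] (same a) * V
            ≡⟨ cong₂ _+_ (cong₂ _+_ (trans (Σ-const T (V * V)) (cong (_* (V * V)) (length-tuples m t))) (Σ-*ʳ T W (agreements a)))
                 (trans (cong (_* V) (Σ-same a)) (*-identityˡ V)) ⟩
          (M * (V * V) + K a * W) + V
            ≤⟨ +-monoˡ-≤ V (+-monoʳ-≤ (M * (V * V)) (KW≤ a)) ⟩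
          (M * (V * V) + β) + V ∎

      -- Chebyshev: where goodCount vanishes, (goodCount - c)² = c².
      chebyshev : ∀ {X} → 0ℚ ≤ℚ c → c ≤ℚ Et goodCount → Et (λ G → goodCount G * goodCount G) ≤ℚ X →
        (B : Graph n → Bool) → (∀ G → B G ≡ true → goodCount G ≡ 0ℚ) →
        (c * c) * Et (λ G → 𝟙 (B G)) + c * c ≤ℚ X
      chebyshev {X} 0≤c hc hX B hB = begin
          (c * c) * Et (λ G → 𝟙 (B G)) + c * c
            ≡⟨ cong (_+ c * c) (sym (Et-*ˡ (c * c) (λ G → 𝟙 (B G)))) ⟩
          Et (λ G → (c * c) * 𝟙 (B G)) + c * c
            ≤⟨ +-monoˡ-≤ (c * c) (Et-mono (λ G → pointwise (B G) (goodCount G) (hB G))) ⟩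
          Et (λ G → (1ℚ * (goodCount G * goodCount G) + (- (c + c)) * goodCount G) + c * c) + c * c
            ≡⟨ cong (_+ c * c) (trans (Et-+ (λ G → 1ℚ * (goodCount G * goodCount G) + (- (c + c)) * goodCount G) (λ _ → c * c))
                 (cong₂ _+_ (Et-linear 1ℚ (- (c + c)) (λ G → goodCount G * goodCount G) goodCount) (Et-const {n} (c * c)))) ⟩
          ((1ℚ * Q + (- (c + c)) * E) + c * c) + c * c
            ≤⟨ ≤-by ((X - Q) + (c + c) * (E - c))
                 (0≤+ (diff-nonneg hX) (0≤* (0≤+ 0≤c 0≤c) (diff-nonneg hc)))
                 (solve 4 (λ x q c e → x :- (((con 1ℚ :* q :+ (:- (c :+ c)) :* e) :+ c :* c) :+ c :* c)
                    := (x :- q) :+ (c :+ c) :* (e :- c)) refl X Q c E) ⟩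
          X ∎
        where
        open ℚ.≤-Reasoning
        E = Et goodCount
        Q = Et (λ G → goodCount G * goodCount G)
        pointwise : ∀ b x → (b ≡ true → x ≡ 0ℚ) → (c * c) * 𝟙 b ≤ℚ (1ℚ * (x * x) + (- (c + c)) * x) + c * c
        pointwise false x _ = ≤-by ((x - c) * (x - c)) (0≤square (x - c))
          (solve 2 (λ x c → ((con 1ℚ :* (x :* x) :+ (:- (c :+ c)) :* x) :+ c :* c) :- (c :* c) :* con 0ℚ
             := (x :- c) :* (x :- c)) refl x c)
        pointwise true x h with h refl
        ... | refl = ≤-reflexive (solve 1 (λ c → (c :* c) :* con 1ℚ
             := (con 1ℚ :* (con 0ℚ :* con 0ℚ) :+ (:- (c :+ c)) :* con 0ℚ) :+ c :* c) refl c)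

      -- Against the main term (MV)², the diagonal contributes at most ε by the bound on MV, and
      -- intersecting pairs at most ε by the bound on w. So the second moment is at most (1 +
      -- 2ε)(MV)² ≤ (1 + δ)c², and `chebyshev` leaves probability at most δ.
      no-good-improbable : ∀ {δ ε} → 0ℚ <ℚ ι m → 0ℚ <ℚ 1ℚ - ι (suc t Nat.* suc t) * q → 0ℚ <ℚ v →
        1ℚ + (ε + ε) ≤ℚ (1ℚ + δ) * (((1ℚ - ι (suc t Nat.* suc t) * q) * v ^ D) * ((1ℚ - ι (suc t Nat.* suc t) * q) * v ^ D)) →
        1ℚ ≤ℚ ε * (ι m ^ t * v ^ N′) →
        (ι t * ι m ^ t) * w ^ N′ ≤ℚ (ε * (ι m ^ t * (v ^ N′ * v ^ N′))) * ι m →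
        (B : Graph n → Bool) → (∀ G → B G ≡ true → goodCount G ≡ 0ℚ) → Et (λ G → 𝟙 (B G)) ≤ℚ δ
      no-good-improbable {δ} {ε} 0<m 0<g 0<v hθ hV hW B hB =
        *-cancelˡ (c * c) (0<* 0<c 0<c) (≤-of-diff (begin
          0ℚ  ≤⟨ diff-nonneg (≤-trans (chebyshev (<⇒≤ 0<c) (goodCount-mean (<⇒≤ 0<g))
                   (goodCount-square _ 0<m hW) B hB) final) ⟩
          (1ℚ + δ) * (c * c) - ((c * c) * E + c * c)
              ≡⟨ solve 3 (λ d c e → (con 1ℚ :+ d) :* (c :* c) :- ((c :* c) :* e :+ c :* c)
                   := (c :* c) :* d :- (c :* c) :* e) refl δ c E ⟩
          (c * c) * δ - (c * c) * E ∎))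
        where
        open ℚ.≤-Reasoning
        E = Et (λ G → 𝟙 (B G))
        0<M = 0<^ t 0<m
        0<c : 0ℚ <ℚ c
        0<c = 0<* 0<M (0<* 0<g (0<* (0<^ N′ 0<v) (0<^ D 0<v)))
        final : M * ((M * (V * V) + ε * (M * (V * V))) + V) ≤ℚ (1ℚ + δ) * (c * c)
        final = begin
          M * ((M * (V * V) + ε * (M * (V * V))) + V)
            ≤⟨ ≤-by ((M * V) * (ε * (M * V) - 1ℚ)) (0≤* (0≤* 0≤M 0≤V) (diff-nonneg hV))
                 (solve 3 (λ m v e → (m :* v) :* (m :* v) :* (con 1ℚ :+ (e :+ e)) :- m :* ((m :* (v :* v) :+ e :*
                   (m :* (v :* v))) :+ v)
                    := (m :* v) :* (e :* (m :* v) :- con 1ℚ)) refl M V ε) ⟩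
          (M * V) * (M * V) * (1ℚ + (ε + ε))
            ≤⟨ *-monoˡ ((M * V) * (M * V)) (0≤square (M * V)) hθ ⟩
          (M * V) * (M * V) * ((1ℚ + δ) * ((g * v ^ D) * (g * v ^ D)))
            ≡⟨ solve 5 (λ m v d g p → (m :* v) :* (m :* v) :* ((con 1ℚ :+ d) :* ((g :* p) :* (g :* p)))
                 := (con 1ℚ :+ d) :* ((m :* (g :* (v :* p))) :* (m :* (g :* (v :* p))))) refl M V δ g (v ^ D) ⟩
          (1ℚ + δ) * (c * c) ∎

-- Covering a graph that has a good tuple

tabulateᵀ : ∀ {A : Set} {n} → (Fin n → Fin n → A) → Triangle A n
tabulateᵀ {n = zero}  f = []
tabulateᵀ {n = suc n} f = tabulateᵀ (λ i j → f (suc i) (suc j)) ▹ tabulate (λ j → f zero (suc j))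

entry-tabulateᵀ : ∀ {A : Set} {n} (f : Fin n → Fin n → A) → (∀ i j → f i j ≡ f j i) →
  ∀ i j → i ≢ j → entry (tabulateᵀ f) i j ≡ just (f i j)
entry-tabulateᵀ f f-sym zero    zero    i≢j = contradiction refl i≢j
entry-tabulateᵀ f f-sym zero    (suc j) i≢j = cong just (Vec.lookup∘tabulate (λ j → f zero (suc j)) j)
entry-tabulateᵀ f f-sym (suc i) zero    i≢j =
  cong just (trans (Vec.lookup∘tabulate (λ j → f zero (suc j)) i) (f-sym zero (suc i)))
entry-tabulateᵀ f f-sym (suc i) (suc j) i≢j =
  entry-tabulateᵀ (λ i j → f (suc i) (suc j)) (λ i j → f-sym (suc i) (suc j)) i j (i≢j ∘ cong suc)

-- Numbers the true positions of `v` from 0. For the neighbourhood of an outer vertex in the tuple,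
-- this numbering supplies the distinct colours.
rank : ∀ {k} → Vec Bool k → Fin k → ℕ
rank (b     ∷ v) zero    = 0
rank (true  ∷ v) (suc i) = suc (rank v i)
rank (false ∷ v) (suc i) = rank v i

rank<ones : ∀ {k} (v : Vec Bool k) i → lookup v i ≡ true → rank v i Nat.< ones v
rank<ones (true  ∷ v) zero    e = Nat.s≤s Nat.z≤n
rank<ones (true  ∷ v) (suc i) e = Nat.s≤s (rank<ones v i e)
rank<ones (false ∷ v) (suc i) e = rank<ones v i e

rank-inj : ∀ {k} (v : Vec Bool k) i j → lookup v i ≡ true → lookup v j ≡ true → rank v i ≡ rank v j → i ≡ j
rank-inj (true  ∷ v) zero    zero    _ _ _ = refl
rank-inj (true  ∷ v) zero    (suc j) _ _ ()
rank-inj (true  ∷ v) (suc i) zero    _ _ ()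
rank-inj (true  ∷ v) (suc i) (suc j) p q e = cong suc (rank-inj v i j p q (ℕ.suc-injective e))
rank-inj (false ∷ v) (suc i) (suc j) p q e = cong suc (rank-inj v i j p q e)

Π-𝟙 : ∀ {A : Set} (xs : List A) (β : A → Bool) → Π[ xs ] (λ x → 𝟙 (β x)) ≡ 0ℚ ⊎ (∀ {x} → x ∈ₗ xs → β x ≡ true)
Π-𝟙 []       β = inj₂ λ ()
Π-𝟙 (x ∷ xs) β with β x in e | Π-𝟙 xs β
... | false | _      = inj₁ (*-zeroˡ (Π[ xs ] (λ x → 𝟙 (β x))))
... | true  | inj₁ p = inj₁ (trans (*-identityˡ (Π[ xs ] (λ x → 𝟙 (β x)))) p)
... | true  | inj₂ p = inj₂ λ { (here refl) → e ; (there q) → p q }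

-- Makes every natural number a colour, so that the colouring can be written down without bounds;
-- `clamp-inj` shows that values up to r stay distinct.
clamp : (r k : ℕ) → Fin (suc r)
clamp r k = Fin.fromℕ< (Nat.s≤s (ℕ.m⊓n≤n k r))

clamp-inj : ∀ {r k l} → k ≤ r → l ≤ r → clamp r k ≡ clamp r l → k ≡ l
clamp-inj {r} {k} {l} k≤r l≤r e = begin
    k                    ≡⟨ sym (ℕ.m≤n⇒m⊓n≡m k≤r) ⟩
    k Nat.⊓ r            ≡⟨ sym (Fin.toℕ-fromℕ< (Nat.s≤s (ℕ.m⊓n≤n k r))) ⟩
    Fin.toℕ (clamp r k)  ≡⟨ cong Fin.toℕ e ⟩
    Fin.toℕ (clamp r l)  ≡⟨ Fin.toℕ-fromℕ< (Nat.s≤s (ℕ.m⊓n≤n l r)) ⟩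
    l Nat.⊓ r            ≡⟨ ℕ.m≤n⇒m⊓n≡m l≤r ⟩
    l ∎
  where open ≡-Reasoning

-- Here r is one less than the number of colours: an outer vertex has at most r neighbours in the
-- tuple, their edges use the colours below r, and r itself is the remaining colour.
module Covering {n t m : ℕ} (r : ℕ) (x : Fin t → Fin m → Fin n)
  (x-inj : ∀ {i j k l} → x i k ≡ x j l → i ≡ j × k ≡ l)
  (z : Fin n) (x≢z : ∀ i k → x i k ≢ z) where

  open Configuration (suc r) x x-inj z x≢z

  IsGood : Vec (Fin m) t → Graph n → Set
  IsGood a G = (∀ {u w} → u ∈ₗ reserved a → w ∈ₗ reserved a → edge G u w ≡ false)
    × (∀ y → mem (reserved a) y ≡ false → ones (neighbours a G y) ≤ r)

  good-cases : ∀ a G → good a G ≡ 0ℚ ⊎ IsGood a G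
  good-cases a G with Π-𝟙 (pairs a) (λ p → not (edge G (proj₁ p) (proj₂ p)))
  ... | inj₁ e = inj₁ (trans (cong (_* rest) e) (*-zeroˡ rest))
    where rest = Π[ allFin n ] (λ y → outside (reserved a) (fewAt a y G) y)
  ... | inj₂ p with Π-𝟙 (allFin n) (λ y → mem (reserved a) y ∨ few (suc r) (neighbours a G y))
  ...   | inj₁ e = inj₁ (trans (cong (independent a G *_) (trans (Π-cong (allFin n) boolean) e)) (*-zeroʳ (independent a G)))
    where
    boolean : ∀ y → outside (reserved a) (fewAt a y G) y ≡ 𝟙 (mem (reserved a) y ∨ few (suc r) (neighbours a G y))
    boolean y with mem (reserved a) y
    ... | true  = refl
    ... | false = refl
  ...   | inj₂ f = inj₂ ((λ u∈ w∈ → Bool.not-injective (p (∈-cartesianProduct⁺ u∈ w∈)))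
    , λ y y∉ → ℕ.≤-pred (ℕ.<ᵇ⇒< _ _ (subst Bool.T (sym (trans (sym (cong (_∨ few (suc r) (neighbours a G y)) y∉))
      (f (∈-allFin y)))) _)))

  module _ (a : Vec (Fin m) t) (G : Graph n) (isolated : ∀ {u w} → u ∈ₗ reserved a → w ∈ₗ reserved a → edge G u w ≡ false)
    (sparse : ∀ y → mem (reserved a) y ≡ false → ones (neighbours a G y) ≤ r) where

    Index : Fin n → Set
    Index u = ∃[ i ] vertex a i ≡ u

    index? : ∀ u → Dec (Index u)
    index? u = Fin.any? (λ i → vertex a i Fin.≟ u)

    -- The edges from a vertex outside the tuple to the tuple get distinct colours below r.
    colour : ∀ {u w} → Dec (Index u) → Dec (Index w) → ℕ
    colour {u} {w} (yes (i , _)) (no _)        = rank (neighbours a G w) i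
    colour {u} {w} (no _)        (yes (i , _)) = rank (neighbours a G u) i
    colour         (yes _)       (yes _)       = r
    colour         (no _)        (no _)        = r

    colour-sym : ∀ {u w} (du : Dec (Index u)) (dw : Dec (Index w)) → colour du dw ≡ colour dw du
    colour-sym (yes _) (yes _) = refl
    colour-sym (yes _) (no _)  = refl
    colour-sym (no _)  (yes _) = refl
    colour-sym (no _)  (no _)  = refl

    χ : Coloring (suc r) n
    χ = tabulateᵀ (λ u w → clamp r (colour (index? u) (index? w)))

    χ-entry : ∀ {u w} → edge G u w ≡ true → entry χ u w ≡ just (clamp r (colour (index? u) (index? w)))
    χ-entry {u} {w} e = entry-tabulateᵀ (λ u w → clamp r (colour (index? u) (index? w)))
      (λ u w → cong (clamp r) (colour-sym (index? u) (index? w))) u w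
      λ { refl → case trans (sym e) (edge-irrefl G u) of λ () }

    selected⊆ : ∀ {u} → Index u → u ∈ₗ reserved a
    selected⊆ (i , refl) = there (∈-tabulate⁺ i)

    outside-mem : ∀ {u y} → u ∈ₗ reserved a → edge G u y ≡ true → mem (reserved a) y ≡ false
    outside-mem {u} {y} u∈ e with mem (reserved a) y in e′
    ... | false = refl
    ... | true  = case trans (sym e) (isolated u∈ (mem⁻ (reserved a) e′)) of λ ()

    neighbour : ∀ {y} i → edge G y (vertex a i) ≡ true → lookup (neighbours a G y) i ≡ true
    neighbour {y} i e = trans (Vec.lookup∘tabulate (λ i → edge G y (vertex a i)) i) e

    rank<r : ∀ {y} i → mem (reserved a) y ≡ false → edge G y (vertex a i) ≡ true → rank (neighbours a G y) i Nat.< r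
    rank<r {y} i y∉ e = ℕ.<-≤-trans (rank<ones (neighbours a G y) i (neighbour i e)) (sparse y y∉)

    colour-from : ∀ i {y} (di : Dec (Index (vertex a i))) (dy : Dec (Index y)) → mem (reserved a) y ≡ false →
      colour di dy ≡ rank (neighbours a G y) i
    colour-from i di      (yes y∈) y∉ = contradiction refl (mem-false {L = reserved a} y∉ (selected⊆ y∈))
    colour-from i (no ¬i) (no _)   y∉ = contradiction (i , refl) ¬i
    colour-from i {y} (yes (j , e)) (no _) y∉ = cong (rank (neighbours a G y)) (vertex-inj a e)

    -- If w were not in the tuple, the edge yw would have colour r, but ranks stay below r. So w is
    -- in the tuple, and `rank` is injective on the neighbours of y.
    colour-back : ∀ i {y w} (dy : Dec (Index y)) (dw : Dec (Index w)) → mem (reserved a) y ≡ false →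
      edge G y (vertex a i) ≡ true → edge G y w ≡ true →
      rank (neighbours a G y) i ≡ colour dy dw → w ≡ vertex a i
    colour-back i (yes y∈) dw y∉ _ _ _ = contradiction refl (mem-false {L = reserved a} y∉ (selected⊆ y∈))
    colour-back i (no _) (no _) y∉ yi yw e = contradiction (rank<r i y∉ yi) (ℕ.<-irrefl e)
    colour-back i {y} (no _) (yes (j , refl)) y∉ yi yw e =
      cong (vertex a) (sym (rank-inj (neighbours a G y) i j (neighbour i yi) (neighbour j yw) e))

    colour≤r : ∀ {y w} (dy : Dec (Index y)) (dw : Dec (Index w)) → mem (reserved a) y ≡ false →
      edge G y w ≡ true → colour dy dw ≤ r
    colour≤r (yes y∈) dw y∉ _ = contradiction refl (mem-false {L = reserved a} y∉ (selected⊆ y∈))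
    colour≤r (no _) (no _) y∉ _ = ℕ.≤-refl
    colour≤r (no _) (yes (j , refl)) y∉ e = ℕ.<⇒≤ (rank<r j y∉ e)

    module _ (H : Subgraph n) (piece : IsPiece G χ H) where

      E⇒edge : ∀ {u w} → Adj (edges H) u w → edge G u w ≡ true
      E⇒edge {u} {w} e = Adj⇒edge G u w (proj₁ (proj₁ piece u w e))

      -- The invariant of a walk in the piece that starts at `vertex a i`: it is either there or at
      -- an adjacent vertex outside the reserved set. No other reserved vertex satisfies it.
      Near : Fin t → Fin n → Set
      Near i u = u ≡ vertex a i ⊎ (mem (reserved a) u ≡ false × Adj (edges H) (vertex a i) u)

      near-step : ∀ i {u w} → Near i u → Adj (edges H) u w → Near i w
      near-step i (inj₁ refl) e = inj₂ (outside-mem (there (∈-tabulate⁺ i)) (E⇒edge e) , e)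
      -- The next edge has the colour of the edge between u and `vertex a i`, hence leads back.
      near-step i {u} {w} (inj₂ (u∉ , e)) e′ = inj₁ (colour-back i (index? u) (index? w) u∉ ui (E⇒edge e′)
        (clamp-inj (ℕ.<⇒≤ (rank<r i u∉ ui)) (colour≤r (index? u) (index? w) u∉ (E⇒edge e′)) (Maybe.just-injective (begin
          just (clamp r (rank (neighbours a G u) i))
            ≡⟨ cong (just ∘ clamp r) (sym (colour-from i (index? (vertex a i)) (index? u) u∉)) ⟩
          just (clamp r (colour (index? (vertex a i)) (index? u))) ≡⟨ sym (χ-entry (E⇒edge e)) ⟩
          entry χ (vertex a i) u                                   ≡⟨ proj₂ (proj₂ piece) (vertex a i) u u w e e′ ⟩
          entry χ u w                                              ≡⟨ χ-entry (E⇒edge e′) ⟩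
          just (clamp r (colour (index? u) (index? w))) ∎))))
        where
        open ≡-Reasoning
        ui : edge G u (vertex a i) ≡ true
        ui = trans (edge-sym G u (vertex a i)) (E⇒edge e)

      near-star : ∀ i {u w} → Near i u → Star (Adj (edges H)) u w → Near i w
      near-star i p refl⋆    = p
      near-star i p (e ◅ es) = near-star i (near-step i p e) es

      from-selected : ∀ i {w} → vertex a i ∈ vertices H → w ∈ vertices H → w ∈ₗ reserved a → w ≡ vertex a i
      from-selected i {w} i∈ w∈ w∈r with near-star i (inj₁ refl) (proj₂ (proj₁ (proj₂ piece)) (vertex a i) w i∈ w∈)
      ... | inj₁ e        = e
      ... | inj₂ (w∉ , _) = contradiction refl (mem-false {L = reserved a} w∉ w∈r)

      -- Unless both vertices are z, one of them lies in the tuple, and walks are followed from that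
      -- one. Hence nothing has to be known about walks from z.
      one-reserved : ∀ {u w} → u ∈ₗ reserved a → w ∈ₗ reserved a → u ∈ vertices H → w ∈ vertices H → u ≡ w
      one-reserved (here refl) (here refl) _ _ = refl
      one-reserved (there u∈) w∈r u∈H w∈H with ∈-tabulate⁻ {f = vertex a} u∈
      ... | i , refl = sym (from-selected i u∈H w∈H w∈r)
      one-reserved u∈r (there w∈) u∈H w∈H with ∈-tabulate⁻ {f = vertex a} w∈
      ... | i , refl = from-selected i w∈H u∈H u∈r

    point : Fin (suc t) → Fin n
    point zero    = z
    point (suc i) = vertex a i

    point-inj : ∀ {i j} → point i ≡ point j → i ≡ j
    point-inj {zero}  {zero}  e = refl
    point-inj {zero}  {suc j} e = contradiction (sym e) (x≢z j (lookup a j))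
    point-inj {suc i} {zero}  e = contradiction e (x≢z i (lookup a i))
    point-inj {suc i} {suc j} e = cong suc (vertex-inj a e)

    point∈ : ∀ i → point i ∈ₗ reserved a
    point∈ zero    = here refl
    point∈ (suc i) = there (∈-tabulate⁺ i)

    ¬cover : ∀ {s} → s ≤ t → ¬ HasTreeCovers (suc r) G s
    ¬cover s≤t cover with cover χ
    ... | k , k<s , Hs , pieces , covers
      with Fin.pigeonhole (ℕ.<-≤-trans k<s (Nat.s≤s s≤t)) (λ i → VAny.index (covers (point i)))
    ...   | i , j , i<j , e = contradiction (cong Fin.toℕ (point-inj (one-reserved H (VAll.lookup⁺ pieces k₀)
      (point∈ i) (point∈ j) i∈ j∈))) (ℕ.<⇒≢ i<j)
      where
      k₀ = VAny.index (covers (point i))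
      H = lookup Hs k₀
      i∈ : point i ∈ vertices H
      i∈ = VAny.lookup-index (covers (point i))
      j∈ : point j ∈ vertices H
      j∈ = subst (λ k → point j ∈ vertices (lookup Hs k)) (sym e) (VAny.lookup-index (covers (point j)))

    tc>t : t Nat.< tc (suc r) G
    tc>t = ℕ.≰⇒> λ tc≤t → ¬cover tc≤t (proj₁ (tc-isLeast (suc r) G))

  goodCount-zero : ∀ G → ¬ (t Nat.< tc (suc r) G) → goodCount G ≡ 0ℚ
  goodCount-zero G ¬tc = trans (Σ-cong (tuples m t) zero-at) (trans (Σ-const (tuples m t) 0ℚ) (*-zeroʳ (ι (length (tuples m t)))))
    where
    zero-at : ∀ a → good a G ≡ 0ℚ
    zero-at a with good-cases a G
    ... | inj₁ e           = e
    ... | inj₂ (iso , spa) = contradiction (tc>t a G iso spa) ¬tc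

-- Estimates for (1 - x)ⁿ in terms of log n

-- Here a is the loss from independence of the reserved set and b that of one outer vertex.
-- Bernoulli gives v^D ≥ 1 - D b, the product with 1 - a is at least 1 - e, and squaring doubles the
-- loss.
near-one : ∀ {v a b} D → 0ℚ ≤ℚ a → 0ℚ ≤ℚ b → b ≤ℚ 1ℚ → a + ι D * b ≤ℚ 1ℚ → 1ℚ - b ≤ℚ v →
  1ℚ - ι 2 * (a + ι D * b) ≤ℚ ((1ℚ - a) * v ^ D) * ((1ℚ - a) * v ^ D)
near-one {v} {a} {b} D 0≤a 0≤b b≤1 e≤1 hv = begin
    1ℚ - ι 2 * e
      ≤⟨ ≤-by (e * e) (0≤square e) (solve 1 (λ e → (con 1ℚ :- e) :* (con 1ℚ :- e) :- (con 1ℚ :- con (ι 2) :* e)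
        := e :* e) refl e) ⟩
    (1ℚ - e) * (1ℚ - e) ≤⟨ *-mono 0≤1-e lower 0≤1-e lower ⟩
    ((1ℚ - a) * v ^ D) * ((1ℚ - a) * v ^ D) ∎
  where
  open ℚ.≤-Reasoning
  e = a + ι D * b
  0≤Db = 0≤* (0≤ι D) 0≤b
  0≤1-e = diff-nonneg e≤1
  0≤1-a : 0ℚ ≤ℚ 1ℚ - a
  0≤1-a = ≤-trans 0≤1-e (≤-by (ι D * b) 0≤Db
    (solve 2 (λ a y → (con 1ℚ :- a) :- (con 1ℚ :- (a :+ y)) := y) refl a (ι D * b)))
  lower : 1ℚ - e ≤ℚ (1ℚ - a) * v ^ D
  lower = begin
    1ℚ - e
      ≤⟨ ≤-by (a * (ι D * b)) (0≤* 0≤a 0≤Db)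
           (solve 2 (λ a y → (con 1ℚ :- a) :* (con 1ℚ :- y) :- (con 1ℚ :- (a :+ y)) := a :* y) refl a (ι D * b)) ⟩
    (1ℚ - a) * (1ℚ - ι D * b)
      ≤⟨ *-monoˡ (1ℚ - a) 0≤1-a (begin
           1ℚ - ι D * b        ≡⟨ solve 2 (λ d b → con 1ℚ :- d :* b := con 1ℚ :+ d :* (:- b)) refl (ι D) b ⟩
           1ℚ + ι D * (- b)    ≤⟨ bernoulli D (neg-antimono-≤ b≤1) ⟩
           (1ℚ - b) ^ D        ≤⟨ ^-mono D (diff-nonneg b≤1) hv ⟩
           v ^ D ∎) ⟩
    (1ℚ - a) * v ^ D ∎

module Scale (i k : ℕ) where
  open ℚ.≤-Reasoning

  n L u : ℚ
  n = ι (suc i)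
  L = logApprox i k
  u = recip i

  0<n : 0ℚ <ℚ n
  0<n = 0<ι i
  0≤L : 0ℚ ≤ℚ L
  0≤L = 0≤log i k
  0≤u : 0ℚ ≤ℚ u
  0≤u = 0≤recip i

  nu : ∀ x → n * (x * u) ≡ x
  nu x = trans (solve 3 (λ n x u → n :* (x :* u) := (n :* u) :* x) refl n x u)
    (trans (cong (_* x) (recip-cancel i)) (*-identityˡ x))

  ≤-scaled : ∀ {x y} → n * x ≤ℚ y → x ≤ℚ y * u
  ≤-scaled {x} {y} h = *-cancelˡ n 0<n (≤-trans h (≤-reflexive (sym (nu y))))

  module EL = ExpLog (suc i) u 0≤u (recip-cancel i)

  growth : (1ℚ + L * u) ^ suc i ≤ℚ ι 4 * n
  growth = EL.exp-log i k

  -- Bernoulli gives 1 + rL/n ≤ (1 + L/n)^r; then the exponents r and n are exchanged.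
  growth-^ : ∀ r → (1ℚ + (ι r * L) * u) ^ suc i ≤ℚ (ι 4 * n) ^ r
  growth-^ r = begin
    (1ℚ + (ι r * L) * u) ^ suc i
      ≤⟨ ^-mono (suc i) (0≤+ 0≤1 (0≤* (0≤* (0≤ι r) 0≤L) 0≤u)) (begin
           1ℚ + (ι r * L) * u   ≡⟨ cong (1ℚ +_) (*-assoc (ι r) L u) ⟩
           1ℚ + ι r * (L * u)   ≤⟨ bernoulli r (≤-trans (ℚ.nonPositive⁻¹ (- 1ℚ)) (0≤* 0≤L 0≤u)) ⟩
           (1ℚ + L * u) ^ r ∎) ⟩
    ((1ℚ + L * u) ^ r) ^ suc i   ≡⟨ Exp.^-assocʳ (1ℚ + L * u) r (suc i) ⟩
    (1ℚ + L * u) ^ (r Nat.* suc i) ≡⟨ cong ((1ℚ + L * u) ^_) (ℕ.*-comm r (suc i)) ⟩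
    (1ℚ + L * u) ^ (suc i Nat.* r) ≡⟨ sym (Exp.^-assocʳ (1ℚ + L * u) (suc i) r) ⟩
    ((1ℚ + L * u) ^ suc i) ^ r   ≤⟨ ^-mono r (0≤^ (suc i) (0≤+ 0≤1 (0≤* 0≤L 0≤u))) growth ⟩
    (ι 4 * n) ^ r ∎

  q-small : ∀ r {q η} → 0ℚ ≤ℚ η → n * q ^ suc r ≤ℚ ι (suc r) * L →
    ι (suc r) * L ≤ℚ η ^ suc r * n → q ≤ℚ η
  q-small r {q} {η} 0≤η h₁ h₂ = ^-cancel r 0≤η (*-cancelˡ n 0<n
    (≤-trans h₁ (≤-trans h₂ (≤-reflexive (*-comm (η ^ suc r) n)))))

  -- By Bernoulli's inequality, the slack 4M in the exponent yields the factor 1 + M.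
  sharp-lower : ∀ r {s M} → 0ℚ ≤ℚ s → ι 2 * s ≤ℚ 1ℚ → 1ℚ ≤ℚ M → n * s + ι 4 * M ≤ℚ ι r * L →
    (ι r * L) * (ι r * L) ≤ℚ n → 1ℚ + M ≤ℚ (ι 4 * n) ^ r * (1ℚ - s) ^ suc i
  sharp-lower r {s} {M} 0≤s 2s≤1 1≤M h hL = begin
    1ℚ + M                        ≡⟨ cong (1ℚ +_) (sym (nu M)) ⟩
    1ℚ + n * (M * u)              ≤⟨ bernoulli (suc i) (≤-trans (ℚ.nonPositive⁻¹ (- 1ℚ)) 0≤Mu) ⟩
    (1ℚ + M * u) ^ suc i          ≤⟨ ^-mono (suc i) (0≤+ 0≤1 0≤Mu) base ⟩
    ((1ℚ + R * u) * (1ℚ - s)) ^ suc i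
                                  ≡⟨ Exp.^-distrib-* (1ℚ + R * u) (1ℚ - s) (suc i) ⟩
    (1ℚ + R * u) ^ suc i * (1ℚ - s) ^ suc i
                                  ≤⟨ *-monoʳ ((1ℚ - s) ^ suc i) (0≤^ (suc i) 0≤1-s) (growth-^ r) ⟩
    (ι 4 * n) ^ r * (1ℚ - s) ^ suc i ∎
    where
    R = ι r * L
    0≤M = ≤-trans 0≤1 1≤M
    0≤Mu = 0≤* 0≤M 0≤u
    s≤1 : s ≤ℚ 1ℚ
    s≤1 = ≤-trans (≤-by s 0≤s (solve 1 (λ s → con (ι 2) :* s :- s := s) refl s)) 2s≤1
    0≤1-s = diff-nonneg s≤1
    0≤ns = 0≤* (<⇒≤ 0<n) 0≤s
    ns≤R : n * s ≤ℚ R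
    ns≤R = ≤-trans (≤-by (ι 4 * M) (0≤* (0≤ι 4) 0≤M)
      (solve 2 (λ x y → (x :+ y) :- x := y) refl (n * s) (ι 4 * M))) h
    n*s²≤1 : n * (s * s) ≤ℚ 1ℚ
    n*s²≤1 = *-cancelˡ n 0<n (begin
      n * (n * (s * s))  ≡⟨ solve 2 (λ n s → n :* (n :* (s :* s)) := (n :* s) :* (n :* s)) refl n s ⟩
      (n * s) * (n * s)  ≤⟨ *-mono 0≤ns ns≤R 0≤ns ns≤R ⟩
      R * R              ≤⟨ hL ⟩
      n                  ≡⟨ sym (*-identityʳ n) ⟩
      n * 1ℚ ∎)
    s²≤Mu : s * s ≤ℚ M * u
    s²≤Mu = ≤-scaled (≤-trans n*s²≤1 1≤M)
    s+4Mu≤ : s + ι 4 * (M * u) ≤ℚ R * u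
    s+4Mu≤ = ≤-scaled (begin
      n * (s + ι 4 * (M * u))      ≡⟨ solve 4 (λ n s M u → n :* (s :+ con (ι 4) :* (M :* u)) := n :* s :+ con
        (ι 4) :* (n :* (M :* u))) refl n s M u ⟩
      n * s + ι 4 * (n * (M * u))  ≡⟨ cong (λ e → n * s + ι 4 * e) (nu M) ⟩
      n * s + ι 4 * M              ≤⟨ h ⟩
      R ∎)
    -- This accounts for the 4: since 1 - s ≥ 1/2, the term 4Mu keeps at least 2Mu, of which one Mu
    -- pays for the s² lost in (1 + s)(1 - s).
    base : 1ℚ + M * u ≤ℚ (1ℚ + R * u) * (1ℚ - s)
    base = begin
      1ℚ + M * u
        ≤⟨ ≤-by ((M * u - s * s) + (ι 2 * (M * u)) * (1ℚ - ι 2 * s))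
             (0≤+ (diff-nonneg s²≤Mu) (0≤* (0≤* (0≤ι 2) 0≤Mu) (diff-nonneg 2s≤1)))
             (solve 2 (λ x s → (con 1ℚ :+ (s :+ con (ι 4) :* x)) :* (con 1ℚ :- s) :- (con 1ℚ :+ x)
                := (x :- s :* s) :+ (con (ι 2) :* x) :* (con 1ℚ :- con (ι 2) :* s)) refl (M * u) s) ⟩
      (1ℚ + (s + ι 4 * (M * u))) * (1ℚ - s) ≤⟨ *-monoʳ (1ℚ - s) 0≤1-s (+-monoʳ-≤ 1ℚ s+4Mu≤) ⟩
      (1ℚ + R * u) * (1ℚ - s) ∎

  -- With y = L/n ≤ 1, (1 + y)(1 - x)² ≥ 1: the loss 2x(1 + y) ≤ 4x is at most half of the gain y,
  -- by 8x ≤ y. The n-th power of 1 + y is at most 4n.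
  weak-lower : ∀ {x v} → 0ℚ ≤ℚ x → ι 8 * (n * x) ≤ℚ L → L ≤ℚ n → 1ℚ - x ≤ℚ v →
    1ℚ ≤ℚ (ι 4 * n) * (v ^ suc i * v ^ suc i)
  weak-lower {x} {v} 0≤x h L≤n hv = begin
    1ℚ                                     ≤⟨ 1≤^ (suc i) base ⟩
    ((1ℚ + y) * (v * v)) ^ suc i           ≡⟨ Exp.^-distrib-* (1ℚ + y) (v * v) (suc i) ⟩
    (1ℚ + y) ^ suc i * (v * v) ^ suc i     ≡⟨ cong ((1ℚ + y) ^ suc i *_) (Exp.^-distrib-* v v (suc i)) ⟩
    (1ℚ + y) ^ suc i * (v ^ suc i * v ^ suc i)
      ≤⟨ *-monoʳ (v ^ suc i * v ^ suc i) (0≤square (v ^ suc i)) growth ⟩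
    (ι 4 * n) * (v ^ suc i * v ^ suc i) ∎
    where
    y = L * u
    0≤y = 0≤* 0≤L 0≤u
    y≤1 : y ≤ℚ 1ℚ
    y≤1 = *-cancelˡ n 0<n (≤-trans (≤-reflexive (nu L)) (≤-trans L≤n (≤-reflexive (sym (*-identityʳ n)))))
    8x≤y : ι 8 * x ≤ℚ y
    8x≤y = ≤-scaled (≤-trans (≤-reflexive (solve 2 (λ n x → n :* (con (ι 8) :* x) := con (ι 8) :* (n :* x)) refl n x)) h)
    x≤1 : x ≤ℚ 1ℚ
    x≤1 = ≤-trans (≤-by (ι 7 * x) (0≤* (0≤ι 7) 0≤x) (solve 1 (λ x → con (ι 8) :* x :- x := con (ι 7) :* x) refl x))
      (≤-trans 8x≤y y≤1)
    0≤1-x = diff-nonneg x≤1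
    0≤¼ : 0ℚ ≤ℚ ℚ.½ * ℚ.½
    0≤¼ = nonNegative⁻¹ (ℚ.½ * ℚ.½)
    base : 1ℚ ≤ℚ (1ℚ + y) * (v * v)
    base = begin
      1ℚ
        ≤⟨ ≤-by (((1ℚ + y) * (ℚ.½ * ℚ.½)) * (y - ι 8 * x) + ((ℚ.½ * ℚ.½) * y) * (1ℚ - y) + ℚ.½ * y + (1ℚ + y) * (x * x))
             (0≤+ (0≤+ (0≤+ (0≤* (0≤* (0≤+ 0≤1 0≤y) 0≤¼) (diff-nonneg 8x≤y)) (0≤* (0≤* 0≤¼ 0≤y) (diff-nonneg y≤1)))
                (0≤* (nonNegative⁻¹ ℚ.½) 0≤y)) (0≤* (0≤+ 0≤1 0≤y) (0≤square x)))
             (solve 2 (λ x y → (con 1ℚ :+ y) :* ((con 1ℚ :- x) :* (con 1ℚ :- x)) :- con 1ℚ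
               := ((con 1ℚ :+ y) :* con (ℚ.½ * ℚ.½)) :* (y :- con (ι 8) :* x) :+ (con (ℚ.½ * ℚ.½) :* y) :*
                 (con 1ℚ :- y) :+ con ℚ.½ :* y :+ (con 1ℚ :+ y) :* (x :* x)) refl x y) ⟩
      (1ℚ + y) * ((1ℚ - x) * (1ℚ - x)) ≤⟨ *-monoˡ (1ℚ + y) (0≤+ 0≤1 0≤y) (*-mono 0≤1-x hv 0≤1-x hv) ⟩
      (1ℚ + y) * (v * v) ∎

  -- Intersecting pairs cost at most a factor 2 over independence. For 4s ≤ 1, 1 - 2s + p ≤ (1 -
  -- s)²(1 + 2p), and (1 + 2p)^n ≤ 1/(1 - 2np) ≤ 2. In the application s = q^r and p = q^(r+1).
  pair-upper : ∀ {s p N} → N ≤ suc i → 0ℚ ≤ℚ s → ι 4 * s ≤ℚ 1ℚ → 0ℚ ≤ℚ p → ι 4 * (n * p) ≤ℚ 1ℚ →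
    0ℚ ≤ℚ (1ℚ - s) - s + p → ((1ℚ - s) - s + p) ^ N ≤ℚ ι 2 * ((1ℚ - s) ^ N * (1ℚ - s) ^ N)
  pair-upper {s} {p} {N} N≤n 0≤s 4s≤1 0≤p 4np≤1 0≤w = begin
    ((1ℚ - s) - s + p) ^ N
      ≤⟨ ^-mono N 0≤w (≤-by (((s * s) + (ι 2 * p) * (s * s)) + p * (1ℚ - ι 4 * s))
           (0≤+ (0≤+ (0≤square s) (0≤* (0≤* (0≤ι 2) 0≤p) (0≤square s))) (0≤* 0≤p (diff-nonneg 4s≤1)))
           (solve 2 (λ s p → ((con 1ℚ :- s) :* (con 1ℚ :- s)) :* (con 1ℚ :+ con (ι 2) :* p) :- ((con 1ℚ :- s) :- s :+ p)
              := (s :* s :+ (con (ι 2) :* p) :* (s :* s)) :+ p :* (con 1ℚ :- con (ι 4) :* s)) refl s p)) ⟩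
    (((1ℚ - s) * (1ℚ - s)) * (1ℚ + ι 2 * p)) ^ N
      ≡⟨ Exp.^-distrib-* ((1ℚ - s) * (1ℚ - s)) (1ℚ + ι 2 * p) N ⟩
    ((1ℚ - s) * (1ℚ - s)) ^ N * (1ℚ + ι 2 * p) ^ N
      ≡⟨ cong (_* (1ℚ + ι 2 * p) ^ N) (Exp.^-distrib-* (1ℚ - s) (1ℚ - s) N) ⟩
    ((1ℚ - s) ^ N * (1ℚ - s) ^ N) * (1ℚ + ι 2 * p) ^ N
      ≤⟨ *-monoˡ _ (0≤square ((1ℚ - s) ^ N)) (≤-trans grow two) ⟩
    ((1ℚ - s) ^ N * (1ℚ - s) ^ N) * ι 2 ≡⟨ *-comm ((1ℚ - s) ^ N * (1ℚ - s) ^ N) (ι 2) ⟩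
    ι 2 * ((1ℚ - s) ^ N * (1ℚ - s) ^ N) ∎
    where
    0≤2p = 0≤* (0≤ι 2) 0≤p
    P = (1ℚ + ι 2 * p) ^ suc i
    grow : (1ℚ + ι 2 * p) ^ N ≤ℚ P
    grow = begin
      (1ℚ + ι 2 * p) ^ N        ≡⟨ sym (*-identityʳ _) ⟩
      (1ℚ + ι 2 * p) ^ N * 1ℚ
        ≤⟨ *-monoˡ _ (0≤^ N (0≤+ 0≤1 0≤2p)) (1≤^ (suc i Nat.∸ N) (≤-by (ι 2 * p) 0≤2p (solve 1 (λ p →
          (con 1ℚ :+ p) :- con 1ℚ := p) refl (ι 2 * p)))) ⟩
      (1ℚ + ι 2 * p) ^ N * (1ℚ + ι 2 * p) ^ (suc i Nat.∸ N) ≡⟨ sym (Exp.^-homo-* (1ℚ + ι 2 * p) N (suc i Nat.∸ N)) ⟩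
      (1ℚ + ι 2 * p) ^ (N Nat.+ (suc i Nat.∸ N)) ≡⟨ cong ((1ℚ + ι 2 * p) ^_) (ℕ.m+[n∸m]≡n N≤n) ⟩
      P ∎
    two : P ≤ℚ ι 2
    two = ≤-by (ι 2 * (1ℚ - P * (1ℚ - n * (ι 2 * p))) + P * (1ℚ - ι 4 * (n * p)))
      (0≤+ (0≤* (0≤ι 2) (diff-nonneg ([1+a]^n*[1-na]≤1 (suc i) 0≤2p)))
           (0≤* (0≤^ (suc i) (0≤+ 0≤1 0≤2p)) (diff-nonneg 4np≤1)))
      (solve 3 (λ P n p → con (ι 2) :- P := con (ι 2) :* (con 1ℚ :- P :* (con 1ℚ :- n :* (con (ι 2) :* p))) :+ P :*
        (con 1ℚ :- con (ι 4) :* (n :* p))) refl P n p)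

-- Conditions valid for all large n, and the sizes of the parts

Eventually : (ℕ → Set) → Set
Eventually P = ∃[ N ] (∀ i → N ≤ suc i → P i)

both : ∀ {P Q} → Eventually P → Eventually Q → Eventually (λ i → P i × Q i)
both (M , h) (N , k) = M Nat.⊔ N , λ i N≤ → h i (ℕ.m⊔n≤o⇒m≤o M N N≤) , k i (ℕ.m⊔n≤o⇒n≤o M N N≤)

polylog-scaled : ∀ j c δ → 0ℚ ≤ℚ c → 0ℚ <ℚ δ →
  Eventually (λ i → ∀ k → c * logApprox i k ^ suc j ≤ℚ δ * ι (suc i))
polylog-scaled j c δ 0≤c 0<δ =
  -- Dividing by 1 + c rather than c also covers c = 0.
  let η , η⁺ , eq = scale (1ℚ + c) δ (ℚ.pos+nonNeg⇒pos 1ℚ c {{ℚ.nonNegative 0≤c}}) (ℚ.positive 0<δ)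
      N , h = polylog j η (positive⁻¹ η {{η⁺}})
  in N , λ i N≤ k → begin
    c * logApprox i k ^ suc j
      ≤⟨ *-monoʳ (logApprox i k ^ suc j) (0≤^ (suc j) (0≤log i k)) (x≤1+x c) ⟩
    (1ℚ + c) * logApprox i k ^ suc j   ≤⟨ *-monoˡ (1ℚ + c) (0≤+ 0≤1 0≤c) (h i k N≤) ⟩
    (1ℚ + c) * (η * ι (suc i))         ≡⟨ sym (*-assoc (1ℚ + c) η (ι (suc i))) ⟩
    ((1ℚ + c) * η) * ι (suc i)         ≡⟨ cong (_* ι (suc i)) eq ⟩
    δ * ι (suc i) ∎
  where open ℚ.≤-Reasoning

log-small : ∀ r η → 0ℚ <ℚ η →
  Eventually (λ i → ∀ k → ι (suc r) * logApprox i k ≤ℚ η ^ suc r * ι (suc i))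
log-small r η 0<η =
  let N , h = polylog-scaled 0 (ι (suc r)) (η ^ suc r) (0≤ι (suc r)) (0<^ (suc r) 0<η)
  in N , λ i N≤ k → ≤-trans
    (≤-reflexive (cong (ι (suc r) *_) (sym (*-identityʳ (logApprox i k))))) (h i N≤ k)

part-large : ∀ t′ B → Eventually (λ i → 0 Nat.< i ℕ./ suc t′ × B ≤ℚ ι (i ℕ./ suc t′))
part-large t′ B =
  let K , B≤K = archimedean B
  in suc (suc K Nat.* suc t′) , λ i N≤ →
    ℕ.≤-<-trans Nat.z≤n (part> K i N≤) , ≤-trans B≤K (ι-mono (ℕ.<⇒≤ (part> K i N≤)))
  where
  part> : ∀ K i → suc (suc K Nat.* suc t′) ≤ suc i → K Nat.< i ℕ./ suc t′
  part> K i N≤ = subst (_≤ i ℕ./ suc t′) (ℕ.m*n/n≡m (suc K) (suc t′)) (ℕ./-monoˡ-≤ (suc t′) (ℕ.≤-pred N≤))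

-- Division with remainder gives i + 1 ≤ t + tm, and t ≤ tm since m ≥ 1.
n≤2tm : ∀ t′ i → 0 Nat.< i ℕ./ suc t′ → ι (suc i) ≤ℚ (ι 2 * ι (suc t′)) * ι (i ℕ./ suc t′)
n≤2tm t′ i 0<m = begin
    ι (suc i)                         ≤⟨ ι-mono bound ⟩
    ι ((2 Nat.* t) Nat.* m)           ≡⟨ trans (ι-* (2 Nat.* t) m) (cong (_* ι m) (ι-* 2 t)) ⟩
    (ι 2 * ι t) * ι m ∎
  where
  open ℚ.≤-Reasoning
  t = suc t′
  m = i ℕ./ t
  bound : suc i ≤ (2 Nat.* t) Nat.* m
  bound = ℕ.≤-trans (subst (λ e → suc e ≤ t Nat.+ m Nat.* t) (sym (ℕ.m≡m%n+[m/n]*n i t)) (ℕ.+-monoˡ-≤ (m Nat.* t) (ℕ.m%n<n i t)))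
    (ℕ.≤-trans (ℕ.+-monoˡ-≤ (m Nat.* t) (subst (t ≤_) (ℕ.*-comm t m) (ℕ.m≤m*n t m {{Nat.>-nonZero 0<m}})))
      (ℕ.≤-reflexive (trans (cong (m Nat.* t Nat.+_) (sym (ℕ.+-identityʳ (m Nat.* t))))
        (trans (cong (2 Nat.*_) (ℕ.*-comm m t)) (sym (ℕ.*-assoc 2 t m))))))

-- Supplies the hypotheses of `no-good-improbable` with δ = 4ε. The factor 4 comes from (1 + 4ε)(1 -
-- ε) = 1 + 2ε + ε(1 - 4ε).
gap-estimate : ∀ {ε a b v} D → 0ℚ <ℚ ε → ι 4 * ε ≤ℚ 1ℚ → 0ℚ ≤ℚ a → 0ℚ ≤ℚ b → 1ℚ ≤ℚ ι D →
  ι 2 * (a + ι D * b) ≤ℚ ε → 1ℚ - b ≤ℚ v →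
  0ℚ <ℚ 1ℚ - a × 0ℚ <ℚ v × 1ℚ + (ε + ε) ≤ℚ (1ℚ + ι 4 * ε) * (((1ℚ - a) * v ^ D) * ((1ℚ - a) * v ^ D))
gap-estimate {ε} {a} {b} {v} D 0<ε 4ε≤1 0≤a 0≤b 1≤D hl hv =
    below 0≤a a≤l , ℚ.<-≤-trans (below 0≤b b≤l) hv , (begin
      1ℚ + (ε + ε)
        ≤⟨ ≤-by (ε * (1ℚ - ι 4 * ε)) (0≤* 0≤ε (diff-nonneg 4ε≤1))
             (solve 1 (λ e → (con 1ℚ :+ con (ι 4) :* e) :* (con 1ℚ :- e) :- (con 1ℚ :+ (e :+ e)) := e :*
               (con 1ℚ :- con (ι 4) :* e)) refl ε) ⟩
      (1ℚ + ι 4 * ε) * (1ℚ - ε)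
        ≤⟨ *-monoˡ (1ℚ + ι 4 * ε) 0≤1+4ε (+-monoʳ-≤ 1ℚ (neg-antimono-≤ hl)) ⟩
      (1ℚ + ι 4 * ε) * (1ℚ - ι 2 * (a + ι D * b))
        ≤⟨ *-monoˡ (1ℚ + ι 4 * ε) 0≤1+4ε (near-one D 0≤a 0≤b (≤-trans b≤l l≤1) l≤1 hv) ⟩
      (1ℚ + ι 4 * ε) * (((1ℚ - a) * v ^ D) * ((1ℚ - a) * v ^ D)) ∎)
  where
  open ℚ.≤-Reasoning
  0≤ε = <⇒≤ 0<ε
  0≤Db = 0≤* (0≤ι D) 0≤b
  0≤l = 0≤+ 0≤a 0≤Db
  0≤1+4ε = 0≤+ 0≤1 (0≤* (0≤ι 4) 0≤ε)
  ε≤1 : ε ≤ℚ 1ℚ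
  ε≤1 = ≤-trans (≤-by (ι 3 * ε) (0≤* (0≤ι 3) 0≤ε) (solve 1 (λ e → con (ι 4) :* e :- e := con (ι 3) :* e) refl ε)) 4ε≤1
  2l≤1 : ι 2 * (a + ι D * b) ≤ℚ 1ℚ
  2l≤1 = ≤-trans hl ε≤1
  half≤1 : ∀ {l} → 0ℚ ≤ℚ l → ι 2 * l ≤ℚ 1ℚ → l ≤ℚ 1ℚ
  half≤1 {l} 0≤l h = ≤-trans (≤-by l 0≤l (solve 1 (λ e → con (ι 2) :* e :- e := e) refl l)) h
  l≤1 : a + ι D * b ≤ℚ 1ℚ
  l≤1 = half≤1 0≤l 2l≤1
  below : ∀ {x} → 0ℚ ≤ℚ x → x ≤ℚ a + ι D * b → 0ℚ <ℚ 1ℚ - x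
  below {x} 0≤x x≤ = ℚ.<-≤-trans (positive⁻¹ ℚ.½) (≤-by (ℚ.½ * (1ℚ - ι 2 * x))
    (0≤* (nonNegative⁻¹ ℚ.½) (diff-nonneg (≤-trans (*-monoˡ (ι 2) (0≤ι 2) x≤) 2l≤1)))
    (solve 1 (λ x → (con 1ℚ :- x) :- con ℚ.½ := con ℚ.½ :* (con 1ℚ :- con (ι 2) :* x)) refl x))
  a≤l : a ≤ℚ a + ι D * b
  a≤l = ≤-by (ι D * b) 0≤Db (solve 2 (λ a x → (a :+ x) :- a := x) refl a (ι D * b))
  b≤l : b ≤ℚ a + ι D * b
  b≤l = ≤-trans (≤-reflexive (sym (*-identityˡ b))) (≤-trans (*-monoʳ b 0≤b 1≤D)
    (≤-by a 0≤a (solve 2 (λ a x → (a :+ x) :- x := a) refl a (ι D * b))))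

-- Vertex 0 is kept apart; the others contain t disjoint parts of m vertices each.
module Layout (t m r′ i : ℕ) (tm≤i : t Nat.* m ≤ i) where

  place : Fin t → Fin m → Fin (suc i)
  place j k = suc (Fin.inject≤ (Fin.combine j k) tm≤i)

  place-inj : ∀ {j j′ k k′} → place j k ≡ place j′ k′ → j ≡ j′ × k ≡ k′
  place-inj {j} {j′} {k} {k′} e = Fin.combine-injective j k j′ k′ (Fin.inject≤-injective tm≤i tm≤i _ _ (Fin.suc-injective e))

  place≢0 : ∀ j k → place j k ≢ zero
  place≢0 j k ()

  module C = Configuration (suc r′) place place-inj zero place≢0

  module _ (q : ℚ) (0≤q : 0ℚ ≤ℚ q) (q≤1 : q ≤ℚ 1ℚ) where
    open Expectation q 0≤q q≤1
    open Binomial q 0≤q q≤1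
    module Mo = C.Moments q 0≤q q≤1

    tc-probability : ℚ
    tc-probability = Et {suc i} (λ G → 𝟙 (does (tc>? (suc r′) t (suc i) G)))

    q^r≤q : q ^ (suc r′) ≤ℚ q
    q^r≤q = *≤ˡ 0≤q (^≤1 r′ 0≤q q≤1)

    -- Serves only to estimate v^D with D fixed, so q^r can be replaced by the cruder q, which is
    -- small as well.
    v-lower : 1ℚ - ι 2 ^ t * q ≤ℚ Mo.v
    v-lower = ≤-trans (+-monoʳ-≤ 1ℚ (neg-antimono-≤ (*-monoˡ (ι 2 ^ t) (0≤^ t (0≤ι 2)) q^r≤q))) (few-prob-lower t (suc r′))

    probable : ∀ {ε} → 0ℚ <ℚ ε → ι 4 * ε ≤ℚ 1ℚ → ι 2 * (ι (suc t Nat.* suc t) * q + ι Mo.D * (ι 2 ^ t * q)) ≤ℚ ε → 0 Nat.< m →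
      ∀ w (0≤w : 0ℚ ≤ℚ w) (w≤1 : w ≤ℚ 1ℚ) →
      (∀ a b y i → lookup a i ≢ lookup b i → mem (C.selected a) y ≡ false → mem (C.selected b) y ≡ false →
        Et (λ G → C.fewAt a y G * C.fewAt b y G) ≤ℚ w) →
      1ℚ ≤ℚ ε * (ι m ^ t * Mo.v ^ Mo.N′) →
      (ι t * ι m ^ t) * w ^ Mo.N′ ≤ℚ (ε * (ι m ^ t * (Mo.v ^ Mo.N′ * Mo.v ^ Mo.N′))) * ι m →
      1ℚ - ι 4 * ε ≤ℚ tc-probability
    probable {ε} 0<ε 4ε≤1 hl 0<m w 0≤w w≤1 hw hV hW = begin
        1ℚ - ι 4 * ε
          ≤⟨ +-monoʳ-≤ 1ℚ (neg-antimono-≤ (Mo.SecondMoment.no-good-improbable w 0≤w w≤1 hw {ι 4 * ε} {ε} 0<ιm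
            (proj₁ estimate) (proj₁ (proj₂ estimate)) (proj₂ (proj₂ estimate)) hV hW bad bad⇒zero)) ⟩
        1ℚ - Et (λ G → 𝟙 (bad G))
          ≡⟨ solve 1 (λ e → con 1ℚ :- e := con 1ℚ :* con 1ℚ :+ (:- con 1ℚ) :* e) refl (Et (λ G → 𝟙 (bad G))) ⟩
        1ℚ * 1ℚ + (- 1ℚ) * Et (λ G → 𝟙 (bad G))
          ≡⟨ cong (λ e → 1ℚ * e + (- 1ℚ) * Et (λ G → 𝟙 (bad G))) (sym (Et-const {suc i} 1ℚ)) ⟩
        1ℚ * Et {suc i} (λ _ → 1ℚ) + (- 1ℚ) * Et (λ G → 𝟙 (bad G))
          ≡⟨ sym (Et-linear 1ℚ (- 1ℚ) (λ _ → 1ℚ) (λ G → 𝟙 (bad G))) ⟩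
        Et (λ G → 1ℚ * 1ℚ + (- 1ℚ) * 𝟙 (bad G)) ≡⟨ Et-cong (λ G → complement (does (tc>? (suc r′) t (suc i) G))) ⟩
        tc-probability ∎
      where
      open ℚ.≤-Reasoning
      bad : Graph (suc i) → Bool
      bad G = not (does (tc>? (suc r′) t (suc i) G))
      complement : ∀ b → 1ℚ * 1ℚ + (- 1ℚ) * 𝟙 (not b) ≡ 𝟙 b
      complement true  = refl
      complement false = refl
      bad⇒zero : ∀ G → bad G ≡ true → C.goodCount G ≡ 0ℚ
      bad⇒zero G = decide (tc>? (suc r′) t (suc i) G)
        where
        decide : (d : Dec (t Nat.< tc (suc r′) G)) → not (does d) ≡ true → C.goodCount G ≡ 0ℚ
        decide (no ¬p) _ = Covering.goodCount-zero r′ place place-inj zero place≢0 G ¬p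
      0<ιm : 0ℚ <ℚ ι m
      0<ιm = ℚ.<-≤-trans (0<ι 0) (ι-mono 0<m)
      estimate = gap-estimate Mo.D 0<ε 4ε≤1 (0≤* (0≤ι (suc t Nat.* suc t)) 0≤q) (0≤* (0≤^ t (0≤ι 2)) 0≤q)
        (ι-mono {1} {Mo.D} (Nat.s≤s Nat.z≤n)) hl v-lower

linear-small : ∀ {x y z} ε → 0ℚ <ℚ x → 0ℚ ≤ℚ y → 0ℚ ≤ℚ z → 0ℚ <ℚ ε →
  ∃[ η ] 0ℚ <ℚ η × (∀ {q} → q ≤ℚ η → ι 2 * (x * q + y * (z * q)) ≤ℚ ε)
linear-small {x} {y} {z} ε 0<x 0≤y 0≤z 0<ε =
  let η , η⁺ , eq = scale (ι 2 * (x + y * z)) ε (ℚ.positive 0<c) (ℚ.positive 0<ε)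
  in η , positive⁻¹ η {{η⁺}} , λ {q} q≤η → begin
    ι 2 * (x * q + y * (z * q))
      ≡⟨ solve 4 (λ x y z q → con (ι 2) :* (x :* q :+ y :* (z :* q)) := (con (ι 2) :* (x :+ y :* z)) :* q) refl x y z q ⟩
    (ι 2 * (x + y * z)) * q    ≤⟨ *-monoˡ (ι 2 * (x + y * z)) (<⇒≤ 0<c) q≤η ⟩
    (ι 2 * (x + y * z)) * η    ≡⟨ eq ⟩
    ε ∎
  where
  open ℚ.≤-Reasoning
  0<c : 0ℚ <ℚ ι 2 * (x + y * z)
  0<c = 0<* (0<ι 1) (ℚ.<-≤-trans 0<x (≤-by {x} {x + y * z} (y * z) (0≤* 0≤y 0≤z)
    (solve 2 (λ a b → (a :+ b) :- a := b) refl x (y * z))))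

loss-small : ∀ t ε → 0ℚ <ℚ ε → ∃[ η ] 0ℚ <ℚ η ×
  (∀ {q} → q ≤ℚ η → ι 2 * (ι (suc t Nat.* suc t) * q + ι (suc t Nat.+ suc t) * (ι 2 ^ t * q)) ≤ℚ ε)
loss-small t ε 0<ε = linear-small ε (0<ι (t Nat.+ t Nat.* suc t)) (0≤ι (suc t Nat.+ suc t)) (0≤^ t (0≤ι 2)) 0<ε

-- (qL)^r n ≤ (r L) L^r, and a power of the logarithm is negligible against n.
qL-small : ∀ r {n L q κ} → 0ℚ <ℚ n → 0ℚ ≤ℚ q → 0ℚ ≤ℚ L → 0ℚ ≤ℚ κ → n * q ^ suc r ≤ℚ ι (suc r) * L →
  ι (suc r) * L ^ suc (suc r) ≤ℚ κ ^ suc r * n → q * L ≤ℚ κ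
qL-small r {n} {L} {q} {κ} 0<n 0≤q 0≤L 0≤κ h hL = ^-cancel r 0≤κ (*-cancelˡ n 0<n (begin
    n * (q * L) ^ suc r            ≡⟨ cong (n *_) (Exp.^-distrib-* q L (suc r)) ⟩
    n * (q ^ suc r * L ^ suc r)    ≡⟨ sym (*-assoc n (q ^ suc r) (L ^ suc r)) ⟩
    (n * q ^ suc r) * L ^ suc r    ≤⟨ *-monoʳ (L ^ suc r) (0≤^ (suc r) 0≤L) h ⟩
    (ι (suc r) * L) * L ^ suc r    ≡⟨ *-assoc (ι (suc r)) L (L ^ suc r) ⟩
    ι (suc r) * L ^ suc (suc r)    ≤⟨ hL ⟩
    κ ^ suc r * n                  ≡⟨ *-comm (κ ^ suc r) n ⟩
    n * κ ^ suc r ∎))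
  where open ℚ.≤-Reasoning

-- The reason intersecting pairs behave as if independent in (i): n q^(r+1) = q (n q^r) ≤ r q L, and
-- q L is small.
np-small : ∀ {n s q L R κ} → 0ℚ ≤ℚ q → 0ℚ ≤ℚ R → n * s ≤ℚ R * L → q * L ≤ℚ κ → (ι 4 * R) * κ ≡ 1ℚ →
  ι 4 * (n * (q * s)) ≤ℚ 1ℚ
np-small {n} {s} {q} {L} {R} {κ} 0≤q 0≤R h hL eq = begin
    ι 4 * (n * (q * s))       ≡⟨ solve 3 (λ n q s → con (ι 4) :* (n :* (q :* s)) := con (ι 4) :* (q :* (n :* s))) refl n q s ⟩
    ι 4 * (q * (n * s))       ≤⟨ *-monoˡ (ι 4) (0≤ι 4) (*-monoˡ q 0≤q h) ⟩
    ι 4 * (q * (R * L))       ≡⟨ solve 3 (λ q R L → con (ι 4) :* (q :* (R :* L)) := (con (ι 4) :* R) :* (q :* L)) refl q R L ⟩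
    (ι 4 * R) * (q * L)       ≤⟨ *-monoˡ (ι 4 * R) (0≤* (0≤ι 4) 0≤R) hL ⟩
    (ι 4 * R) * κ             ≡⟨ eq ⟩
    1ℚ ∎
  where
  open ℚ.≤-Reasoning

-- P is (4n)^r and X is (1 - q^r)^n. The factor 1 + K gained from ω has to outweigh B, the price for
-- passing from n to the part size m, and 1/ε.
many-good : ∀ {B ε K P X M V} → 0ℚ <ℚ B → 0ℚ ≤ℚ ε → 0ℚ ≤ℚ X → 0ℚ ≤ℚ M → B ≤ℚ ε * K → 1ℚ + K ≤ℚ P * X →
  P ≤ℚ B * M → X ≤ℚ V → 1ℚ ≤ℚ ε * (M * V)
many-good {B} {ε} {K} {P} {X} {M} {V} 0<B 0≤ε 0≤X 0≤M hB hK hP hX = *-cancelˡ B 0<B (begin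
    B * 1ℚ              ≡⟨ *-identityʳ B ⟩
    B                   ≤⟨ hB ⟩
    ε * K               ≤⟨ *-monoˡ ε 0≤ε (x≤1+x K) ⟩
    ε * (1ℚ + K)        ≤⟨ *-monoˡ ε 0≤ε hK ⟩
    ε * (P * X)         ≤⟨ *-monoˡ ε 0≤ε (*-monoʳ X 0≤X hP) ⟩
    ε * ((B * M) * X)   ≤⟨ *-monoˡ ε 0≤ε (*-monoˡ (B * M) (0≤* (<⇒≤ 0<B) 0≤M) hX) ⟩
    ε * ((B * M) * V)   ≡⟨ solve 4 (λ e b m v → e :* ((b :* m) :* v) := b :* (e :* (m :* v))) refl ε B M V ⟩
    B * (ε * (M * V)) ∎)
  where
  open ℚ.≤-Reasoning

-- Only a proportion t/m of the pairs intersect in a given way of counting by coordinates, so a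
-- constant factor 2 in W is absorbed once m ≥ 2t/ε.
overlap-small : ∀ {T M W V ε m} → 0ℚ ≤ℚ T → 0ℚ ≤ℚ M → W ≤ℚ ι 2 * (V * V) → T * ι 2 ≤ℚ ε * m →
  (T * M) * W ≤ℚ (ε * (M * (V * V))) * m
overlap-small {T} {M} {W} {V} {ε} {m} 0≤T 0≤M hW hT = begin
    (T * M) * W                ≤⟨ *-monoˡ (T * M) (0≤* 0≤T 0≤M) hW ⟩
    (T * M) * (ι 2 * (V * V))  ≡⟨ solve 3 (λ t m v → (t :* m) :* (con (ι 2) :* (v :* v)) := (t :* con (ι 2)) :*
      (m :* (v :* v))) refl T M V ⟩
    (T * ι 2) * (M * (V * V))  ≤⟨ *-monoʳ (M * (V * V)) (0≤* 0≤M (0≤square V)) hT ⟩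
    (ε * m) * (M * (V * V))    ≡⟨ solve 4 (λ e m M v → (e :* m) :* (M :* (v :* v)) := (e :* (M :* (v :* v))) :* m) refl ε m M V ⟩
    (ε * (M * (V * V))) * m ∎
  where
  open ℚ.≤-Reasoning

pair-bound-range : ∀ {s p} → 0ℚ ≤ℚ s → ι 4 * s ≤ℚ 1ℚ → 0ℚ ≤ℚ p → p ≤ℚ s →
  0ℚ ≤ℚ (1ℚ - s) - s + p × (1ℚ - s) - s + p ≤ℚ 1ℚ
pair-bound-range {s} {p} 0≤s 4s≤1 0≤p p≤s =
    ≤-by ((1ℚ - ι 4 * s) + (ι 2 * s + p)) (0≤+ (diff-nonneg 4s≤1) (0≤+ (0≤* (0≤ι 2) 0≤s) 0≤p))
      (solve 2 (λ s p → ((con 1ℚ :- s) :- s :+ p) :- con 0ℚ := (con 1ℚ :- con (ι 4) :* s) :+ (con (ι 2) :* s :+ p)) refl s p)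
  , ≤-by (s + (s - p)) (0≤+ 0≤s (diff-nonneg p≤s))
      (solve 2 (λ s p → con 1ℚ :- ((con 1ℚ :- s) :- s :+ p) := s :+ (s :- p)) refl s p)

power-bound : ∀ t {n m c} → 0ℚ ≤ℚ n → n ≤ℚ c * m → (ι 4 * n) ^ t ≤ℚ (ι 4 * c) ^ t * m ^ t
power-bound t {n} {m} {c} 0≤n h = begin
    (ι 4 * n) ^ t          ≤⟨ ^-mono t (0≤* (0≤ι 4) 0≤n) (*-monoˡ (ι 4) (0≤ι 4) h) ⟩
    (ι 4 * (c * m)) ^ t    ≡⟨ cong (_^ t) (sym (*-assoc (ι 4) c m)) ⟩
    ((ι 4 * c) * m) ^ t    ≡⟨ Exp.^-distrib-* (ι 4 * c) m t ⟩
    (ι 4 * c) ^ t * m ^ t ∎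
  where open ℚ.≤-Reasoning

parts-fit : ∀ t′ i → suc t′ Nat.* (i ℕ./ suc t′) ≤ i
parts-fit t′ i = subst (_≤ i) (ℕ.*-comm (i ℕ./ suc t′) (suc t′)) (ℕ.m/n*n≤m i (suc t′))

-- Expected numbers of good tuples at and below the threshold

drop-nonneg : ∀ {x y z} → 0ℚ ≤ℚ y → x + y ≤ℚ z → x ≤ℚ z
drop-nonneg {x} {y} hy h = ≤-trans (≤-by {x} {x + y} y hy (solve 2 (λ x y → (x :+ y) :- x := y) refl x y)) h

1-x≤1 : ∀ {x} → 0ℚ ≤ℚ x → 1ℚ - x ≤ℚ 1ℚ
1-x≤1 {x} h = ≤-by {1ℚ - x} {1ℚ} x h (solve 1 (λ x → con 1ℚ :- (con 1ℚ :- x) := x) refl x)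

square-bound : ∀ {c L n} → (c * c) * L ^ 2 ≤ℚ 1ℚ * n → (c * L) * (c * L) ≤ℚ n
square-bound {c} {L} {n} h = ≤-trans
  (≤-reflexive (solve 2 (λ c l → (c :* l) :* (c :* l) := (c :* c) :* (l :* (l :* con 1ℚ))) refl c L))
  (≤-trans h (≤-reflexive (*-identityˡ n)))

module Sharp (r′ : ℕ) (ε : ℚ) (0<ε : 0ℚ <ℚ ε) (4ε≤1 : ι 4 * ε ≤ℚ 1ℚ) where

  -- By n ≤ 2 r m, (4n)^r is at most B m^r.
  B : ℚ
  B = (ι 4 * (ι 2 * ι (suc r′))) ^ suc r′

  0<B : 0ℚ <ℚ B
  0<B = 0<^ (suc r′) (0<* (0<ι 3) (0<* (0<ι 1) (0<ι r′)))

  0<4r : 0ℚ <ℚ ι 4 * ι (suc r′)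
  0<4r = 0<* (0<ι 3) (0<ι r′)

  η-choice = loss-small (suc r′) ε 0<ε
  κ-choice = scale (ι 4 * ι (suc r′)) 1ℚ (ℚ.positive 0<4r) (ℚ.positive (positive⁻¹ 1ℚ))
  K-choice = large B ε 0<ε
  m-choice = large (ι (suc r′) * ι 2) ε 0<ε

  η κ : ℚ
  η = proj₁ η-choice
  κ = proj₁ κ-choice

  0<η : 0ℚ <ℚ η
  0<η = proj₁ (proj₂ η-choice)

  0<κ : 0ℚ <ℚ κ
  0<κ = positive⁻¹ κ {{proj₁ (proj₂ κ-choice)}}

  -- At least B/ε, for `many-good`; the successor ensures K ≥ 1, for `sharp-lower`.
  K : ℕ
  K = suc (proj₁ K-choice)

  eventually = both (both (log-small r′ η 0<η) (log-small r′ (recip 3) (0<recip 3)))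
    (both (both (polylog-scaled 1 (ι (suc r′) * ι (suc r′)) 1ℚ (0≤* (0≤ι (suc r′)) (0≤ι (suc r′))) (positive⁻¹ 1ℚ))
                (polylog-scaled (suc r′) (ι (suc r′)) (κ ^ suc r′) (0≤ι (suc r′)) (0<^ (suc r′) 0<κ)))
          (part-large r′ (ι (proj₁ m-choice))))

  -- The hypothesis on q is p^r = (r log n - ω)/n with ω weakened to the constant 4K. The threshold
  -- for n depends only on r and ε, not on k or q.
  sharp : ∀ i → proj₁ eventually ≤ suc i → ∀ k q (0≤q : 0ℚ ≤ℚ q) (q≤1 : q ≤ℚ 1ℚ) →
    ι (suc i) * q ^ suc r′ + ι 4 * ι K ≤ℚ ι (suc r′) * logApprox i k →
    1ℚ - ι 4 * ε ≤ℚ Expectation.Et q 0≤q q≤1 {suc i} (λ G → 𝟙 (does (tc>? (suc r′) (suc r′) (suc i) G)))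
  sharp i N≤ k q 0≤q q≤1 h = Lay.probable q 0≤q q≤1 0<ε 4ε≤1 (proj₂ (proj₂ η-choice) q≤η) 0<m
      ((1ℚ - q ^ suc r′) - q ^ suc r′ + q * q ^ suc r′) (proj₁ range) (proj₂ range)
      (λ a b y j → Lay.Mo.Et-few-distinct q 0≤q q≤1 refl a b y j)
      (subst (λ v → 1ℚ ≤ℚ ε * (ι m ^ suc r′ * v ^ N′)) (sym v≡)
        (many-good 0<B (<⇒≤ 0<ε) (0≤^ (suc i) 0≤1-s) (0≤^ (suc r′) (0≤ι m)) (proj₂ K-choice K (ℕ.n≤1+n _))
          (sharp-lower (suc r′) 0≤s 2s≤1 (ι-mono {1} {K} (Nat.s≤s Nat.z≤n)) h R²≤n)
          (power-bound (suc r′) {ι (suc i)} {ι m} {ι 2 * ι (suc r′)} (0≤ι (suc i)) (n≤2tm r′ i 0<m))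
          (^-anti 0≤1-s 1-s≤1 (ℕ.m∸n≤m (suc i) (suc (suc r′) Nat.+ suc (suc r′))))))
      (subst (λ v → (ι (suc r′) * ι m ^ suc r′) * W ≤ℚ (ε * (ι m ^ suc r′ * (v ^ N′ * v ^ N′))) * ι m) (sym v≡)
        (overlap-small {ι (suc r′)} {ι m ^ suc r′} {W} {(1ℚ - q ^ suc r′) ^ N′} {ε} {ι m} (0≤ι (suc r′)) (0≤^ (suc r′) (0≤ι m))
          (pair-upper {q ^ suc r′} {q * q ^ suc r′} {N′} (ℕ.m∸n≤m (suc i) (suc (suc r′) Nat.+ suc
            (suc r′))) 0≤s 4s≤1 (0≤* 0≤q 0≤s)
            (np-small {ι (suc i)} {q ^ suc r′} {q} {logApprox i k} {ι (suc r′)} {κ} 0≤q (0≤ι (suc r′)) ns≤ qL≤κ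
              (proj₂ (proj₂ κ-choice))) (proj₁ range))
          (≤-trans (proj₂ m-choice (proj₁ m-choice) ℕ.≤-refl) (*-monoˡ {ι (proj₁ m-choice)} {ι m} ε (<⇒≤ 0<ε) (proj₂ m-facts)))))
    where
    open Scale i k
    facts = proj₂ eventually i N≤
    m-facts = proj₂ (proj₂ facts)
    m = i ℕ./ suc r′
    0<m = proj₁ m-facts
    module Lay = Layout (suc r′) m r′ i (parts-fit r′ i)
    N′ = suc i Nat.∸ (suc (suc r′) Nat.+ suc (suc r′))
    W : ℚ
    W = ((1ℚ - q ^ suc r′) - q ^ suc r′ + q * q ^ suc r′) ^ N′
    v≡ : Binomial.few-prob q 0≤q q≤1 (suc r′) (suc r′) ≡ 1ℚ - q ^ suc r′
    v≡ = Binomial.few-prob-all q 0≤q q≤1 (suc r′)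
    0≤s : 0ℚ ≤ℚ q ^ suc r′
    0≤s = 0≤^ (suc r′) 0≤q
    ns≤ : ι (suc i) * q ^ suc r′ ≤ℚ ι (suc r′) * logApprox i k
    ns≤ = drop-nonneg (0≤* (0≤ι 4) (0≤ι K)) h
    q≤η : q ≤ℚ η
    q≤η = q-small r′ (<⇒≤ 0<η) ns≤ (proj₁ (proj₁ facts) k)
    4q≤1 : ι 4 * q ≤ℚ 1ℚ
    4q≤1 = ≤-trans (*-monoˡ (ι 4) (0≤ι 4) (q-small r′ {q} {recip 3} (0≤recip 3) ns≤ (proj₂ (proj₁ facts) k)))
      (≤-reflexive (recip-cancel 3))
    4s≤1 : ι 4 * q ^ suc r′ ≤ℚ 1ℚ
    4s≤1 = ≤-trans (*-monoˡ {q ^ suc r′} {q} (ι 4) (0≤ι 4) (*≤ˡ {q} {q ^ r′} 0≤q (^≤1 {q} r′ 0≤q q≤1))) 4q≤1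
    2s≤1 : ι 2 * q ^ suc r′ ≤ℚ 1ℚ
    2s≤1 = ≤-trans (*-monoʳ (q ^ suc r′) 0≤s (ι-mono {2} {4} (Nat.s≤s (Nat.s≤s Nat.z≤n)))) 4s≤1
    s≤1 : q ^ suc r′ ≤ℚ 1ℚ
    s≤1 = ^≤1 (suc r′) 0≤q q≤1
    0≤1-s : 0ℚ ≤ℚ 1ℚ - q ^ suc r′
    0≤1-s = diff-nonneg s≤1
    1-s≤1 : 1ℚ - q ^ suc r′ ≤ℚ 1ℚ
    1-s≤1 = 1-x≤1 0≤s
    range : 0ℚ ≤ℚ (1ℚ - q ^ suc r′) - q ^ suc r′ + q * q ^ suc r′ × (1ℚ - q ^ suc r′) - q ^ suc r′ + q * q ^ suc r′ ≤ℚ 1ℚ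
    range = pair-bound-range 0≤s 4s≤1 (0≤* 0≤q 0≤s) (*≤ʳ 0≤s q≤1)
    qL≤κ : q * logApprox i k ≤ℚ κ
    qL≤κ = qL-small r′ (0<ι i) 0≤q (0≤log i k) (<⇒≤ 0<κ) ns≤ (proj₂ (proj₁ (proj₂ facts)) k)
    R²≤n : (ι (suc r′) * logApprox i k) * (ι (suc r′) * logApprox i k) ≤ℚ ι (suc i)
    R²≤n = square-bound {ι (suc r′)} {logApprox i k} {ι (suc i)} (proj₁ (proj₁ (proj₂ facts)) k)

-- V² ≥ 1/(4n) and n ≤ 2Tm give (mV)² ≥ m/(8T), which exceeds (T/ε)² when m ≥ 8T³/ε².
weak-count : ∀ {n T m ε V} → 0ℚ ≤ℚ T → 0ℚ ≤ℚ m → 0ℚ ≤ℚ ε → 0ℚ ≤ℚ V → 1ℚ ≤ℚ (ι 4 * n) * (V * V) →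
  n ≤ℚ (ι 2 * T) * m → ι 8 * (T * (T * T)) ≤ℚ (ε * ε) * m → T ≤ℚ ε * (m * V)
weak-count {n} {T} {m} {ε} {V} 0≤T 0≤m 0≤ε 0≤V hV hn hm = square-cancel (0≤* 0≤ε (0≤* 0≤m 0≤V)) (begin
    T * T                                ≡⟨ sym (*-identityʳ (T * T)) ⟩
    (T * T) * 1ℚ                         ≤⟨ *-monoˡ (T * T) (0≤square T) hV ⟩
    (T * T) * ((ι 4 * n) * (V * V))
      ≤⟨ *-monoˡ (T * T) (0≤square T) (*-monoʳ (V * V) (0≤square V) (*-monoˡ (ι 4) (0≤ι 4) hn)) ⟩
    (T * T) * ((ι 4 * ((ι 2 * T) * m)) * (V * V))
      ≡⟨ solve 3 (λ T m V → (T :* T) :* ((con (ι 4) :* ((con (ι 2) :* T) :* m)) :* (V :* V))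
           := (con (ι 8) :* (T :* (T :* T))) :* (m :* (V :* V))) refl T m V ⟩
    (ι 8 * (T * (T * T))) * (m * (V * V))
      ≤⟨ *-monoʳ (m * (V * V)) (0≤* 0≤m (0≤square V)) hm ⟩
    ((ε * ε) * m) * (m * (V * V))
      ≡⟨ solve 3 (λ e m V → ((e :* e) :* m) :* (m :* (V :* V)) := (e :* (m :* V)) :* (e :* (m :* V))) refl ε m V ⟩
    (ε * (m * V)) * (ε * (m * V)) ∎)
  where
  open ℚ.≤-Reasoning

weak-many : ∀ {T m M ε V} → 1ℚ ≤ℚ T → 0ℚ ≤ℚ ε → 0ℚ ≤ℚ V → m ≤ℚ M → T ≤ℚ ε * (m * V) → 1ℚ ≤ℚ ε * (M * V)
weak-many {V = V} 1≤T 0≤ε 0≤V m≤M h = ≤-trans 1≤T (≤-trans h (*-monoˡ _ 0≤ε (*-monoʳ V 0≤V m≤M)))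

-- With w = v, the requirement on intersecting pairs reduces to t ≤ ε m V, the same inequality that
-- `weak-many` uses for the diagonal.
weak-overlap : ∀ {T m M ε V} → 0ℚ ≤ℚ M → 0ℚ ≤ℚ V → T ≤ℚ ε * (m * V) → (T * M) * V ≤ℚ (ε * (M * (V * V))) * m
weak-overlap {T} {m} {M} {ε} {V} 0≤M 0≤V h = begin
    (T * M) * V              ≡⟨ *-assoc T M V ⟩
    T * (M * V)              ≤⟨ *-monoʳ (M * V) (0≤* 0≤M 0≤V) h ⟩
    (ε * (m * V)) * (M * V)  ≡⟨ solve 4 (λ e m M v → (e :* (m :* v)) :* (M :* v) := (e :* (M :* (v :* v))) :* m) refl ε m M V ⟩
    (ε * (M * (V * V))) * m ∎
  where
  open ℚ.≤-Reasoning

weak-scale : ∀ {n C s L ε′} → 0ℚ ≤ℚ C → n * s ≤ℚ ε′ * L → (ι 8 * C) * ε′ ≡ 1ℚ → ι 8 * (n * (C * s)) ≤ℚ L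
weak-scale {n} {C} {s} {L} {ε′} 0≤C h eq = begin
    ι 8 * (n * (C * s))      ≡⟨ solve 3 (λ n C s → con (ι 8) :* (n :* (C :* s)) := (con (ι 8) :* C) :* (n :* s)) refl n C s ⟩
    (ι 8 * C) * (n * s)      ≤⟨ *-monoˡ (ι 8 * C) (0≤* (0≤ι 8) 0≤C) h ⟩
    (ι 8 * C) * (ε′ * L)     ≡⟨ sym (*-assoc (ι 8 * C) ε′ L) ⟩
    ((ι 8 * C) * ε′) * L     ≡⟨ trans (cong (_* L) eq) (*-identityˡ L) ⟩
    L ∎
  where
  open ℚ.≤-Reasoning

weak-hyp : ∀ {n C s L R} → 0ℚ ≤ℚ n → 0ℚ ≤ℚ s → 0ℚ ≤ℚ L → 1ℚ ≤ℚ C → 1ℚ ≤ℚ R → ι 8 * (n * (C * s)) ≤ℚ L → n * s ≤ℚ R * L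
weak-hyp {n} {C} {s} {L} {R} 0≤n 0≤s 0≤L 1≤C 1≤R h = begin
    n * s                 ≤⟨ *-monoˡ n 0≤n (≤-trans (≤-reflexive (sym (*-identityˡ s))) (*-monoʳ s 0≤s 1≤C)) ⟩
    n * (C * s)           ≤⟨ ≤-by (ι 7 * (n * (C * s))) (0≤* (0≤ι 7) (0≤* 0≤n (0≤* (≤-trans 0≤1 1≤C) 0≤s)))
                               (solve 1 (λ x → con (ι 8) :* x :- x := con (ι 7) :* x) refl (n * (C * s))) ⟩
    ι 8 * (n * (C * s))   ≤⟨ h ⟩
    L                     ≡⟨ sym (*-identityˡ L) ⟩
    1ℚ * L                ≤⟨ *-monoʳ L 0≤L 1≤R ⟩
    R * L ∎
  where
  open ℚ.≤-Reasoning

module Weak (r′ t′ : ℕ) (ε : ℚ) (0<ε : 0ℚ <ℚ ε) (4ε≤1 : ι 4 * ε ≤ℚ 1ℚ) where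

  1≤C : 1ℚ ≤ℚ ι 2 ^ suc t′
  1≤C = 1≤^ (suc t′) (ι-mono {1} {2} (Nat.s≤s Nat.z≤n))

  0≤C : 0ℚ ≤ℚ ι 2 ^ suc t′
  0≤C = ≤-trans 0≤1 1≤C

  η-choice = loss-small (suc t′) ε 0<ε
  -- 2^t is the constant of `few-prob-lower`, and 8 the one required by `weak-lower`.
  δ-choice = scale (ι 8 * ι 2 ^ suc t′) 1ℚ (ℚ.positive (0<* (0<ι 7) (0<^ (suc t′) (0<ι 1)))) (ℚ.positive (positive⁻¹ 1ℚ))
  m-choice = large (ι 8 * (ι (suc t′) * (ι (suc t′) * ι (suc t′)))) (ε * ε) (0<* 0<ε 0<ε)

  η δ : ℚ
  η = proj₁ η-choice
  δ = proj₁ δ-choice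

  0<η : 0ℚ <ℚ η
  0<η = proj₁ (proj₂ η-choice)

  0<δ : 0ℚ <ℚ δ
  0<δ = positive⁻¹ δ {{proj₁ (proj₂ δ-choice)}}

  eventually = both (both (log-small r′ η 0<η) (polylog-scaled 0 1ℚ 1ℚ 0≤1 (positive⁻¹ 1ℚ)))
    (part-large t′ (ι (proj₁ m-choice)))

  weak : ∀ i → proj₁ eventually ≤ suc i → ∀ k q (0≤q : 0ℚ ≤ℚ q) (q≤1 : q ≤ℚ 1ℚ) →
    ι (suc i) * q ^ suc r′ ≤ℚ δ * logApprox i k →
    1ℚ - ι 4 * ε ≤ℚ Expectation.Et q 0≤q q≤1 {suc i} (λ G → 𝟙 (does (tc>? (suc r′) (suc t′) (suc i) G)))
  weak i N≤ k q 0≤q q≤1 h = Lay.probable q 0≤q q≤1 0<ε 4ε≤1 (proj₂ (proj₂ η-choice) q≤η) 0<m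
      v 0≤v v≤1 (λ a b y j _ y∉ _ → Lay.Mo.Et-few-same q 0≤q q≤1 a b y y∉)
      (weak-many {ι (suc t′)} {ι m} {ι m ^ suc t′} {ε} {v ^ N′} (ι-mono {1} {suc t′} (Nat.s≤s Nat.z≤n)) (<⇒≤ 0<ε) 0≤V m≤M t≤)
      (weak-overlap {ι (suc t′)} {ι m} {ι m ^ suc t′} {ε} {v ^ N′} (0≤^ (suc t′) (0≤ι m)) 0≤V t≤)
    where
    open Scale i k
    facts = proj₂ eventually i N≤
    m-facts = proj₂ facts
    m = i ℕ./ suc t′
    0<m = proj₁ m-facts
    module Lay = Layout (suc t′) m r′ i (parts-fit t′ i)
    N′ = suc i Nat.∸ (suc (suc t′) Nat.+ suc (suc t′))
    v : ℚ
    v = Binomial.few-prob q 0≤q q≤1 (suc t′) (suc r′)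
    0≤v : 0ℚ ≤ℚ v
    0≤v = Binomial.0≤few-prob q 0≤q q≤1 (suc t′) (suc r′)
    v≤1 : v ≤ℚ 1ℚ
    v≤1 = Binomial.few-prob≤1 q 0≤q q≤1 (suc t′) (suc r′)
    0≤V : 0ℚ ≤ℚ v ^ N′
    0≤V = 0≤^ N′ 0≤v
    0≤s : 0ℚ ≤ℚ q ^ suc r′
    0≤s = 0≤^ (suc r′) 0≤q
    8nx≤L : ι 8 * (ι (suc i) * (ι 2 ^ suc t′ * q ^ suc r′)) ≤ℚ logApprox i k
    8nx≤L = weak-scale {ι (suc i)} {ι 2 ^ suc t′} {q ^ suc r′} {logApprox i k} {δ} 0≤C h (proj₂ (proj₂ δ-choice))
    ns≤ : ι (suc i) * q ^ suc r′ ≤ℚ ι (suc r′) * logApprox i k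
    ns≤ = weak-hyp {ι (suc i)} {ι 2 ^ suc t′} {q ^ suc r′} {logApprox i k} {ι (suc r′)}
      (0≤ι (suc i)) 0≤s (0≤log i k) 1≤C (ι-mono {1} {suc r′} (Nat.s≤s Nat.z≤n)) 8nx≤L
    q≤η : q ≤ℚ η
    q≤η = q-small r′ (<⇒≤ 0<η) ns≤ (proj₁ (proj₁ facts) k)
    L≤n : logApprox i k ≤ℚ ι (suc i)
    L≤n = unit (proj₂ (proj₁ facts) k)
      where
      unit : ∀ {L n} → 1ℚ * L ^ 1 ≤ℚ 1ℚ * n → L ≤ℚ n
      unit {L} {n} h = subst₂ _≤ℚ_ (trans (*-identityˡ (L * 1ℚ)) (*-identityʳ L)) (*-identityˡ n) h
    1≤4nV² : 1ℚ ≤ℚ (ι 4 * ι (suc i)) * (v ^ N′ * v ^ N′)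
    1≤4nV² = ≤-trans (weak-lower (0≤* 0≤C 0≤s) 8nx≤L L≤n (Binomial.few-prob-lower q 0≤q q≤1 (suc t′) (suc r′)))
      (*-monoˡ (ι 4 * ι (suc i)) (0≤* (0≤ι 4) (0≤ι (suc i))) (*-mono 0≤vn vn≤V 0≤vn vn≤V))
      where
      0≤vn = 0≤^ (suc i) 0≤v
      vn≤V = ^-anti 0≤v v≤1 (ℕ.m∸n≤m (suc i) (suc (suc t′) Nat.+ suc (suc t′)))
    t≤ : ι (suc t′) ≤ℚ ε * (ι m * v ^ N′)
    t≤ = weak-count {ι (suc i)} {ι (suc t′)} {ι m} {ε} {v ^ N′} (0≤ι (suc t′)) (0≤ι m) (<⇒≤ 0<ε) 0≤V 1≤4nV² (n≤2tm t′ i 0<m)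
      (≤-trans (proj₂ m-choice (proj₁ m-choice) ℕ.≤-refl) (*-monoˡ {ι (proj₁ m-choice)} {ι m} (ε * ε) (0≤square ε)
        (proj₂ m-facts)))
    m≤M : ι m ≤ℚ ι m ^ suc t′
    m≤M = ≤-trans (≤-reflexive (sym (*-identityʳ (ι m)))) (*-monoˡ {1ℚ} {ι m ^ t′} (ι m) (0≤ι m) (1≤^ t′ (ι-mono 0<m)))

-- Reals as sequences of rationals

seq-* : ∀ x y k → seq (x *ℝ y) k ≡ seq x k * seq y k
seq-* x y k = refl

seq-+ : ∀ x y k → seq (x +ℝ y) k ≡ seq x k + seq y k
seq-+ x y k = refl

seq-sub : ∀ x y k → seq (x -ℝ y) k ≡ seq x k - seq y k
seq-sub x y k = refl

seq-fromℚ : ∀ a k → seq (fromℚ a) k ≡ a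
seq-fromℚ a k = refl

seq-∣∣ : ∀ x k → seq ∣ x ∣ℝ k ≡ ℚ.∣ seq x k ∣
seq-∣∣ x k = refl

seq-^ : ∀ x n k → seq (x ^ℝ n) k ≡ seq x k ^ n
seq-^ x zero    k = refl
seq-^ x (suc n) k = cong (seq x k *_) (seq-^ x n k)

seq-log : ∀ i k → seq (log (suc i)) k ≡ logApprox i k
seq-log i k = refl

abs-≤ : ∀ {a b} → a ≤ℚ b → - a ≤ℚ b → ℚ.∣ a ∣ ≤ℚ b
abs-≤ {a} {b} h h′ = decide (ℚ.∣p∣≡p∨∣p∣≡-p a)
  where
  decide : ℚ.∣ a ∣ ≡ a ⊎ ℚ.∣ a ∣ ≡ - a → ℚ.∣ a ∣ ≤ℚ b
  decide (inj₁ e) = subst (_≤ℚ b) (sym e) h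
  decide (inj₂ e) = subst (_≤ℚ b) (sym e) h′

≤-abs : ∀ a → a ≤ℚ ℚ.∣ a ∣
≤-abs a = decide (ℚ.≤-total 0ℚ a)
  where
  decide : 0ℚ ≤ℚ a ⊎ a ≤ℚ 0ℚ → a ≤ℚ ℚ.∣ a ∣
  decide (inj₁ h) = ≤-reflexive (sym (ℚ.0≤p⇒∣p∣≡p h))
  decide (inj₂ h) = ≤-trans h (ℚ.0≤∣p∣ a)

abs-swap : ∀ a b → ℚ.∣ a - b ∣ ≡ ℚ.∣ b - a ∣
abs-swap a b = trans (cong ℚ.∣_∣ (sym (neg-sub b a))) (ℚ.∣-p∣≡∣p∣ (b - a))

abs-≤⇒ : ∀ {a b δ} → ℚ.∣ a - b ∣ ≤ℚ δ → a ≤ℚ b + δ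
abs-≤⇒ {a} {b} {δ} h = ≤-by {a} {b + δ} (δ - (a - b)) (diff-nonneg (≤-trans (≤-abs (a - b)) h))
  (solve 3 (λ a b d → (b :+ d) :- a := d :- (a :- b)) refl a b δ)

abs-triangle : ∀ a b c → ℚ.∣ a - c ∣ ≤ℚ ℚ.∣ a - b ∣ + ℚ.∣ b - c ∣
abs-triangle a b c = ≤-trans
  (≤-reflexive (cong ℚ.∣_∣ (solve 3 (λ a b c → a :- c := (a :- b) :+ (b :- c)) refl a b c)))
  (ℚ.∣p+q∣≤∣p∣+∣q∣ (a - b) (b - c))

-- Formulated for bare sequences rather than reals, because it is used to show that the truncated
-- sequence is Cauchy.
EventuallyClose : (ℕ → ℚ) → (ℕ → ℚ) → Set
EventuallyClose s s′ = ∀ δ → 0ℚ <ℚ δ → ∃[ N ] (∀ k → N ≤ k → ℚ.∣ s k - s′ k ∣ ≤ℚ δ)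

0<½ : 0ℚ <ℚ ½
0<½ = positive⁻¹ ½

cauchy-close : ∀ {s s′} → Cauchy s → EventuallyClose s s′ → Cauchy s′
cauchy-close {s} {s′} c h δ =
  let 0<½δ = 0<* {½} {δ} 0<½ (positive⁻¹ δ)
      0<¼δ = 0<* {½} {½ * δ} 0<½ 0<½δ
      N₁ , k₁ = c (½ * δ) {{ℚ.positive 0<½δ}}
      N₂ , k₂ = h (½ * (½ * δ)) 0<¼δ
  in N₁ ⊔ N₂ , λ m n N≤m N≤n → step (s m) (s n) (s′ m) (s′ n)
       (k₁ m n (ℕ.m⊔n≤o⇒m≤o N₁ N₂ N≤m) (ℕ.m⊔n≤o⇒m≤o N₁ N₂ N≤n))
       (k₂ m (ℕ.m⊔n≤o⇒n≤o N₁ N₂ N≤m)) (k₂ n (ℕ.m⊔n≤o⇒n≤o N₁ N₂ N≤n))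
  where
  open ℚ.≤-Reasoning
  step : ∀ a b a′ b′ → ℚ.∣ a - b ∣ ≤ℚ ½ * δ → ℚ.∣ a - a′ ∣ ≤ℚ ½ * (½ * δ) → ℚ.∣ b - b′ ∣ ≤ℚ ½ * (½ * δ) → ℚ.∣ a′ - b′ ∣ ≤ℚ δ
  step a b a′ b′ ab aa bb = begin
    ℚ.∣ a′ - b′ ∣                                       ≤⟨ abs-triangle a′ a b′ ⟩
    ℚ.∣ a′ - a ∣ + ℚ.∣ a - b′ ∣
      ≤⟨ +-mono-≤ (≤-trans (≤-reflexive (abs-swap a′ a)) aa)
                    (≤-trans (abs-triangle a b b′) (+-mono-≤ ab bb)) ⟩
    ½ * (½ * δ) + (½ * δ + ½ * (½ * δ))
      ≡⟨ solve 1 (λ d → con ½ :* (con ½ :* d) :+ (con ½ :* d :+ con ½ :* (con ½ :* d)) := d) refl δ ⟩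
    δ ∎

close-refl : ∀ s → EventuallyClose s s
close-refl s δ 0<δ = 0 , λ k _ → subst (_≤ℚ δ) (sym (cong ℚ.∣_∣ (ℚ.+-inverseʳ (s k)))) (<⇒≤ 0<δ)

close-+ : ∀ {s s′ t t′} → EventuallyClose s s′ → EventuallyClose t t′ →
  EventuallyClose (λ k → s k + t k) (λ k → s′ k + t′ k)
close-+ {s} {s′} {t} {t′} h h′ δ 0<δ =
  let 0<½δ = 0<* {½} {δ} 0<½ 0<δ
      N₁ , k₁ = h (½ * δ) 0<½δ
      N₂ , k₂ = h′ (½ * δ) 0<½δ
  in N₁ ⊔ N₂ , λ k N≤ → step (s k) (s′ k) (t k) (t′ k) (k₁ k (ℕ.m⊔n≤o⇒m≤o N₁ N₂ N≤)) (k₂ k (ℕ.m⊔n≤o⇒n≤o N₁ N₂ N≤))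
  where
  open ℚ.≤-Reasoning
  step : ∀ a a′ b b′ → ℚ.∣ a - a′ ∣ ≤ℚ ½ * δ → ℚ.∣ b - b′ ∣ ≤ℚ ½ * δ → ℚ.∣ (a + b) - (a′ + b′) ∣ ≤ℚ δ
  step a a′ b b′ aa bb = begin
    ℚ.∣ (a + b) - (a′ + b′) ∣           ≡⟨ cong ℚ.∣_∣ (+-swap a b a′ b′) ⟩
    ℚ.∣ (a - a′) + (b - b′) ∣           ≤⟨ ℚ.∣p+q∣≤∣p∣+∣q∣ (a - a′) (b - b′) ⟩
    ℚ.∣ a - a′ ∣ + ℚ.∣ b - b′ ∣         ≤⟨ +-mono-≤ aa bb ⟩
    ½ * δ + ½ * δ                       ≡⟨ ½+½ δ ⟩
    δ ∎

close-neg : ∀ {s s′} → EventuallyClose s s′ → EventuallyClose (λ k → - s k) (λ k → - s′ k)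
close-neg {s} {s′} h δ 0<δ =
  let N , k₁ = h δ 0<δ in N , λ k N≤ → ≤-trans (≤-reflexive (step (s k) (s′ k))) (k₁ k N≤)
  where
  step : ∀ a b → ℚ.∣ (- a) - (- b) ∣ ≡ ℚ.∣ a - b ∣
  step a b = trans (cong ℚ.∣_∣ (solve 2 (λ a b → (:- a) :- (:- b) := b :- a) refl a b)) (abs-swap b a)

close-* : ∀ {s s′ t t′} → Cauchy s → Cauchy t′ → EventuallyClose s s′ → EventuallyClose t t′ →
  EventuallyClose (λ k → s k * t k) (λ k → s′ k * t′ k)
close-* {s} {s′} {t} {t′} cs ct h h′ δ 0<δ =
  let A , A⁺ , M₁ , b₁ = bounded s cs
      B , B⁺ , M₂ , b₂ = bounded t′ ct
      η , η⁺ , eq = scale (A + B) δ (ℚ.pos+pos⇒pos A {{A⁺}} B {{B⁺}}) (ℚ.positive 0<δ)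
      N₁ , k₁ = h η (positive⁻¹ η {{η⁺}})
      N₂ , k₂ = h′ η (positive⁻¹ η {{η⁺}})
  in (N₁ ⊔ M₁) ⊔ (N₂ ⊔ M₂) , λ k N≤ →
    let l = ℕ.m⊔n≤o⇒m≤o (N₁ ⊔ M₁) (N₂ ⊔ M₂) N≤
        r = ℕ.m⊔n≤o⇒n≤o (N₁ ⊔ M₁) (N₂ ⊔ M₂) N≤
    in *-close (s k) (t k) (s′ k) (t′ k) A B η δ A⁺ B⁺ eq
         (b₁ k (ℕ.m⊔n≤o⇒n≤o N₁ M₁ l)) (b₂ k (ℕ.m⊔n≤o⇒n≤o N₂ M₂ r))
         (k₁ k (ℕ.m⊔n≤o⇒m≤o N₁ M₁ l)) (k₂ k (ℕ.m⊔n≤o⇒m≤o N₂ M₂ r))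

infix 4 _≃ℝ_

_≃ℝ_ : ℝ → ℝ → Set
x ≃ℝ y = EventuallyClose (seq x) (seq y)

*ℝ-cong : ∀ x x′ y y′ → x ≃ℝ x′ → y ≃ℝ y′ → x *ℝ y ≃ℝ x′ *ℝ y′
*ℝ-cong x x′ y y′ = close-* {seq x} {seq x′} {seq y} {seq y′} (cauchy x) (cauchy y′)

^ℝ-cong : ∀ {x x′} n → x ≃ℝ x′ → x ^ℝ n ≃ℝ x′ ^ℝ n
^ℝ-cong zero    h = close-refl (λ _ → 1ℚ)
^ℝ-cong {x} {x′} (suc n) h = *ℝ-cong x x′ (x ^ℝ n) (x′ ^ℝ n) h (^ℝ-cong n h)

weight-cong : ∀ {n p p′} → p ≃ℝ p′ → (G : Graph n) → weight p G ≃ℝ weight p′ G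
weight-cong {p = p} {p′} h G = product (entries G)
  where
  factor : ℝ → Bool → ℝ
  factor p b = if b then p else 1ℝ -ℝ p
  factor-cong : ∀ b → factor p b ≃ℝ factor p′ b
  factor-cong true  = h
  factor-cong false = close-+ {λ _ → 1ℚ} {λ _ → 1ℚ} {λ k → - seq p k} {λ k → - seq p′ k}
    (close-refl (λ _ → 1ℚ)) (close-neg {seq p} {seq p′} h)
  product : ∀ bs → productℝ (map (factor p) bs) ≃ℝ productℝ (map (factor p′) bs)
  product []       = close-refl (λ _ → 1ℚ)
  product (b ∷ bs) = *ℝ-cong (factor p b) (factor p′ b) (productℝ (map (factor p) bs)) (productℝ (map (factor p′) bs))
    (factor-cong b) (product bs)

-- `Pr` is a polynomial in p over a list of graphs that does not depend on p. This permits replacing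
-- p by its truncation.
Pr-cong : ∀ {n p p′} {A : Graph n → Set} (A? : ∀ G → Dec (A G)) → p ≃ℝ p′ → Pr p A? ≃ℝ Pr p′ A?
Pr-cong {n} {p} {p′} A? h = total (filter A? (allGraphs n))
  where
  total : ∀ Gs → sumℝ (map (weight p) Gs) ≃ℝ sumℝ (map (weight p′) Gs)
  total []       = close-refl (λ _ → 0ℚ)
  total (G ∷ Gs) = close-+ {seq (weight p G)} {seq (weight p′ G)}
    {seq (sumℝ (map (weight p) Gs))} {seq (sumℝ (map (weight p′) Gs))} (weight-cong h G) (total Gs)

-- Probabilities as expectations

bitWeight : ℚ → Bool → ℚ
bitWeight q b = if b then q else 1ℚ - q

graphWeight : ∀ {n} → ℚ → Graph n → ℚ
graphWeight q G = Π[ entries G ] (bitWeight q)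

seq-weight : ∀ {n} p k (G : Graph n) → seq (weight p G) k ≡ graphWeight (seq p k) G
seq-weight p k G = product (entries G)
  where
  factor : Bool → ℝ
  factor b = if b then p else 1ℝ -ℝ p
  seq-factor : ∀ b → seq (factor b) k ≡ bitWeight (seq p k) b
  seq-factor true  = refl
  seq-factor false = refl
  product : ∀ bs → seq (productℝ (map factor bs)) k ≡ Π[ bs ] (bitWeight (seq p k))
  product []       = refl
  product (b ∷ bs) = trans (seq-* (factor b) (productℝ (map factor bs)) k) (cong₂ _*_ (seq-factor b) (product bs))

seq-Pr : ∀ {n} {A : Graph n → Set} (A? : ∀ G → Dec (A G)) p k →
  seq (Pr p A?) k ≡ Σ[ allGraphs n ] (λ G → graphWeight (seq p k) G * 𝟙 (does (A? G)))
seq-Pr {n} {A} A? p k = total (allGraphs n)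
  where
  w : Graph n → ℚ
  w = graphWeight (seq p k)
  total : ∀ Gs → seq (sumℝ (map (weight p) (filter A? Gs))) k ≡ Σ[ Gs ] (λ G → w G * 𝟙 (does (A? G)))
  step : ∀ G Gs (d : Dec (A G)) →
    seq (sumℝ (map (weight p) (filter A? (G ∷ Gs)))) k ≡ w G * 𝟙 (does d) + Σ[ Gs ] (λ G → w G * 𝟙 (does (A? G)))
  total []       = refl
  total (G ∷ Gs) = step G Gs (A? G)
  step G Gs (yes a) = trans (cong (λ l → seq (sumℝ (map (weight p) l)) k) (List.filter-accept A? a))
    (trans (seq-+ (weight p G) (sumℝ (map (weight p) (filter A? Gs))) k)
      (cong₂ _+_ (trans (seq-weight p k G) (sym (*-identityʳ (w G)))) (total Gs)))
  step G Gs (no ¬a) = trans (cong (λ l → seq (sumℝ (map (weight p) l)) k) (List.filter-reject A? ¬a))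
    (trans (total Gs) (trans (sym (+-identityˡ rest)) (cong (_+ rest) (sym (*-zeroʳ (w G))))))
    where rest = Σ[ Gs ] (λ G → w G * 𝟙 (does (A? G)))

module _ (q : ℚ) (0≤q : 0ℚ ≤ℚ q) (q≤1 : q ≤ℚ 1ℚ) where
  open Expectation q 0≤q q≤1
  open ≡-Reasoning

  Ev-sum : ∀ n (f : Vec Bool n → ℚ) →
    Σ[ allVecs allBools n ] (λ v → Π[ toList v ] (bitWeight q) * f v) ≡ Ev f
  Ev-sum zero f = solve 1 (λ x → con 1ℚ :* x :+ con 0ℚ := x) refl (f [])
  Ev-sum (suc n) f = begin
      Σ[ allVecs allBools (suc n) ] (λ v → Π[ toList v ] (bitWeight q) * f v)
        ≡⟨ Σ-cartesian _∷_ allBools (allVecs allBools n) (λ v → Π[ toList v ] (bitWeight q) * f v) ⟩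
      half true + (half false + 0ℚ)
        ≡⟨ cong₂ _+_ (pull true) (trans (+-identityʳ (half false)) (pull false)) ⟩
      q * Ev (λ v → f (true ∷ v)) + (1ℚ - q) * Ev (λ v → f (false ∷ v)) ∎
    where
    half : Bool → ℚ
    half b = Σ[ allVecs allBools n ] (λ v → Π[ toList (b ∷ v) ] (bitWeight q) * f (b ∷ v))
    uncons : ∀ b (v : Vec Bool n) → Π[ toList (b ∷ v) ] (bitWeight q) ≡ bitWeight q b * Π[ toList v ] (bitWeight q)
    uncons b v = refl
    pull : ∀ b → half b ≡ bitWeight q b * Ev (λ v → f (b ∷ v))
    pull b = trans (Σ-cong (allVecs allBools n) (λ v → trans (cong (_* f (b ∷ v)) (uncons b v))
        (*-assoc (bitWeight q b) (Π[ toList v ] (bitWeight q)) (f (b ∷ v)))))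
      (trans (Σ-*ˡ (allVecs allBools n) (bitWeight q b) (λ v → Π[ toList v ] (bitWeight q) * f (b ∷ v)))
        (cong (bitWeight q b *_) (Ev-sum n (λ v → f (b ∷ v)))))

  -- `allGraphs` and `entries` grow by one row at a time, just as `Et` does, so the weight of t ▹
  -- row splits into that of t and that of the row.
  Et-sum : ∀ n (f : Graph n → ℚ) → Σ[ allGraphs n ] (λ G → graphWeight q G * f G) ≡ Et f
  Et-sum zero f = solve 1 (λ x → con 1ℚ :* x :+ con 0ℚ := x) refl (f [])
  Et-sum (suc n) f = begin
      Σ[ allGraphs (suc n) ] (λ G → graphWeight q G * f G)
        ≡⟨ Σ-cartesian _▹_ (allGraphs n) (allVecs allBools n) (λ G → graphWeight q G * f G) ⟩
      Σ[ allGraphs n ] (λ t → Σ[ allVecs allBools n ] (λ row → graphWeight q (t ▹ row) * f (t ▹ row)))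
        ≡⟨ Σ-cong (allGraphs n) (λ t → trans (Σ-cong (allVecs allBools n) (λ row →
               trans (cong (_* f (t ▹ row)) (unsnoc t row))
                     (*-assoc (graphWeight q t) (Π[ toList row ] (bitWeight q)) (f (t ▹ row)))))
             (trans (Σ-*ˡ (allVecs allBools n) (graphWeight q t) (λ row → Π[ toList row ] (bitWeight q) * f (t ▹ row)))
               (cong (graphWeight q t *_) (Ev-sum n (λ row → f (t ▹ row)))))) ⟩
      Σ[ allGraphs n ] (λ t → graphWeight q t * Ev (λ row → f (t ▹ row)))
        ≡⟨ Et-sum n (λ t → Ev (λ row → f (t ▹ row))) ⟩
      Et f ∎
    where
    unsnoc : ∀ t (row : Vec Bool n) → graphWeight q (t ▹ row) ≡ graphWeight q t * Π[ toList row ] (bitWeight q)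
    unsnoc t row = Π-++ (entries t) (toList row) (bitWeight q)

-- Truncation to [0, 1]

-- Approximations of a real in [0, 1] may lie slightly outside the interval, where they are not
-- probabilities and monotonicity of `Et` fails.
truncate : ℚ → ℚ
truncate x = 0ℚ ℚ.⊔ (x ℚ.⊓ 1ℚ)

0≤truncate : ∀ x → 0ℚ ≤ℚ truncate x
0≤truncate x = ℚ.p≤p⊔q 0ℚ (x ℚ.⊓ 1ℚ)

truncate≤1 : ∀ x → truncate x ≤ℚ 1ℚ
truncate≤1 x = ℚ.⊔-lub 0≤1 (ℚ.p⊓q≤q x 1ℚ)

truncate-close : ∀ {x δ} → 0ℚ ≤ℚ δ → 0ℚ ≤ℚ x + δ → x ≤ℚ 1ℚ + δ → ℚ.∣ x - truncate x ∣ ≤ℚ δ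
truncate-close {x} {δ} 0≤δ h₀ h₁ = abs-≤
  (drop-sub (≤-trans (ℚ.⊓-glb (≤-reflexive refl) h₁) (below (ℚ.≤-total x 1ℚ))))
  (≤-trans (≤-reflexive (neg-sub x (truncate x))) (drop-sub (ℚ.⊔-lub h₀
    (≤-trans (ℚ.p⊓q≤p x 1ℚ) (≤-by {x} {x + δ} δ 0≤δ (solve 2 (λ x d → (x :+ d) :- x := d) refl x δ))))))
  where
  drop-sub : ∀ {a b} → a ≤ℚ b + δ → a - b ≤ℚ δ
  drop-sub {a} {b} h = ≤-by {a - b} {δ} ((b + δ) - a) (diff-nonneg h) (solve 3 (λ a b d → d :- (a :- b) :=
    (b :+ d) :- a) refl a b δ)
  below : x ≤ℚ 1ℚ ⊎ 1ℚ ≤ℚ x → x ℚ.⊓ (1ℚ + δ) ≤ℚ truncate x + δ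
  below (inj₁ x≤1) = ≤-trans (ℚ.p⊓q≤p x (1ℚ + δ)) (≤-trans (≤-by {x} {x + δ} δ 0≤δ (solve 2 (λ x d → (x :+ d) :- x
    := d) refl x δ))
    (+-monoˡ-≤ δ (≤-trans (≤-reflexive (sym (ℚ.p≤q⇒p⊓q≡p x≤1))) (ℚ.p≤q⊔p 0ℚ (x ℚ.⊓ 1ℚ)))))
  below (inj₂ 1≤x) = ≤-trans (ℚ.p⊓q≤q x (1ℚ + δ))
    (+-monoˡ-≤ δ (≤-trans (≤-reflexive (sym (ℚ.p≥q⇒p⊓q≡q 1≤x))) (ℚ.p≤q⊔p 0ℚ (x ℚ.⊓ 1ℚ))))

module Truncated (p : ℝ) (0≤p : 0ℝ ≤ℝ p) (p≤1 : p ≤ℝ 1ℝ) where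

  close : EventuallyClose (seq p) (λ k → truncate (seq p k))
  close δ 0<δ =
    let N₁ , h₁ = 0≤p δ {{ℚ.positive 0<δ}}
        N₂ , h₂ = p≤1 δ {{ℚ.positive 0<δ}}
    in N₁ ⊔ N₂ , λ k N≤ → truncate-close (<⇒≤ 0<δ)
      (h₁ k (ℕ.m⊔n≤o⇒m≤o N₁ N₂ N≤)) (h₂ k (ℕ.m⊔n≤o⇒n≤o N₁ N₂ N≤))

  p̂ : ℝ
  p̂ = mkℝ (λ k → truncate (seq p k)) (cauchy-close {seq p} {λ k → truncate (seq p k)} (cauchy p) close)

  seq-p̂ : ∀ k → seq p̂ k ≡ truncate (seq p k)
  seq-p̂ k = refl

  probability : ∀ {n} {A : Graph n → Set} → (∀ G → Dec (A G)) → ℕ → ℚ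
  probability A? k = Expectation.Et (truncate (seq p k)) (0≤truncate (seq p k)) (truncate≤1 (seq p k)) (λ G → 𝟙 (does (A? G)))

  seq-Pr-p̂ : ∀ {n} {A : Graph n → Set} (A? : ∀ G → Dec (A G)) k → seq (Pr p̂ A?) k ≡ probability A? k
  seq-Pr-p̂ {n} A? k = trans (seq-Pr A? p̂ k)
    (trans (cong (λ q → Σ[ allGraphs n ] (λ G → graphWeight q G * 𝟙 (does (A? G)))) (seq-p̂ k))
    (Et-sum (truncate (seq p k)) (0≤truncate (seq p k)) (truncate≤1 (seq p k)) n (λ G → 𝟙 (does (A? G)))))

  probability≤1 : ∀ {n} {A : Graph n → Set} (A? : ∀ G → Dec (A G)) k → probability A? k ≤ℚ 1ℚ
  probability≤1 {n} A? k = ≤-trans (E.Et-mono (λ G → 𝟙≤1 (does (A? G)))) (≤-reflexive (E.Et-const {n} 1ℚ))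
    where module E = Expectation (truncate (seq p k)) (0≤truncate (seq p k)) (truncate≤1 (seq p k))

  -- Probabilities at truncated values never exceed 1, so a lower bound suffices; the error of
  -- truncation is absorbed by the tolerance in `_≤ℝ_`.
  Pr-near-1 : ∀ {n} {A : Graph n → Set} (A? : ∀ G → Dec (A G)) δ → 0ℚ ≤ℚ δ →
    ∃[ K ] (∀ k → K ≤ k → 1ℚ - δ ≤ℚ probability A? k) → ∣ Pr p A? -ℝ 1ℝ ∣ℝ ≤ℝ fromℚ δ
  Pr-near-1 A? δ 0≤δ (K , h) δ′ =
    let N , c = Pr-cong {p = p} {p̂} A? close δ′ (positive⁻¹ δ′)
    in K ⊔ N , λ k K≤ → estimate {seq (Pr p A?) k} {probability A? k} (h k (ℕ.m⊔n≤o⇒m≤o K N K≤)) (probability≤1 A? k)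
      (subst (λ y → ℚ.∣ seq (Pr p A?) k - y ∣ ≤ℚ δ′) (seq-Pr-p̂ A? k) (c k (ℕ.m⊔n≤o⇒n≤o K N K≤)))
    where
    open ℚ.≤-Reasoning
    estimate : ∀ {x y} → 1ℚ - δ ≤ℚ y → y ≤ℚ 1ℚ → ℚ.∣ x - y ∣ ≤ℚ δ′ → ℚ.∣ x - 1ℚ ∣ ≤ℚ δ + δ′
    estimate {x} {y} h₁ h₂ h₃ = begin
      ℚ.∣ x - 1ℚ ∣               ≤⟨ abs-triangle x y 1ℚ ⟩
      ℚ.∣ x - y ∣ + ℚ.∣ y - 1ℚ ∣
        ≤⟨ +-mono-≤ h₃ (abs-≤
             (≤-by {y - 1ℚ} {δ} (δ + (1ℚ - y)) (0≤+ 0≤δ (diff-nonneg h₂)) (solve 2 (λ y d → d :- (y :- con 1ℚ)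
               := d :+ (con 1ℚ :- y)) refl y δ))
             (≤-by { - (y - 1ℚ)} {δ} (y - (1ℚ - δ)) (diff-nonneg h₁) (solve 2 (λ y d → d :- (:- (y :- con 1ℚ))
               := y :- (con 1ℚ :- d)) refl y δ))) ⟩
      δ′ + δ                     ≡⟨ ℚ.+-comm δ′ δ ⟩
      δ + δ′ ∎

quarter : ∀ δ → 0ℚ <ℚ δ → ∃[ ε ] 0ℚ <ℚ ε × ι 4 * ε ≤ℚ 1ℚ × ι 4 * ε ≤ℚ δ
quarter δ 0<δ = recip 3 * (δ ℚ.⊓ 1ℚ) , 0<* {recip 3} {δ ℚ.⊓ 1ℚ} (0<recip 3) 0<min
    , ≤-trans (≤-reflexive four) (ℚ.p⊓q≤q δ 1ℚ) , ≤-trans (≤-reflexive four) (ℚ.p⊓q≤p δ 1ℚ)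
  where
  0<min : 0ℚ <ℚ δ ℚ.⊓ 1ℚ
  0<min = decide (ℚ.⊓-sel δ 1ℚ)
    where
    decide : δ ℚ.⊓ 1ℚ ≡ δ ⊎ δ ℚ.⊓ 1ℚ ≡ 1ℚ → 0ℚ <ℚ δ ℚ.⊓ 1ℚ
    decide (inj₁ e) = subst (0ℚ <ℚ_) (sym e) 0<δ
    decide (inj₂ e) = subst (0ℚ <ℚ_) (sym e) (positive⁻¹ 1ℚ)
  four : ι 4 * (recip 3 * (δ ℚ.⊓ 1ℚ)) ≡ δ ℚ.⊓ 1ℚ
  four = trans (sym (*-assoc (ι 4) (recip 3) (δ ℚ.⊓ 1ℚ))) (trans (cong (_* (δ ℚ.⊓ 1ℚ)) (recip-cancel 3)) (*-identityˡ (δ ℚ.⊓ 1ℚ)))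

module Sequence (p : ℕ → ℝ) (bounds : ∀ n → 0ℝ ≤ℝ p n × p n ≤ℝ 1ℝ) where

  module At (n : ℕ) = Truncated (p n) (proj₁ (bounds n)) (proj₂ (bounds n))

  aas : {A : ∀ n → Graph n → Set} (A? : ∀ n G → Dec (A n G)) →
    (∀ ε → 0ℚ <ℚ ε → ι 4 * ε ≤ℚ 1ℚ →
      ∃[ N ] (∀ i → N ≤ i → ∃[ K ] (∀ k → K ≤ k → 1ℚ - ι 4 * ε ≤ℚ At.probability (suc i) (A? (suc i)) k))) →
    AsymptoticallyAlmostSurely p A?
  aas A? h δ =
    let ε , 0<ε , 4ε≤1 , 4ε≤δ = quarter δ (positive⁻¹ δ)
        N , f = h ε 0<ε 4ε≤1
    in suc N , λ where
      (suc i) (Nat.s≤s N≤i) → At.Pr-near-1 (suc i) (A? (suc i)) δ (<⇒≤ (positive⁻¹ δ))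
        (proj₁ (f i N≤i) , λ k K≤k → ≤-trans (+-monoʳ-≤ 1ℚ (neg-antimono-≤ 4ε≤δ)) (proj₂ (f i N≤i) k K≤k))

  q : ℕ → ℕ → ℚ
  q i k = truncate (seq (p (suc i)) k)

  seq-p̂^ : ∀ i r k → seq (At.p̂ (suc i) ^ℝ r) k ≡ q i k ^ r
  seq-p̂^ i r k = trans (seq-^ (At.p̂ (suc i)) r k) (cong (_^ r) (At.seq-p̂ (suc i) k))

-- Here a and x approximate p(n)ʳ, R approximates r log n, w approximates ω(n), and u = 1/n.
sharp-tolerance : ∀ {n u d a x R w M} → n * u ≡ 1ℚ → ι 4 * (n * d) ≡ 1ℚ → 0ℚ ≤ℚ n →
  a ≤ℚ x + d → x ≤ℚ (R - w) * u + d → M + 1ℚ ≤ℚ w + ½ → n * a + M ≤ℚ R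
sharp-tolerance {n} {u} {d} {a} {x} {R} {w} {M} nu nd 0≤n h₁ h₂ h₃ = begin
    n * a + M                                ≤⟨ +-monoˡ-≤ M (*-monoˡ n 0≤n (≤-trans h₁ (+-monoˡ-≤ d h₂))) ⟩
    n * (((R - w) * u + d) + d) + M
      ≡⟨ solve 6 (λ n u d R w M → n :* (((R :- w) :* u :+ d) :+ d) :+ M
           := (n :* u) :* (R :- w) :+ con ½ :* (con (ι 4) :* (n :* d)) :+ M) refl n u d R w M ⟩
    (n * u) * (R - w) + ½ * (ι 4 * (n * d)) + M ≡⟨ cong₂ (λ a b → a * (R - w) + ½ * b + M) nu nd ⟩
    1ℚ * (R - w) + ½ * 1ℚ + M
      ≤⟨ ≤-by {1ℚ * (R - w) + ½ * 1ℚ + M} {R} ((w + ½) - (M + 1ℚ)) (diff-nonneg h₃)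
           (solve 3 (λ R w M → R :- (con 1ℚ :* (R :- w) :+ con ½ :* con 1ℚ :+ M) := (w :+ con ½) :- (M :+ con 1ℚ)) refl R w M) ⟩
    R ∎
  where
  open ℚ.≤-Reasoning

-- Case (i)
module SharpRegime (r′ : ℕ) (p : ℕ → ℝ) (bounds : ∀ n → 0ℝ ≤ℝ p n × p n ≤ℝ 1ℝ)
  (ω : ℕ → ℝ) (ω→∞ : ω ⟶∞)
  (root : ∀ n → .{{_ : NonZero n}} → p n Is suc r′ thRootOf ((fromℕ (suc r′) *ℝ log n -ℝ ω n) /ℝ n)) where

  open Sequence p bounds

  target : ℕ → ℝ
  target i = (fromℕ (suc r′) *ℝ log (suc i) -ℝ ω (suc i)) /ℝ suc i

  seq-target : ∀ i k → seq (target i) k ≡ (ι (suc r′) * logApprox i k - seq (ω (suc i)) k) * recip i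
  seq-target i k = trans (seq-* (X -ℝ W) (fromℚ (recip i)) k)
    (cong₂ _*_ (trans (seq-sub X W k) (cong (_- seq W k) (trans (seq-* (fromℕ (suc r′)) (log (suc i)) k)
      (cong₂ _*_ (seq-fromℚ (ι (suc r′)) k) (seq-log i k))))) (seq-fromℚ (recip i) k))
    where
    X = fromℕ (suc r′) *ℝ log (suc i)
    W = ω (suc i)

  result : AsymptoticallyAlmostSurely p (tc>? (suc r′) (suc r′))
  result = aas (tc>? (suc r′) (suc r′)) λ ε 0<ε 4ε≤1 →
    let module S = Sharp r′ ε 0<ε 4ε≤1
        -- The extra 1 pays for the approximations: 1/2 for ω, and 2nd = 1/2 for the two errors d =
        -- 1/(4n).
        M = ι 4 * ι S.K + 1ℚ
        N , ω-large = ω→∞ M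
    in proj₁ S.eventually ⊔ N , λ i N≤i →
      let d = recip 3 * recip i
          0<d = 0<* {recip 3} {recip i} (0<recip 3) (0<recip i)
          K₁ , c₁ = ^ℝ-cong {p (suc i)} {At.p̂ (suc i)} (suc r′) (At.close (suc i)) d 0<d
          K₂ , c₂ = proj₁ (proj₂ (root (suc i))) d {{ℚ.positive 0<d}}
          K₃ , c₃ = ω-large (suc i) (ℕ.m≤n⇒m≤1+n (ℕ.m⊔n≤o⇒n≤o (proj₁ S.eventually) N N≤i)) ½ {{ℚ.positive 0<½}}
      in K₁ ⊔ (K₂ ⊔ K₃) , λ k K≤k →
        S.sharp i (ℕ.m≤n⇒m≤1+n (ℕ.m⊔n≤o⇒m≤o (proj₁ S.eventually) N N≤i)) k (q i k)
          (0≤truncate (seq (p (suc i)) k)) (truncate≤1 (seq (p (suc i)) k))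
          (bound S.K i k (c₁ k (ℕ.m⊔n≤o⇒m≤o K₁ (K₂ ⊔ K₃) K≤k))
            (c₂ k (ℕ.m⊔n≤o⇒m≤o K₂ K₃ (ℕ.m⊔n≤o⇒n≤o K₁ (K₂ ⊔ K₃) K≤k)))
            (c₃ k (ℕ.m⊔n≤o⇒n≤o K₂ K₃ (ℕ.m⊔n≤o⇒n≤o K₁ (K₂ ⊔ K₃) K≤k))))
    where
    four-nd : ∀ i → ι 4 * (ι (suc i) * (recip 3 * recip i)) ≡ 1ℚ
    four-nd i = trans (shuffle (ι 4) (ι (suc i)) (recip 3) (recip i)) (trans (cong₂ _*_ (recip-cancel 3)
      (recip-cancel i)) (*-identityˡ 1ℚ))
      where
      shuffle : ∀ a b c d → a * (b * (c * d)) ≡ (a * c) * (b * d)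
      shuffle = solve 4 (λ a b c d → a :* (b :* (c :* d)) := (a :* c) :* (b :* d)) refl
    bound : ∀ K i k → ℚ.∣ seq (p (suc i) ^ℝ suc r′) k - seq (At.p̂ (suc i) ^ℝ suc r′) k ∣ ≤ℚ recip 3 * recip i →
      seq (p (suc i) ^ℝ suc r′) k ≤ℚ seq (target i) k + recip 3 * recip i → ι 4 * ι K + 1ℚ ≤ℚ seq (ω (suc i)) k + ½ →
      ι (suc i) * q i k ^ suc r′ + ι 4 * ι K ≤ℚ ι (suc r′) * logApprox i k
    bound K i k h₁ h₂ h₃ = sharp-tolerance {ι (suc i)} {recip i} {recip 3 * recip i} {q i k ^ suc r′}
      {seq (p (suc i) ^ℝ suc r′) k} {ι (suc r′) * logApprox i k} {seq (ω (suc i)) k} {ι 4 * ι K}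
      (recip-cancel i) (four-nd i) (0≤ι (suc i))
      (abs-≤⇒ {q i k ^ suc r′} {seq (p (suc i) ^ℝ suc r′) k} {recip 3 * recip i}
        (subst (_≤ℚ recip 3 * recip i) (trans (abs-swap (seq (p (suc i) ^ℝ suc r′) k) (seq (At.p̂ (suc i) ^ℝ suc r′) k))
          (cong (λ y → ℚ.∣ y - seq (p (suc i) ^ℝ suc r′) k ∣) (seq-p̂^ i (suc r′) k))) h₁))
      (subst (λ y → seq (p (suc i) ^ℝ suc r′) k ≤ℚ y + recip 3 * recip i) (seq-target i k) h₂) h₃

-- Products and powers of inequalities between reals

small-factor : ∀ C δ → 0ℚ ≤ℚ C → 0ℚ <ℚ δ → ∃[ η ] 0ℚ <ℚ η × η ≤ℚ 1ℚ × C * η ≤ℚ δ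
small-factor C δ 0≤C 0<δ =
  let η , η⁺ , eq = scale (C + δ) δ (ℚ.nonNeg+pos⇒pos C {{ℚ.nonNegative 0≤C}} δ {{ℚ.positive 0<δ}}) (ℚ.positive 0<δ)
      0<η = positive⁻¹ η {{η⁺}}
  in η , 0<η , at-most-1 η (<⇒≤ 0<η) eq , at-most-δ η (<⇒≤ 0<η) eq
  where
  0≤δ = <⇒≤ 0<δ
  at-most-δ : ∀ η → 0ℚ ≤ℚ η → (C + δ) * η ≡ δ → C * η ≤ℚ δ
  at-most-δ η 0≤η eq = ≤-trans (≤-by {C * η} {(C + δ) * η} (δ * η) (0≤* 0≤δ 0≤η)
    (solve 3 (λ c d e → (c :+ d) :* e :- c :* e := d :* e) refl C δ η)) (≤-reflexive eq)
  at-most-1 : ∀ η → 0ℚ ≤ℚ η → (C + δ) * η ≡ δ → η ≤ℚ 1ℚ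
  at-most-1 η 0≤η eq = *-cancelˡ {η} {1ℚ} δ 0<δ (≤-trans (≤-by {δ * η} {(C + δ) * η} (C * η) (0≤* 0≤C 0≤η)
    (solve 3 (λ c d e → (c :+ d) :* e :- d :* e := c :* e) refl C δ η)) (≤-reflexive (trans eq (sym (*-identityʳ δ)))))

-- Inequalities are multiplied termwise, whence the termwise signs. (a′ + η)(b′ + η) exceeds a′b′ by
-- (a′ + b′ + η)η ≤ (A + B + 1)η, with A and B eventual bounds.
*ℝ-mono : ∀ x x′ y y′ → (∀ k → 0ℚ ≤ℚ seq x k) → (∀ k → 0ℚ ≤ℚ seq y k) → (∀ k → 0ℚ ≤ℚ seq x′ k) → (∀ k → 0ℚ ≤ℚ seq y′ k) →
  x ≤ℝ x′ → y ≤ℝ y′ → x *ℝ y ≤ℝ x′ *ℝ y′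
*ℝ-mono x x′ y y′ hx hy hx′ hy′ xx yy δ =
  let A , A⁺ , M₁ , b₁ = bounded (seq x′) (cauchy x′)
      B , B⁺ , M₂ , b₂ = bounded (seq y′) (cauchy y′)
      0≤A = <⇒≤ (positive⁻¹ A {{A⁺}})
      0≤B = <⇒≤ (positive⁻¹ B {{B⁺}})
      η , 0<η , η≤1 , Cη≤δ = small-factor ((A + B) + 1ℚ) δ (0≤+ (0≤+ 0≤A 0≤B) 0≤1) (positive⁻¹ δ)
      N₁ , h₁ = xx η {{ℚ.positive 0<η}}
      N₂ , h₂ = yy η {{ℚ.positive 0<η}}
  in (N₁ ⊔ M₁) ⊔ (N₂ ⊔ M₂) , λ k N≤ →
    let l = ℕ.m⊔n≤o⇒m≤o (N₁ ⊔ M₁) (N₂ ⊔ M₂) N≤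
        r = ℕ.m⊔n≤o⇒n≤o (N₁ ⊔ M₁) (N₂ ⊔ M₂) N≤
    in step {seq x k} {seq x′ k} {seq y k} {seq y′ k} (<⇒≤ 0<η) η≤1 Cη≤δ (hx k) (hy k) (hx′ k) (hy′ k)
         (h₁ k (ℕ.m⊔n≤o⇒m≤o N₁ M₁ l)) (h₂ k (ℕ.m⊔n≤o⇒m≤o N₂ M₂ r))
         (≤-trans (≤-abs (seq x′ k)) (b₁ k (ℕ.m⊔n≤o⇒n≤o N₁ M₁ l))) (≤-trans (≤-abs (seq y′ k)) (b₂ k (ℕ.m⊔n≤o⇒n≤o N₂ M₂ r)))
  where
  open ℚ.≤-Reasoning
  step : ∀ {a a′ b b′ A B η} → 0ℚ ≤ℚ η → η ≤ℚ 1ℚ → ((A + B) + 1ℚ) * η ≤ℚ δ → 0ℚ ≤ℚ a → 0ℚ ≤ℚ b → 0ℚ ≤ℚ a′ → 0ℚ ≤ℚ b′ →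
    a ≤ℚ a′ + η → b ≤ℚ b′ + η → a′ ≤ℚ A → b′ ≤ℚ B → a * b ≤ℚ a′ * b′ + δ
  step {a} {a′} {b} {b′} {A} {B} {η} 0≤η η≤1 Cη≤δ 0≤a 0≤b 0≤a′ 0≤b′ ha hb a′≤A b′≤B = begin
    a * b                                  ≤⟨ *-mono 0≤a ha 0≤b hb ⟩
    (a′ + η) * (b′ + η)
      ≡⟨ solve 3 (λ a b e → (a :+ e) :* (b :+ e) := a :* b :+ ((a :+ b) :+ e) :* e) refl a′ b′ η ⟩
    a′ * b′ + ((a′ + b′) + η) * η
      ≤⟨ +-monoʳ-≤ (a′ * b′) (≤-trans (*-monoʳ η 0≤η (+-mono-≤ (+-mono-≤ a′≤A b′≤B) η≤1)) Cη≤δ) ⟩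
    a′ * b′ + δ ∎

^ℝ-mono : ∀ x y n → (∀ k → 0ℚ ≤ℚ seq x k) → (∀ k → 0ℚ ≤ℚ seq y k) → x ≤ℝ y → x ^ℝ n ≤ℝ y ^ℝ n
^ℝ-mono x y zero    hx hy h δ = 0 , λ _ _ → ≤-by {1ℚ} {1ℚ + δ} δ (<⇒≤ (positive⁻¹ δ))
  (solve 1 (λ d → (con 1ℚ :+ d) :- con 1ℚ := d) refl δ)
^ℝ-mono x y (suc n) hx hy h = *ℝ-mono x y (x ^ℝ n) (y ^ℝ n) hx (0≤power x hx) hy (0≤power y hy) h (^ℝ-mono x y n hx hy h)
  where
  0≤power : ∀ w → (∀ k → 0ℚ ≤ℚ seq w k) → ∀ k → 0ℚ ≤ℚ seq (w ^ℝ n) k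
  0≤power w hw k = subst (0ℚ ≤ℚ_) (sym (seq-^ w n k)) (0≤^ n (hw k))

abs-^ : ∀ a n → ℚ.∣ a ∣ ^ n ≡ ℚ.∣ a ^ n ∣
abs-^ a zero    = refl
abs-^ a (suc n) = trans (cong (ℚ.∣ a ∣ *_) (abs-^ a n)) (sym (ℚ.∣p*q∣≡∣p∣*∣q∣ a (a ^ n)))

𝟙-mono : ∀ {P Q : Set} (P? : Dec P) (Q? : Dec Q) → (P → Q) → 𝟙 (does P?) ≤ℚ 𝟙 (does Q?)
𝟙-mono (no _)  Q?      f = 0≤𝟙 (does Q?)
𝟙-mono (yes p) (yes _) f = ≤-refl
𝟙-mono (yes p) (no ¬q) f = contradiction (f p) ¬q

-- For n ≥ 2, the first Mercator term is already 1 - 1/n ≥ 1/2. A positive lower bound for L is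
-- needed to absorb additive errors into δL.
½≤log : ∀ i k → ½ ≤ℚ logApprox (suc i) (suc k)
½≤log i k = ≤-trans
  (≤-trans (+-monoʳ-≤ 1ℚ (neg-antimono-≤ (1/-anti 1 (suc i) (Nat.s≤s Nat.z≤n)))) (≤-reflexive (sym (1-1/n≡ (suc i)))))
  (mercator-≥ k (0≤1-1/n (suc i)))

-- Here a approximates p(n)ʳ, x approximates r log n / n, e = cʳ where p ≤ c f, and u = 1/n.
weak-tolerance : ∀ {n u d a e x R L δ} → n * u ≡ 1ℚ → ι 8 * (n * d) ≡ δ → 0ℚ ≤ℚ n → 0ℚ ≤ℚ e → e ≤ℚ 1ℚ →
  0ℚ ≤ℚ δ → ½ ≤ℚ L → (ι 2 * R) * e ≤ℚ δ → a ≤ℚ e * x + d → x ≤ℚ (R * L) * u + d → n * a ≤ℚ δ * L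
weak-tolerance {n} {u} {d} {a} {e} {x} {R} {L} {δ} nu nd 0≤n 0≤e e≤1 0≤δ ½≤L Re≤δ h₁ h₂ = begin
    n * a
      ≤⟨ *-monoˡ n 0≤n (≤-trans h₁ (+-monoˡ-≤ d (*-monoˡ e 0≤e h₂))) ⟩
    n * (e * ((R * L) * u + d) + d)
      ≡⟨ solve 6 (λ n u d e R L → n :* (e :* ((R :* L) :* u :+ d) :+ d)
           := (n :* u) :* (e :* (R :* L)) :+ con eighth :* ((e :+ con 1ℚ) :* (con (ι 8) :* (n :* d)))) refl n u d e R L ⟩
    (n * u) * (e * (R * L)) + eighth * ((e + 1ℚ) * (ι 8 * (n * d)))
      ≡⟨ cong₂ (λ x y → x * (e * (R * L)) + eighth * ((e + 1ℚ) * y)) nu nd ⟩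
    1ℚ * (e * (R * L)) + eighth * ((e + 1ℚ) * δ)
      ≤⟨ ≤-by {1ℚ * (e * (R * L)) + eighth * ((e + 1ℚ) * δ)} {δ * L}
           (½ * ((δ - (ι 2 * R) * e) * L) + ½ * (δ * (L - ½)) + eighth * ((1ℚ - e) * δ))
           (0≤+ (0≤+ (0≤* 0≤½ (0≤* (diff-nonneg Re≤δ) (≤-trans 0≤½ ½≤L))) (0≤* 0≤½ (0≤* 0≤δ (diff-nonneg ½≤L))))
             (0≤* (0≤recip 7) (0≤* (diff-nonneg e≤1) 0≤δ)))
           (solve 4 (λ e R L D → D :* L :- (con 1ℚ :* (e :* (R :* L)) :+ con eighth :* ((e :+ con 1ℚ) :* D))
             := con ½ :* ((D :- (con (ι 2) :* R) :* e) :* L) :+ con ½ :* (D :* (L :- con ½)) :+ con eighth :*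
               ((con 1ℚ :- e) :* D)) refl e R L δ) ⟩
    δ * L ∎
  where
  open ℚ.≤-Reasoning
  eighth : ℚ
  eighth = recip 7
  0≤½ = <⇒≤ 0<½

abs-near : ∀ {x y d} → 0ℚ ≤ℚ y → x ≤ℚ y + d → y ≤ℚ x + d → ℚ.∣ x ∣ ≤ℚ y + d
abs-near {x} {y} {d} 0≤y h₁ h₂ = abs-≤ h₁ (≤-by { - x} {y + d} (((x + d) - y) + (y + y)) (0≤+ (diff-nonneg h₂) (0≤+ 0≤y 0≤y))
  (solve 3 (λ x y d → (y :+ d) :- (:- x) := ((x :+ d) :- y) :+ (y :+ y)) refl x y d))

-- Case (ii)
module WeakRegime (r′ : ℕ) (p : ℕ → ℝ) (bounds : ∀ n → 0ℝ ≤ℝ p n × p n ≤ℝ 1ℝ) (f : ℕ → ℝ)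
  (root : ∀ n → .{{_ : NonZero n}} → f n Is suc r′ thRootOf ((fromℕ (suc r′) *ℝ log n) /ℝ n)) (p=of : p =o f) (K : ℕ) where

  open Sequence p bounds

  target : ℕ → ℝ
  target i = (fromℕ (suc r′) *ℝ log (suc i)) /ℝ suc i

  seq-target : ∀ i k → seq (target i) k ≡ (ι (suc r′) * logApprox i k) * recip i
  seq-target i k = trans (seq-* (fromℕ (suc r′) *ℝ log (suc i)) (fromℚ (recip i)) k)
    (cong₂ _*_ (trans (seq-* (fromℕ (suc r′)) (log (suc i)) k)
      (cong₂ _*_ (seq-fromℚ (ι (suc r′)) k) (seq-log i k))) (seq-fromℚ (recip i) k))

  0≤target : ∀ i k → 0ℚ ≤ℚ (ι (suc r′) * logApprox i k) * recip i
  0≤target i k = 0≤* (0≤* (0≤ι (suc r′)) (0≤log i k)) (0≤recip i)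

  -- The bound c |f| for p. Only its r-th power c^r |f^r| is evaluated, where f^r is the known
  -- expression r log n / n.
  envelope : ℚ → ℕ → ℝ
  envelope c i = fromℚ c *ℝ ∣ f (suc i) ∣ℝ

  seq-envelope^ : ∀ c i k → seq (envelope c i ^ℝ suc r′) k ≡ c ^ suc r′ * ℚ.∣ seq (f (suc i) ^ℝ suc r′) k ∣
  seq-envelope^ c i k = trans (seq-^ (envelope c i) (suc r′) k)
    (trans (cong (_^ suc r′) (trans (seq-* (fromℚ c) ∣ f (suc i) ∣ℝ k) (cong₂ _*_ (seq-fromℚ c k) (seq-∣∣ (f (suc i)) k))))
    (trans (Exp.^-distrib-* c ℚ.∣ seq (f (suc i)) k ∣ (suc r′)) (cong (c ^ suc r′ *_)
      (trans (abs-^ (seq (f (suc i)) k) (suc r′)) (cong ℚ.∣_∣ (sym (seq-^ (f (suc i)) (suc r′) k)))))))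

  p̂≤envelope : ∀ c i → ∣ p (suc i) ∣ℝ ≤ℝ fromℚ c *ℝ ∣ f (suc i) ∣ℝ → At.p̂ (suc i) ≤ℝ envelope c i
  p̂≤envelope c i h δ =
    let 0<½δ = 0<* {½} {δ} 0<½ (positive⁻¹ δ)
        N₁ , h₁ = h (½ * δ) {{ℚ.positive 0<½δ}}
        N₂ , h₂ = At.close (suc i) (½ * δ) 0<½δ
    in N₁ ⊔ N₂ , λ k N≤ → step {truncate (seq (p (suc i)) k)} {seq (p (suc i)) k} {seq (envelope c i) k}
      (h₁ k (ℕ.m⊔n≤o⇒m≤o N₁ N₂ N≤)) (h₂ k (ℕ.m⊔n≤o⇒n≤o N₁ N₂ N≤))
    where
    open ℚ.≤-Reasoning
    step : ∀ {x y z} → ℚ.∣ y ∣ ≤ℚ z + ½ * δ → ℚ.∣ y - x ∣ ≤ℚ ½ * δ → x ≤ℚ z + δ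
    step {x} {y} {z} hy hx = begin
      x                       ≤⟨ abs-≤⇒ {x} {y} {½ * δ} (subst (_≤ℚ ½ * δ) (abs-swap y x) hx) ⟩
      y + ½ * δ               ≤⟨ +-monoˡ-≤ (½ * δ) (≤-trans (≤-abs y) hy) ⟩
      (z + ½ * δ) + ½ * δ     ≡⟨ trans (ℚ.+-assoc z (½ * δ) (½ * δ)) (cong (z +_) (½+½ δ)) ⟩
      z + δ ∎

  result : AsymptoticallyAlmostSurely p (tc>? (suc r′) K)
  result = aas (tc>? (suc r′) K) λ ε 0<ε 4ε≤1 →
    let module W = Weak r′ K ε 0<ε 4ε≤1
        -- c ≤ 1 gives c^r ≤ c, so that 2 r c ≤ δ also controls c^r.
        c , 0<c , c≤1 , Rc≤δ = small-factor (ι 2 * ι (suc r′)) W.δ (0≤* (0≤ι 2) (0≤ι (suc r′))) W.0<δ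
        N , p≤ = p=of c {{ℚ.positive 0<c}}
    -- The successor leaves out n = 1, where log n = 0; likewise the empty Mercator sum is skipped
    -- below. Both would violate `½≤log`.
    in suc (proj₁ W.eventually ⊔ N) , λ where
      (suc i) (Nat.s≤s N≤i) →
        let d = W.δ * (recip 7 * recip (suc i))
            0<d = 0<* {W.δ} {recip 7 * recip (suc i)} W.0<δ (0<* {recip 7} {recip (suc i)} (0<recip 7) (0<recip (suc i)))
            K₁ , c₁ = ^ℝ-mono (At.p̂ (suc (suc i))) (envelope c (suc i)) (suc r′)
              (λ k → 0≤truncate (seq (p (suc (suc i))) k)) (λ k → 0≤* (<⇒≤ 0<c) (ℚ.0≤∣p∣ (seq (f (suc (suc i))) k)))
              (p̂≤envelope c (suc i) (p≤ (suc (suc i)) (ℕ.m≤n⇒m≤1+n (ℕ.m≤n⇒m≤1+n (ℕ.m⊔n≤o⇒n≤o (proj₁ W.eventually) N N≤i)))))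
              d {{ℚ.positive 0<d}}
            K₂ , c₂ = proj₁ (proj₂ (root (suc (suc i)))) d {{ℚ.positive 0<d}}
            K₃ , c₃ = proj₂ (proj₂ (root (suc (suc i)))) d {{ℚ.positive 0<d}}
        in suc (K₁ ⊔ (K₂ ⊔ K₃)) , λ where
          (suc k) (Nat.s≤s K≤k) →
            let K≤ = ℕ.m≤n⇒m≤1+n K≤k
            in ≤-trans
              (W.weak (suc i) (ℕ.m≤n⇒m≤1+n (ℕ.m≤n⇒m≤1+n (ℕ.m⊔n≤o⇒m≤o (proj₁ W.eventually) N N≤i))) (suc k) (q (suc i) (suc k))
                (0≤truncate (seq (p (suc (suc i))) (suc k))) (truncate≤1 (seq (p (suc (suc i))) (suc k)))
                (bound c W.δ (<⇒≤ 0<c) c≤1 (<⇒≤ W.0<δ) Rc≤δ (suc i) (suc k) (½≤log i k)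
                  (c₁ (suc k) (ℕ.m⊔n≤o⇒m≤o K₁ (K₂ ⊔ K₃) K≤))
                  (c₂ (suc k) (ℕ.m⊔n≤o⇒m≤o K₂ K₃ (ℕ.m⊔n≤o⇒n≤o K₁ (K₂ ⊔ K₃) K≤)))
                  (c₃ (suc k) (ℕ.m⊔n≤o⇒n≤o K₂ K₃ (ℕ.m⊔n≤o⇒n≤o K₁ (K₂ ⊔ K₃) K≤)))))
              -- `Weak` is used with t = K + 1, which is positive also for K = 0; tc > K + 1 is then
              -- weakened to tc > K.
              (Expectation.Et-mono (truncate (seq (p (suc (suc i))) (suc k))) (0≤truncate (seq (p (suc (suc i)))
                (suc k))) (truncate≤1 (seq (p (suc (suc i))) (suc k)))
                (λ G → 𝟙-mono (tc>? (suc r′) (suc K) (suc (suc i)) G) (tc>? (suc r′) K (suc (suc i)) G) ℕ.<⇒≤))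
    where
    eight-nd : ∀ δ i → ι 8 * (ι (suc i) * (δ * (recip 7 * recip i))) ≡ δ
    eight-nd δ i = trans (shuffle (ι 8) (ι (suc i)) δ (recip 7) (recip i))
        (trans (cong₂ (λ a b → δ * (a * b)) (recip-cancel 7) (recip-cancel i)) (trans (cong (δ *_)
          (*-identityˡ 1ℚ)) (*-identityʳ δ)))
      where
      shuffle : ∀ a b e c d → a * (b * (e * (c * d))) ≡ e * ((a * c) * (b * d))
      shuffle = solve 5 (λ a b e c d → a :* (b :* (e :* (c :* d))) := e :* ((a :* c) :* (b :* d))) refl
    bound : ∀ c δ → 0ℚ ≤ℚ c → c ≤ℚ 1ℚ → 0ℚ ≤ℚ δ → (ι 2 * ι (suc r′)) * c ≤ℚ δ → ∀ i k → ½ ≤ℚ logApprox i k →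
      seq (At.p̂ (suc i) ^ℝ suc r′) k ≤ℚ seq (envelope c i ^ℝ suc r′) k + δ * (recip 7 * recip i) →
      seq (f (suc i) ^ℝ suc r′) k ≤ℚ seq (target i) k + δ * (recip 7 * recip i) →
      seq (target i) k ≤ℚ seq (f (suc i) ^ℝ suc r′) k + δ * (recip 7 * recip i) →
      ι (suc i) * q i k ^ suc r′ ≤ℚ δ * logApprox i k
    bound c δ 0≤c c≤1 0≤δ Rc≤δ i k ½≤L h₁ h₂ h₃ =
      weak-tolerance {ι (suc i)} {recip i} {δ * (recip 7 * recip i)} {q i k ^ suc r′} {c ^ suc r′}
        {ℚ.∣ seq (f (suc i) ^ℝ suc r′) k ∣} {ι (suc r′)} {logApprox i k} {δ}
        (recip-cancel i) (eight-nd δ i) (0≤ι (suc i)) (0≤^ (suc r′) 0≤c) (^≤1 (suc r′) 0≤c c≤1) 0≤δ ½≤L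
        (≤-trans (*-monoˡ {c ^ suc r′} {c} (ι 2 * ι (suc r′)) (0≤* (0≤ι 2) (0≤ι (suc r′))) (*≤ˡ {c} {c ^ r′} 0≤c
          (^≤1 {c} r′ 0≤c c≤1))) Rc≤δ)
        (subst₂ (λ x y → x ≤ℚ y + δ * (recip 7 * recip i)) (seq-p̂^ i (suc r′) k) (seq-envelope^ c i k) h₁)
        (abs-near {seq (f (suc i) ^ℝ suc r′) k} {(ι (suc r′) * logApprox i k) * recip i} (0≤target i k)
          (subst (λ y → seq (f (suc i) ^ℝ suc r′) k ≤ℚ y + δ * (recip 7 * recip i)) (seq-target i k) h₂)
          (subst (λ y → y ≤ℚ seq (f (suc i) ^ℝ suc r′) k + δ * (recip 7 * recip i)) (seq-target i k) h₃))

theorem1p7 : (r : ℕ) → 2 ≤ r →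
    (p : ℕ → ℝ) → (∀ n → 0ℝ ≤ℝ p n × p n ≤ℝ 1ℝ) →
    ((ω : ℕ → ℝ) → ω ⟶∞ →
    (∀ n → .{{_ : NonZero n}} → p n Is r thRootOf ((fromℕ r *ℝ log n -ℝ ω n) /ℝ n)) →
    AsymptoticallyAlmostSurely p (tc>? r r))
    ×
    ((f : ℕ → ℝ) →
    (∀ n → .{{_ : NonZero n}} → f n Is r thRootOf ((fromℕ r *ℝ log n) /ℝ n)) →
    p =o f →
    ∀ K → AsymptoticallyAlmostSurely p (tc>? r K))
theorem1p7 (suc r′) _ p bounds =
    (λ ω ω→∞ root → SharpRegime.result r′ p bounds ω ω→∞ root)
  , (λ f root p=of K → WeakRegime.result r′ p bounds f root p=of K)
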